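{- For all integers $n \ge 32$ and $0 \le k \le n$ with $n-k$ even, there exists a CMDRR$(n,k)$.
   Context: A mixed doubles game is a match between two teams, each team consisting of one man and one woman; in a game $M_a F_b$ v $M_c F_d$, $M_a$ and $F_b$ are partners, $M_c$ and $F_d$ are partners, and each player of one team opposes each player of the other team. A complete mixed doubles round robin tournament CMDRR$(n,k)$ is a schedule (set) of mixed doubles games for $n$ men and $n$ women, of which $k$ men and $k$ women are paired into $k$ spouse pairs (a spouse pair is one man and one woman), such that: spouses never play in a game together as partners or opponents; every man and woman who are not spouses are partners exactly once and opponents exactly once; each player who has a spouse opposes every other player of the same sex exactly once; each player who does not have a spouse opposes some other same-sex player who does not have a spouse exactly twice and opposes all other same-sex players exactly once. -}

module Defs where

open import Data.Fin using (Fin)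
open import Data.Fin.Properties using (_≟_)
open import Data.List using (List; length; filter)
open import Data.Nat using (ℕ)
open import Data.Product using (∃-syntax; _×_)
open import Data.Sum using (_⊎_)
open import Function.Bundles using (_↣_; Injection)
open import Relation.Binary.PropositionalEquality using (_≡_; _≢_)
open import Relation.Nullary using (¬_)
open import Relation.Nullary.Decidable using (_×-dec_; _⊎-dec_)
open import Relation.Unary using (Decidable)

private
  variable
    n : ℕ

Man Woman : ℕ → Set
Man n = Fin n
Woman n = Fin n

record Team (n : ℕ) : Set where
  constructor M_F_
  field
    man   : Man n
    woman : Woman n

open Team public

record Game (n : ℕ) : Set where
  constructor game
  field
    team₁ team₂    : Team n
    distinct-men   : man team₁ ≢ man team₂
    distinct-women : woman team₁ ≢ woman team₂

open Game public

-- The two teams of a game play symmetric roles, so each relation below is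
-- invariant under exchanging team₁ and team₂.

Partners : Man n → Woman n → Game n → Set
Partners m f g = (man (team₁ g) ≡ m × woman (team₁ g) ≡ f)
               ⊎ (man (team₂ g) ≡ m × woman (team₂ g) ≡ f)

OpponentsMF : Man n → Woman n → Game n → Set
OpponentsMF m f g = (man (team₁ g) ≡ m × woman (team₂ g) ≡ f)
                  ⊎ (man (team₂ g) ≡ m × woman (team₁ g) ≡ f)

OpponentsMM : Man n → Man n → Game n → Set
OpponentsMM m m′ g = (man (team₁ g) ≡ m × man (team₂ g) ≡ m′)
                   ⊎ (man (team₂ g) ≡ m × man (team₁ g) ≡ m′)

OpponentsFF : Woman n → Woman n → Game n → Set
OpponentsFF f f′ g = (woman (team₁ g) ≡ f × woman (team₂ g) ≡ f′)
                   ⊎ (woman (team₂ g) ≡ f × woman (team₁ g) ≡ f′)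

partners? : (m : Man n) (f : Woman n) → Decidable (Partners m f)
partners? m f g = ((man (team₁ g) ≟ m) ×-dec (woman (team₁ g) ≟ f))
            ⊎-dec ((man (team₂ g) ≟ m) ×-dec (woman (team₂ g) ≟ f))

opponentsMF? : (m : Man n) (f : Woman n) → Decidable (OpponentsMF m f)
opponentsMF? m f g = ((man (team₁ g) ≟ m) ×-dec (woman (team₂ g) ≟ f))
               ⊎-dec ((man (team₂ g) ≟ m) ×-dec (woman (team₁ g) ≟ f))

opponentsMM? : (m m′ : Man n) → Decidable (OpponentsMM m m′)
opponentsMM? m m′ g = ((man (team₁ g) ≟ m) ×-dec (man (team₂ g) ≟ m′))
                ⊎-dec ((man (team₂ g) ≟ m) ×-dec (man (team₁ g) ≟ m′))

opponentsFF? : (f f′ : Woman n) → Decidable (OpponentsFF f f′)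
opponentsFF? f f′ g = ((woman (team₁ g) ≟ f) ×-dec (woman (team₂ g) ≟ f′))
                ⊎-dec ((woman (team₂ g) ≟ f) ×-dec (woman (team₁ g) ≟ f′))

-- Number of games, with multiplicity, that satisfy a decidable property.
count : {P : Game n → Set} → Decidable P → List (Game n) → ℕ
count P? gs = length (filter P? gs)

-- The opposition requirements among the n players of one sex, where
-- `meetings p q` is the number of games in which p opposes q.
record SameSexOpposition {n : ℕ} (HasSpouse : Fin n → Set)
                         (meetings : Fin n → Fin n → ℕ) : Set where
  field
    with-spouse    : ∀ p → HasSpouse p → ∀ q → q ≢ p → meetings p q ≡ 1
    without-spouse : ∀ p → ¬ HasSpouse p →
      ∃[ r ] ( r ≢ p
             × ¬ HasSpouse r
             × meetings p r ≡ 2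
             × (∀ q → q ≢ p → q ≢ r → meetings p q ≡ 1))

-- The s-th spouse pair is (husband s, wife s); injectivity makes the k pairs
-- disjoint.
record SpousePairs (n k : ℕ) : Set where
  field
    husbands : Fin k ↣ Man n
    wives    : Fin k ↣ Woman n

  husband : Fin k → Man n
  husband = Injection.to husbands

  wife : Fin k → Woman n
  wife = Injection.to wives

  Spouses : Man n → Woman n → Set
  Spouses m f = ∃[ s ] (husband s ≡ m × wife s ≡ f)

  IsHusband : Man n → Set
  IsHusband m = ∃[ s ] husband s ≡ m

  IsWife : Woman n → Set
  IsWife f = ∃[ s ] wife s ≡ f

-- The set of games is given as a list.  A repeated game (also with its teams
-- exchanged) would make some partnership occur twice, which the partnership
-- counts exclude, so the list has no repetitions.
record CMDRR (n k : ℕ) : Set where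
  field
    spousePairs : SpousePairs n k
    games       : List (Game n)

  open SpousePairs spousePairs public

  field
    spouses-not-partners  : ∀ m f → Spouses m f → count (partners? m f) games ≡ 0
    spouses-not-opponents : ∀ m f → Spouses m f → count (opponentsMF? m f) games ≡ 0
    partners-once         : ∀ m f → ¬ Spouses m f → count (partners? m f) games ≡ 1
    opponents-once        : ∀ m f → ¬ Spouses m f → count (opponentsMF? m f) games ≡ 1
    men-oppose            : SameSexOpposition IsHusband (λ m m′ → count (opponentsMM? m m′) games)
    women-oppose          : SameSexOpposition IsWife (λ f f′ → count (opponentsFF? f f′) games)

-- A transversal design with D full groups of size m and one group truncated to u points has blocks of
-- D or D + 1 points.  Self-orthogonal Latin squares give tournaments in which every player has a spouse;
-- put these on the full groups and on the blocks outside one parallel class, and tournaments in which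
-- some players have no spouse on the truncated group and on the blocks of that class.  Since the blocks
-- of the class are disjoint, this gives a tournament for D m + u couples whose number of spouse pairs
-- runs through an arithmetic progression.
--
-- For D = 4, with blocks of 4 points having 0 or 4 spouse pairs, and m coprime to 6, where the blocks are
-- the lines y = q + λ p over ℤ/m with λ = 0 , … , 4, every n ≥ 240 reduces to some u with 32 ≤ u ≤ m.
-- For n < 240 finitely many such progressions, with D = 4 , 8 , 10 over ℤ/m, GF(8), GF(9) and GF(16), two
-- variants of the construction and explicit small tournaments and squares, cover all numbers of pairs.
module Submission where

open import Defs

-- A player without a spouse meets one player of the same sex twice and also meets, as partner and
-- as opponent, the player of the other sex with the same index. When tournaments are glued along
-- lines, these extra meetings must come from one line only. So each player may lack a spouse on at
-- most one line. This is why a block of the parallel class always gives its point of the truncated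
-- group a spouse: whether that point has one is decided inside the truncated group. Blocks of `D`
-- points without any spouse force `D` to be even, and both `D` and `D + 1` must be orders of
-- self-orthogonal squares. No such square has order 2, 3 or 6, which leaves 4, 8, 10 as the first
-- choices. Blocks of 4 points change the number of pairs by 4 at a time, so its residue modulo 4
-- has to be supplied by the truncated group. That group needs tournaments of its own size with
-- various numbers of pairs, hence an induction on `n` that only reaches down to 32 and has no
-- separate base case: small `n` must be settled from explicit data.

-- Gluing tournaments along the lines of a pairwise balanced design.

module Composition where

  open import Data.Bool using (Bool; true; false)
  open import Data.Bool.Properties using (¬-not)
  open import Data.Empty using (⊥)
  open import Data.Fin using (Fin)
  open import Data.Fin.Properties using (_≟_; any?)
  open import Data.List using (List; []; _∷_; _++_; length; filter; map; concatMap)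
  open import Data.List.Membership.Propositional using (_∈_)
  open import Data.List.Properties using (length-++; filter-++)
  open import Data.List.Relation.Unary.All using (lookup)
  open import Data.List.Relation.Unary.AllPairs using (_∷_)
  open import Data.List.Relation.Unary.Any using (here; there)
  open import Data.List.Relation.Unary.Unique.Propositional using (Unique)
  open import Data.Nat using (ℕ; _+_)
  open import Data.Nat.Properties using (+-identityʳ)
  open import Data.Product using (∃; ∃₂; _×_; _,_; proj₁; proj₂)
  open import Data.Sum using (_⊎_; inj₁; inj₂)
  open import Function using (_∘_)
  open import Function.Definitions using (Injective)
  open import Relation.Binary.PropositionalEquality
    using (_≡_; _≢_; refl; sym; trans; cong; cong₂; subst; ≢-sym)
  open import Relation.Nullary using (¬_; yes; no; contradiction)
  open import Relation.Nullary.Decidable using (_×-dec_; _⊎-dec_)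
  open import Relation.Unary using (Decidable)

  private
    variable
      n s : ℕ

  data Meeting : Set where
    partnersᴹ opponentsᴹ menᴹ womenᴹ : Meeting

  left right : Meeting → Game n → Fin n × Fin n
  left  partnersᴹ  g = man (team₁ g) , woman (team₁ g)
  left  opponentsᴹ g = man (team₁ g) , woman (team₂ g)
  left  menᴹ       g = man (team₁ g) , man (team₂ g)
  left  womenᴹ     g = woman (team₁ g) , woman (team₂ g)
  right partnersᴹ  g = man (team₂ g) , woman (team₂ g)
  right opponentsᴹ g = man (team₂ g) , woman (team₁ g)
  right menᴹ       g = man (team₂ g) , man (team₁ g)
  right womenᴹ     g = woman (team₂ g) , woman (team₁ g)

  -- For each of the four kinds of meeting, Meets and meets? unfold to the
  -- corresponding relation of Defs and its decision procedure.
  Meets : Meeting → Fin n → Fin n → Game n → Set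
  Meets r x y g = (proj₁ (left r g) ≡ x × proj₂ (left r g) ≡ y)
                ⊎ (proj₁ (right r g) ≡ x × proj₂ (right r g) ≡ y)

  meets? : ∀ r (x y : Fin n) → Decidable (Meets r x y)
  meets? r x y g = ((proj₁ (left r g) ≟ x) ×-dec (proj₂ (left r g) ≟ y))
             ⊎-dec ((proj₁ (right r g) ≟ x) ×-dec (proj₂ (right r g) ≟ y))

  meetings : Meeting → List (Game n) → Fin n → Fin n → ℕ
  meetings r gs x y = count (meets? r x y) gs

  -- Partners and opponents obey the same rule, so one record serves both. Spouses share an index,
  -- which makes the spouse condition one about the diagonal `meets x x`.
  record MixedMeetings (S : Fin n → Bool) (meets : Fin n → Fin n → ℕ) : Set where
    field
      spouses : ∀ x → S x ≡ true → meets x x ≡ 0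
      others  : ∀ x y → ¬ (x ≡ y × S x ≡ true) → meets x y ≡ 1

  -- A tournament in which man x and woman x are spouses exactly when S x is true.
  record Tournament (n : ℕ) (S : Fin n → Bool) : Set where
    field
      games     : List (Game n)
      partners  : MixedMeetings S (meetings partnersᴹ games)
      opponents : MixedMeetings S (meetings opponentsᴹ games)
      men       : SameSexOpposition (λ x → S x ≡ true) (meetings menᴹ games)
      women     : SameSexOpposition (λ x → S x ≡ true) (meetings womenᴹ games)

  module _ {S S′ : Fin n → Bool} (S≗S′ : ∀ x → S x ≡ S′ x) where

    private
      to : ∀ {x} → S′ x ≡ true → S x ≡ true
      to = trans (S≗S′ _)

      from : ∀ {x} → S x ≡ true → S′ x ≡ true
      from = trans (sym (S≗S′ _))

      mixed : ∀ {M} → MixedMeetings S M → MixedMeetings S′ M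
      mixed h = record
        { spouses = λ x → spouses x ∘ to
        ; others  = λ x y ¬p → others x y (λ (e , p) → ¬p (e , from p))
        } where open MixedMeetings h

      same : ∀ {M} → SameSexOpposition (λ x → S x ≡ true) M → SameSexOpposition (λ x → S′ x ≡ true) M
      same h = record
        { with-spouse    = λ x → with-spouse x ∘ to
        ; without-spouse = λ x ¬p → let r , r≢x , ¬r , two , one = without-spouse x (¬p ∘ from)
                                    in r , r≢x , ¬r ∘ to , two , one
        } where open SameSexOpposition h

    -- Statuses built in different ways agree only pointwise. Without function extensionality a
    -- tournament has to be carried along such an agreement.
    Tournament-resp : Tournament n S → Tournament n S′
    Tournament-resp T = record
      { games = games ; partners = mixed partners ; opponents = mixed opponents
      ; men = same men ; women = same women }
      where open Tournament T

  module _ {A : Set} {P : A → Set} (P? : Decidable P) where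

    private
      countA : List A → ℕ
      countA xs = length (filter P? xs)

    count-none : ∀ xs → (∀ x → ¬ P x) → countA xs ≡ 0
    count-none []       ¬P = refl
    count-none (x ∷ xs) ¬P with P? x
    ... | yes p = contradiction p (¬P x)
    ... | no  _ = count-none xs ¬P

    count-map : ∀ {B : Set} {Q : B → Set} (Q? : Decidable Q) (f : B → A) →
                (∀ b → P (f b) → Q b) → (∀ b → Q b → P (f b)) →
                ∀ bs → countA (map f bs) ≡ length (filter Q? bs)
    count-map Q? f to from []       = refl
    count-map Q? f to from (b ∷ bs) with P? (f b) | Q? b
    ... | yes p | yes q = cong ℕ.suc (count-map Q? f to from bs)
    ... | yes p | no ¬q = contradiction (to b p) ¬q
    ... | no ¬p | yes q = contradiction (from b q) ¬p
    ... | no ¬p | no ¬q = count-map Q? f to from bs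

    count-++ : ∀ xs ys → countA (xs ++ ys) ≡ countA xs + countA ys
    count-++ xs ys = trans (cong length (filter-++ P? xs ys)) (length-++ (filter P? xs))

    module _ {I : Set} (f : I → List A) where

      count-concatMap-zero : ∀ L → (∀ {c} → c ∈ L → countA (f c) ≡ 0) → countA (concatMap f L) ≡ 0
      count-concatMap-zero []      _ = refl
      count-concatMap-zero (c ∷ L) h =
        trans (count-++ (f c) _) (cong₂ _+_ (h (here refl)) (count-concatMap-zero L (h ∘ there)))

      -- The counting form of the fact that one line serves a given pair of players: that line
      -- contributes `v`, all others nothing, and `Unique L` excludes counting it twice.
      count-concatMap : ∀ {L c v} → Unique L → c ∈ L → countA (f c) ≡ v →
                        (∀ c′ → c′ ≢ c → countA (f c′) ≡ 0) → countA (concatMap f L) ≡ v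
      count-concatMap {c ∷ L} (c∉L ∷ _) (here refl) eq zeros =
        trans (count-++ (f c) _)
          (trans (cong₂ _+_ eq (count-concatMap-zero L λ {c′} c′∈L → zeros c′ λ { refl → lookup c∉L c′∈L refl }))
                 (+-identityʳ _))
      count-concatMap {c′ ∷ L} (c′∉L ∷ u) (there c∈L) eq zeros =
        trans (count-++ (f c′) _)
          (cong₂ _+_ (zeros c′ (lookup c′∉L c∈L)) (count-concatMap u c∈L eq zeros))

  mapGame : (ι : Fin s → Fin n) → Injective _≡_ _≡_ ι → Game s → Game n
  mapGame ι inj g = record
    { team₁ = M ι (man (team₁ g)) F ι (woman (team₁ g))
    ; team₂ = M ι (man (team₂ g)) F ι (woman (team₂ g))
    ; distinct-men   = distinct-men g ∘ inj
    ; distinct-women = distinct-women g ∘ inj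
    }

  module _ (ι : Fin s → Fin n) (inj : Injective _≡_ _≡_ ι) where

    private
      left-map : ∀ r g → left r (mapGame ι inj g) ≡ (ι (proj₁ (left r g)) , ι (proj₂ (left r g)))
      left-map partnersᴹ  g = refl
      left-map opponentsᴹ g = refl
      left-map menᴹ       g = refl
      left-map womenᴹ     g = refl

      right-map : ∀ r g → right r (mapGame ι inj g) ≡ (ι (proj₁ (right r g)) , ι (proj₂ (right r g)))
      right-map partnersᴹ  g = refl
      right-map opponentsᴹ g = refl
      right-map menᴹ       g = refl
      right-map womenᴹ     g = refl

      Meets-map : ∀ r {x y} g → Meets r x y (mapGame ι inj g) →
                  ∃₂ λ i j → ι i ≡ x × ι j ≡ y × Meets r i j g
      Meets-map r g p rewrite left-map r g | right-map r g with p
      ... | inj₁ (a , b) = _ , _ , a , b , inj₁ (refl , refl)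
      ... | inj₂ (a , b) = _ , _ , a , b , inj₂ (refl , refl)

      map-Meets : ∀ r {i j} g → Meets r i j g → Meets r (ι i) (ι j) (mapGame ι inj g)
      map-Meets r g p rewrite left-map r g | right-map r g with p
      ... | inj₁ (a , b) = inj₁ (cong ι a , cong ι b)
      ... | inj₂ (a , b) = inj₂ (cong ι a , cong ι b)

    meetings-map : ∀ r gs i j → meetings r (map (mapGame ι inj) gs) (ι i) (ι j) ≡ meetings r gs i j
    meetings-map r gs i j = count-map (meets? r (ι i) (ι j)) (meets? r i j) _ to (map-Meets r) gs
      where
      to : ∀ g → Meets r (ι i) (ι j) (mapGame ι inj g) → Meets r i j g
      to g p with Meets-map r g p
      ... | i′ , j′ , ei , ej , q with inj ei | inj ej
      ... | refl | refl = q

    meetings-map-outside : ∀ r gs {x y} → (∀ i j → ι i ≡ x → ι j ≡ y → ⊥) →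
                           meetings r (map (mapGame ι inj) gs) x y ≡ 0
    meetings-map-outside r gs {x} {y} out =
      -- The count is compared with that of the empty predicate on the original games.
      trans (count-map (meets? r x y) (λ _ → no λ ()) _
               (λ g p → let i , j , ei , ej , _ = Meets-map r g p in out i j ei ej) (λ _ ()) gs)
            (count-none (λ _ → no λ ()) gs (λ _ ()))

  true≢false : ∀ {b : Bool} → b ≡ true → b ≢ false
  true≢false refl ()

  -- Pairwise balanced closure: the lines partition the pairs of points, and each
  -- point lacks a spouse on at most one line.
  module Compose {n : ℕ} {I : Set} (L : List I) (L-unique : Unique L) (L-all : ∀ c → c ∈ L)
    (size : I → ℕ) (Sₗ : ∀ c → Fin (size c) → Bool) (T : ∀ c → Tournament (size c) (Sₗ c))
    (ι : ∀ c → Fin (size c) → Fin n) (ι-inj : ∀ c → Injective _≡_ _≡_ (ι c))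
    (line : Fin n → Fin n → I)
    (cover : ∀ {x y} → x ≢ y → ∃₂ λ i j → ι (line x y) i ≡ x × ι (line x y) j ≡ y)
    (line-ι : ∀ c {i j} → i ≢ j → line (ι c i) (ι c j) ≡ c)
    (S : Fin n → Bool)
    (S-true  : ∀ c i → S (ι c i) ≡ true → Sₗ c i ≡ true)
    (S-false : ∀ x → S x ≡ false → ∃₂ λ c i → ι c i ≡ x × Sₗ c i ≡ false)
    (single  : ∀ c c′ i i′ → ι c i ≡ ι c′ i′ → Sₗ c i ≡ false → Sₗ c′ i′ ≡ false → c ≡ c′)
    where

    private
      base : ∀ c → List (Game (size c))
      base c = Tournament.games (T c)

      part : I → List (Game n)
      part c = map (mapGame (ι c) (ι-inj c)) (base c)

      gs : List (Game n)
      gs = concatMap part L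

      local : Meeting → ∀ c → Fin (size c) → Fin (size c) → ℕ
      local r c = meetings r (base c)

      -- A game on another line `c′` containing both points would make `line` return both `c` and
      -- `c′` for this pair.
      on-line : ∀ r c {i j} → i ≢ j → meetings r gs (ι c i) (ι c j) ≡ local r c i j
      on-line r c {i} {j} i≢j =
        count-concatMap (meets? r _ _) part L-unique (L-all c) (meetings-map (ι c) (ι-inj c) r (base c) i j)
          (λ c′ c′≢c → meetings-map-outside (ι c′) (ι-inj c′) r (base c′) (λ i′ j′ ei ej →
            c′≢c (trans (sym (line-ι c′ (λ i′≡j′ → i≢j (ι-inj c (trans (sym ei) (trans (cong (ι c′) i′≡j′) ej))))))
                        (trans (cong₂ line ei ej) (line-ι c i≢j)))))

      mixed : ∀ r → (∀ c → MixedMeetings (Sₗ c) (local r c)) → MixedMeetings S (meetings r gs)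
      mixed r loc = record { spouses = spouses ; others = others }
        where
        module Loc c = MixedMeetings (loc c)

        diagonal-zero : ∀ c x → (∀ i → ι c i ≡ x → Sₗ c i ≡ true) → count (meets? r x x) (part c) ≡ 0
        diagonal-zero c x all-spouses with any? (λ i → ι c i ≟ x)
        ... | yes (i , refl) = trans (meetings-map (ι c) (ι-inj c) r (base c) i i) (Loc.spouses c i (all-spouses i refl))
        ... | no  ¬i         = meetings-map-outside (ι c) (ι-inj c) r (base c) (λ i _ e _ → ¬i (i , e))

        spouses : ∀ x → S x ≡ true → meetings r gs x x ≡ 0
        spouses x Sx = count-concatMap-zero (meets? r x x) part L
          (λ {c} _ → diagonal-zero c x (λ i → λ { refl → S-true c i Sx }))

        others : ∀ x y → ¬ (x ≡ y × S x ≡ true) → meetings r gs x y ≡ 1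
        others x y ¬xy with x ≟ y
        ... | no x≢y with cover x≢y
        ...   | i , j , ei , ej = trans (sym (cong₂ (meetings r gs) ei ej))
                  (trans (on-line r _ i≢j) (Loc.others _ i j (i≢j ∘ proj₁)))
          where
          i≢j : i ≢ j
          i≢j e = x≢y (trans (sym ei) (trans (cong (ι _) e) ej))
        -- A point without a spouse lacks one on exactly one line. That line contributes the
        -- diagonal meeting; every other line gives the point a spouse and contributes none.
        others x .x ¬xy | yes refl with S-false x (¬-not (λ Sx → ¬xy (refl , Sx)))
        ... | c , i , refl , Sᵢ = count-concatMap (meets? r _ _) part L-unique (L-all c)
                (trans (meetings-map (ι c) (ι-inj c) r (base c) i i) (Loc.others c i i (λ (_ , Sₜ) → true≢false Sₜ Sᵢ)))
                (λ c′ c′≢c → diagonal-zero c′ x (λ i′ e → ¬-not (λ S′ → c′≢c (single c′ c i′ i e S′ Sᵢ))))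

      same : ∀ r → (∀ c → SameSexOpposition (λ i → Sₗ c i ≡ true) (local r c)) →
             SameSexOpposition (λ x → S x ≡ true) (meetings r gs)
      same r loc = record { with-spouse = with-spouse ; without-spouse = without-spouse }
        where
        module Loc c = SameSexOpposition (loc c)

        via-line : ∀ {x y} (P : ℕ → Set) → x ≢ y →
                   (∀ c i j → ι c i ≡ x → ι c j ≡ y → i ≢ j → P (local r c i j)) → P (meetings r gs x y)
        via-line P x≢y h with cover x≢y
        ... | i , j , ei , ej = subst P (trans (sym (on-line r _ i≢j)) (cong₂ (meetings r gs) ei ej)) (h _ i j ei ej i≢j)
          where
          i≢j : i ≢ j
          i≢j e = x≢y (trans (sym ei) (trans (cong (ι _) e) ej))

        with-spouse : ∀ p → S p ≡ true → ∀ q → q ≢ p → meetings r gs p q ≡ 1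
        with-spouse p Sp q q≢p = via-line (_≡ 1) (≢-sym q≢p)
          (λ c i j ei _ i≢j → Loc.with-spouse c i (S-true c i (trans (cong S ei) Sp)) j (≢-sym i≢j))

        without-spouse : ∀ p → ¬ (S p ≡ true) → ∃ λ q → q ≢ p × ¬ (S q ≡ true) × meetings r gs p q ≡ 2
                         × (∀ q′ → q′ ≢ p → q′ ≢ q → meetings r gs p q′ ≡ 1)
        without-spouse p ¬Sp with S-false p (¬-not ¬Sp)
        ... | c , i , refl , Sᵢ with Loc.without-spouse c i (λ Sₜ → true≢false Sₜ Sᵢ)
        ... | j , j≢i , ¬Sⱼ , two , one =
              ι c j , j≢i ∘ ι-inj c , ¬Sⱼ ∘ S-true c j , trans (on-line r c (≢-sym j≢i)) two
            , λ q q≢p q≢j → via-line (_≡ 1) (≢-sym q≢p) (λ c′ i′ j′ ei ej i′≢j′ → rest c′ i′ j′ ei (λ e → q≢j (trans (sym ej) e)) i′≢j′)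
          where
          -- If `p` has a spouse on `c′`, its opponents there are met once each. Otherwise `single`
          -- identifies `c′` with `c`, where only `ι c j` is met twice.
          rest : ∀ c′ i′ j′ → ι c′ i′ ≡ ι c i → ι c′ j′ ≢ ι c j → i′ ≢ j′ → local r c′ i′ j′ ≡ 1
          rest c′ i′ j′ ei j′≢ i′≢j′ with Sₗ c′ i′ in S′
          ... | true  = Loc.with-spouse c′ i′ S′ j′ (≢-sym i′≢j′)
          ... | false with single c′ c i′ i ei S′ Sᵢ
          ...   | refl with ι-inj c ei
          ...     | refl = one j′ (≢-sym i′≢j′) (j′≢ ∘ cong (ι c))

    compose : Tournament n S
    compose = record
      { games     = gs
      ; partners  = mixed partnersᴹ (Tournament.partners ∘ T)
      ; opponents = mixed opponentsᴹ (Tournament.opponents ∘ T)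
      ; men       = same menᴹ (Tournament.men ∘ T)
      ; women     = same womenᴹ (Tournament.women ∘ T)
      }

-- Transversal designs and their truncations.

module Planes where

  open import Data.Bool using (Bool; true; false)
  open import Data.Fin using (Fin; zero; suc; toℕ; fromℕ<; inject≤; combine; remQuot; join; splitAt; _↑ˡ_)
  open import Data.Fin.Properties
    using (_≟_; toℕ-injective; toℕ-fromℕ<; toℕ-inject≤; toℕ<n; combine-remQuot; remQuot-combine;
           join-splitAt; splitAt-↑ˡ; splitAt-↑ʳ)
  open import Data.List using (List; map; _++_; allFin; cartesianProductWith)
  open import Data.List.Membership.Propositional using (_∈_)
  open import Data.List.Membership.Propositional.Properties
    using (∈-map⁺; ∈-map⁻; ∈-++⁺ˡ; ∈-++⁺ʳ; ∈-allFin; ∈-cartesianProductWith⁺; ∈-cartesianProductWith⁻)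
  open import Data.List.Relation.Unary.Unique.Propositional using (Unique)
  open import Data.List.Relation.Unary.Unique.Propositional.Properties
    using (map⁺; ++⁺; allFin⁺; cartesianProductWith⁺)
  open import Data.Nat using (ℕ; suc; _+_; _*_; _≤_; _<_; _<?_)
  open import Data.Product using (∃; ∃₂; _×_; _,_; uncurry)
  open import Data.Product.Properties using (,-injectiveˡ; ,-injectiveʳ)
  open import Data.Sum using (_⊎_; inj₁; inj₂; map₁; [_,_]′)
  open import Data.Sum.Properties using (inj₁-injective; inj₂-injective)
  open import Function using (_∘_; const)
  open import Function.Definitions using (Injective)
  open import Relation.Binary.PropositionalEquality using (_≡_; _≢_; refl; sym; trans; cong; cong₂; subst)
  open import Relation.Nullary using (¬_; yes; no; contradiction)
  open Composition

  -- A transversal design in normal form: the block (p , q) meets group i in the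
  -- point val i p q, and the blocks (0# , q) form a parallel class.
  record Plane (K m : ℕ) : Set where
    field
      0#        : Fin m
      val lift  : Fin K → Fin m → Fin m → Fin m
      meet      : Fin K → Fin K → Fin m → Fin m → Fin m
      val-0     : ∀ i q → val i 0# q ≡ q
      val-lift  : ∀ i p x → val i p (lift i p x) ≡ x
      lift-val  : ∀ i p q → lift i p (val i p q) ≡ q
      meet-val  : ∀ {i j} → i ≢ j → ∀ p q → meet i j (val i p q) (val j p q) ≡ p
      lift-meet : ∀ {i j} → i ≢ j → ∀ x y → lift i (meet i j x y) x ≡ lift j (meet i j x y) y

  data Line (K m : ℕ) : Set where
    group : Fin K → Line K m
    block : (p q : Fin m) → Line K m

  module _ {K m : ℕ} where

    lines : List (Line K m)
    lines = map group (allFin K) ++ cartesianProductWith block (allFin m) (allFin m)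

    lines-all : ∀ c → c ∈ lines
    lines-all (group i)   = ∈-++⁺ˡ (∈-map⁺ group (∈-allFin i))
    lines-all (block p q) = ∈-++⁺ʳ _ (∈-cartesianProductWith⁺ block (∈-allFin p) (∈-allFin q))

    lines-unique : Unique lines
    lines-unique = ++⁺ (map⁺ (λ { refl → refl }) (allFin⁺ K))
                       (cartesianProductWith⁺ block (λ { refl → refl , refl }) (allFin⁺ m) (allFin⁺ m))
                       disjoint
      where
      disjoint : ∀ {c} → ¬ (c ∈ map group (allFin K) × c ∈ cartesianProductWith block (allFin m) (allFin m))
      disjoint (a , b) with ∈-map⁻ group a | ∈-cartesianProductWith⁻ block (allFin m) (allFin m) b
      ... | _ , _ , refl | _ , _ , _ , _ , ()

  Point : ℕ → ℕ → ℕ → Set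
  Point m D t = (Fin m × Fin D) ⊎ Fin t

  module _ {m D t : ℕ} where

    encode : Point m D t → Fin (m * D + t)
    encode = join (m * D) t ∘ map₁ (uncurry combine)

    decode : Fin (m * D + t) → Point m D t
    decode = map₁ (remQuot D) ∘ splitAt (m * D)

    decode-encode : ∀ x → decode (encode x) ≡ x
    decode-encode (inj₁ (q , g)) rewrite splitAt-↑ˡ (m * D) (combine q g) t = cong inj₁ (remQuot-combine q g)
    decode-encode (inj₂ e)       rewrite splitAt-↑ʳ (m * D) t e = refl

    encode-decode : ∀ x → encode (decode x) ≡ x
    encode-decode x with splitAt (m * D) x in eq
    ... | inj₁ y = trans (cong (_↑ˡ t) (combine-remQuot {m} D y)) (trans (cong (join (m * D) t) (sym eq)) (join-splitAt (m * D) t x))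
    ... | inj₂ e = trans (cong (join (m * D) t) (sym eq)) (join-splitAt (m * D) t x)

    encode-injective : Injective _≡_ _≡_ encode
    encode-injective e = trans (sym (decode-encode _)) (trans (cong decode e) (decode-encode _))

  -- `dir` and `pos` embed the surviving points in the full design, so joining lines are computed
  -- there. Truncation only changes which points a line retains, and both shapes of truncation used
  -- later are instances.
  module Truncate {K m D t : ℕ} (P : Plane K m)
    (dir : Point m D t → Fin K) (pos : Point m D t → Fin m)
    (dir-pos-injective : ∀ {x y} → dir x ≡ dir y → pos x ≡ pos y → x ≡ y)
    where

    open Plane P

    On : Line K m → Point m D t → Set
    On (group i)   x = dir x ≡ i
    On (block p q) x = val (dir x) p q ≡ pos x

    -- The size of a truncated line depends on which of its points survive, so each line brings its
    -- own enumeration and a tournament for the status pulled back along it.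
    record Fitting (σ : Point m D t → Bool) (c : Line K m) : Set where
      field
        size       : ℕ
        point      : Fin size → Point m D t
        injective  : Injective _≡_ _≡_ point
        sound      : ∀ i → On c (point i)
        complete   : ∀ x → On c x → ∃ λ i → point i ≡ x
        tournament : Tournament size (σ ∘ point)

    line : Point m D t → Point m D t → Line K m
    line x y with dir x ≟ dir y
    ... | yes _ = group (dir x)
    ... | no  _ = let p = meet (dir x) (dir y) (pos x) (pos y) in block p (lift (dir x) p (pos x))

    on-line : ∀ x y → On (line x y) x × On (line x y) y
    on-line x y with dir x ≟ dir y
    ... | yes e = refl , sym e
    ... | no ¬e = val-lift _ _ _ , trans (cong (val (dir y) _) (lift-meet ¬e _ _)) (val-lift _ _ _)

    line-unique : ∀ c {x y} → On c x → On c y → x ≢ y → line x y ≡ c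
    line-unique c {x} {y} onx ony x≢y with dir x ≟ dir y
    line-unique (group i)   onx ony x≢y | yes e = cong group onx
    line-unique (block p q) onx ony x≢y | yes e =
      contradiction (dir-pos-injective e (trans (sym onx) (trans (cong (λ i → val i p q) e) ony))) x≢y
    line-unique (group i)   onx ony x≢y | no ¬e = contradiction (trans onx (sym ony)) ¬e
    line-unique (block p q) {x} {y} onx ony x≢y | no ¬e = cong₂ block p≡
      (trans (cong₂ (lift (dir x)) p≡ (sym onx)) (lift-val _ p q))
      where
      p≡ : meet (dir x) (dir y) (pos x) (pos y) ≡ p
      p≡ = trans (cong₂ (meet (dir x) (dir y)) (sym onx) (sym ony)) (meet-val ¬e p q)

    module _ (σ : Line K m → Point m D t → Bool) (fit : ∀ c → Fitting (σ c) c)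
      (S : Point m D t → Bool)
      (S-true  : ∀ c x → On c x → S x ≡ true → σ c x ≡ true)
      (S-false : ∀ x → S x ≡ false → ∃ λ c → On c x × σ c x ≡ false)
      (single  : ∀ c c′ x → On c x → On c′ x → σ c x ≡ false → σ c′ x ≡ false → c ≡ c′)
      where

      private
        module Fit c = Fitting (fit c)

        cover : ∀ {x y} → x ≢ y → let c = line (decode x) (decode y) in
                ∃₂ λ i j → encode (Fit.point c i) ≡ x × encode (Fit.point c j) ≡ y
        cover {x} {y} _ with on-line (decode x) (decode y)
        ... | onx , ony with Fit.complete _ _ onx | Fit.complete _ _ ony
        ... | i , ei | j , ej = i , j , trans (cong encode ei) (encode-decode {m} {D} {t} x) , trans (cong encode ej) (encode-decode {m} {D} {t} y)

        line-ι : ∀ c {i j} → i ≢ j → line (decode (encode (Fit.point c i))) (decode (encode (Fit.point c j))) ≡ c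
        line-ι c {i} {j} i≢j = trans (cong₂ line (decode-encode _) (decode-encode _))
          (line-unique c (Fit.sound c i) (Fit.sound c j) (i≢j ∘ Fit.injective c))

      tournament : Tournament (m * D + t) (S ∘ decode)
      tournament = Compose.compose lines lines-unique lines-all Fit.size _ Fit.tournament
        (λ c → encode ∘ Fit.point c) (λ c → Fit.injective c ∘ encode-injective)
        (λ x y → line (decode x) (decode y)) cover line-ι
        (S ∘ decode)
        (λ c i Sx → S-true c _ (Fit.sound c i) (trans (cong S (sym (decode-encode _))) Sx))
        (λ x Sx → let c , onx , σx = S-false (decode x) Sx ; i , e = Fit.complete c _ onx in
                  c , i , trans (cong encode e) (encode-decode {m} {D} {t} x) , trans (cong (σ c) e) σx)
        (λ c c′ i i′ e σᵢ σᵢ′ → let e′ = encode-injective e in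
           single c c′ _ (Fit.sound c i) (subst (On c′) (sym e′) (Fit.sound c′ i′)) σᵢ (trans (cong (σ c′) e′) σᵢ′))

  AllSpouses : ℕ → Set
  AllSpouses n = Tournament n (const true)

  infixr 5 _▹_
  _▹_ : {n : ℕ} → Bool → (Fin n → Bool) → Fin (suc n) → Bool
  (b ▹ f) zero    = b
  (b ▹ f) (suc i) = f i

  -- D full groups and a further group truncated to u points, which becomes a hole.
  module Hole {D m u : ℕ} (u≤m : u ≤ m) (P : Plane (suc D) m)
    {Sᴳ : Fin D → Fin m → Bool} (Tᴳ : ∀ g → Tournament m (Sᴳ g))
    -- On a longer block of the class the extra point comes first and always has a spouse, since its
    -- own status is settled by `Tᴴ`.
    {Sᶜ : Fin m → Fin D → Bool} (Tᶜ : ∀ q → Tournament D (Sᶜ q)) (Tᶜ⁺ : ∀ q → Tournament (suc D) (true ▹ Sᶜ q))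
    {Sᴴ : Fin u → Bool} (Tᴴ : Tournament u Sᴴ)
    (T : AllSpouses D) (T⁺ : AllSpouses (suc D))
    (S : Fin m → Fin D → Bool)
    -- A point of a full group may lack a spouse in one place only. The first alternative leaves the
    -- decision to the block of the class, the second to the group.
    (home : ∀ q g → (Sᴳ g q ≡ true × Sᶜ q g ≡ S q g) ⊎ (Sᶜ q g ≡ true × Sᴳ g q ≡ S q g))
    where

    open Plane P

    private
      dir : Point m D u → Fin (suc D)
      dir (inj₁ (_ , g)) = suc g
      dir (inj₂ _)       = zero

      pos : Point m D u → Fin m
      pos (inj₁ (x , _)) = x
      pos (inj₂ e)       = inject≤ e u≤m

      dir-pos-injective : ∀ {x y} → dir x ≡ dir y → pos x ≡ pos y → x ≡ y
      dir-pos-injective {inj₁ _} {inj₁ _} refl refl = refl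
      dir-pos-injective {inj₂ _} {inj₂ _} _ e = cong inj₂
        (toℕ-injective (trans (sym (toℕ-inject≤ _ u≤m)) (trans (cong toℕ e) (toℕ-inject≤ _ u≤m))))

      open Truncate P dir pos dir-pos-injective

      blockStatus : Fin m → Fin m → Fin D → Bool
      blockStatus p q g with p ≟ 0#
      ... | yes _ = Sᶜ q g
      ... | no  _ = true

      σ : Line (suc D) m → Point m D u → Bool
      σ (group zero)    (inj₂ e)       = Sᴴ e
      σ (group (suc g)) (inj₁ (q , _)) = Sᴳ g q
      σ (block p q)     (inj₁ (_ , g)) = blockStatus p q g
      σ _               _              = true

      statusT : ∀ p q → Tournament D (blockStatus p q)
      statusT p q with p ≟ 0#
      ... | yes _ = Tᶜ q
      ... | no  _ = T

      statusT⁺ : ∀ p q → Tournament (suc D) (true ▹ blockStatus p q)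
      statusT⁺ p q with p ≟ 0#
      ... | yes _ = Tᶜ⁺ q
      ... | no  _ = Tournament-resp (λ { zero → refl ; (suc _) → refl }) T⁺

      blockPoint : ∀ p q → Fin D → Point m D u
      blockPoint p q g = inj₁ (val (suc g) p q , g)

      fit : ∀ c → Fitting (σ c) c
      fit (group zero) = record
        { size = u ; point = inj₂ ; injective = inj₂-injective ; sound = λ _ → refl
        ; complete = λ { (inj₂ e) _ → e , refl } ; tournament = Tᴴ }
      fit (group (suc g)) = record
        { size = m ; point = λ q → inj₁ (q , g) ; injective = ,-injectiveˡ ∘ inj₁-injective ; sound = λ _ → refl
        ; complete = λ { (inj₁ (q , _)) refl → q , refl } ; tournament = Tᴳ g }
      -- Group `zero` is the truncated one, and the block meets it at position `val zero p q`; that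
      -- point survives exactly when the position is below `u`.
      fit (block p q) with toℕ (val zero p q) <? u
      ... | no z≮u = record
        { size = D ; point = blockPoint p q ; injective = ,-injectiveʳ ∘ inj₁-injective ; sound = λ _ → refl
        ; complete = complete
        ; tournament = statusT p q }
        where
        complete : ∀ x → On (block p q) x → ∃ λ i → blockPoint p q i ≡ x
        complete (inj₁ (_ , g)) refl = g , refl
        complete (inj₂ e) on = contradiction (subst (_< u) (trans (sym (toℕ-inject≤ e u≤m)) (cong toℕ (sym on))) (toℕ<n e)) z≮u
      ... | yes z<u = record
        { size = suc D ; point = point ; injective = injective ; sound = sound ; complete = complete
        ; tournament = Tournament-resp (λ { zero → refl ; (suc _) → refl }) (statusT⁺ p q) }
        where
        point : Fin (suc D) → Point m D u
        point zero    = inj₂ (fromℕ< z<u)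
        point (suc g) = blockPoint p q g

        injective : Injective _≡_ _≡_ point
        injective {zero}  {zero}  _ = refl
        injective {suc _} {suc _} e = cong suc (,-injectiveʳ (inj₁-injective e))

        sound : ∀ i → On (block p q) (point i)
        sound zero    = toℕ-injective (trans (sym (toℕ-fromℕ< z<u)) (sym (toℕ-inject≤ _ u≤m)))
        sound (suc _) = refl

        complete : ∀ x → On (block p q) x → ∃ λ i → point i ≡ x
        complete (inj₁ (_ , g)) refl = suc g , refl
        complete (inj₂ e) on = zero , cong inj₂ (toℕ-injective
          (trans (toℕ-fromℕ< z<u) (trans (cong toℕ on) (toℕ-inject≤ e u≤m))))

      Sₚ : Point m D u → Bool
      Sₚ = [ uncurry S , Sᴴ ]′

      on-class : ∀ {q x g} → On (block 0# q) (inj₁ (x , g)) → q ≡ x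
      on-class on = trans (sym (val-0 _ _)) on

      S-true : ∀ c x → On c x → Sₚ x ≡ true → σ c x ≡ true
      S-true (group zero)    (inj₂ e)       _    s = s
      S-true (group (suc g)) (inj₁ (q , _)) refl s with home q g
      ... | inj₁ (a , _) = a
      ... | inj₂ (_ , b) = trans b s
      S-true (block p q)     (inj₁ (x , g)) on   s with p ≟ 0#
      ... | no  _    = refl
      ... | yes refl with on-class on | home q g
      ...   | refl | inj₁ (_ , b) = trans b s
      ...   | refl | inj₂ (a , _) = a
      S-true (block p q)     (inj₂ e)       _    s = refl
      S-true (group zero)    (inj₁ _)       _    s = refl
      S-true (group (suc _)) (inj₂ _)       _    s = refl

      S-false : ∀ x → Sₚ x ≡ false → ∃ λ c → On c x × σ c x ≡ false
      S-false (inj₂ e)       s = group zero , refl , s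
      S-false (inj₁ (q , g)) s with home q g
      ... | inj₂ (_ , b) = group (suc g) , refl , trans b s
      ... | inj₁ (_ , b) = block 0# q , val-0 _ q , status
        where
        status : blockStatus 0# q g ≡ false
        status with 0# ≟ 0#
        ... | yes _ = trans b s
        ... | no ¬e = contradiction refl ¬e

      -- By `home`, a point lacking a spouse in its group has one on its block of the class, and
      -- blocks outside the class give every point a spouse.
      single-mixed : ∀ {g p q x g′} → suc g′ ≡ suc g → On (block p q) (inj₁ (x , g′)) →
                     Sᴳ g x ≡ false → blockStatus p q g′ ≢ false
      single-mixed {g} {p} {q} {x} refl on a b with p ≟ 0#
      single-mixed {g} {p} {q} {x} refl on a () | no _
      ... | yes refl with on-class on | home q g
      ...   | refl | inj₁ (a′ , _) = true≢false a′ a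
      ...   | refl | inj₂ (b′ , _) = true≢false b′ b

      class : ∀ {p q x g} → On (block p q) (inj₁ (x , g)) → blockStatus p q g ≡ false →
              block {suc D} p q ≡ block 0# x
      class {p} on s with p ≟ 0#
      class     on s  | yes refl = cong (block 0#) (on-class on)
      class     on () | no _

      single : ∀ c c′ x → On c x → On c′ x → σ c x ≡ false → σ c′ x ≡ false → c ≡ c′
      single (group zero)    (group zero)    (inj₂ _) _ _ _ _ = refl
      single (group (suc g)) (group (suc h)) (inj₁ _) on on′ _ _ = cong group (trans (sym on) on′)
      single (group (suc g)) (block p q)     (inj₁ _) on on′ a b = contradiction b (single-mixed on on′ a)
      single (block p q)     (group (suc g)) (inj₁ _) on on′ a b = contradiction a (single-mixed on′ on b)
      single (block p q)     (block p′ q′)   (inj₁ _) on on′ a b = trans (class on a) (sym (class on′ b))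
      single (group zero)    _               (inj₁ _) _ _ () _
      single (group (suc g)) (group zero)    (inj₁ _) _ _ _ ()
      single (block p q)     (group zero)    (inj₁ _) _ _ _ ()
      single (group zero)    (group (suc _)) (inj₂ _) _ _ _ ()
      single (group zero)    (block _ _)     (inj₂ _) _ _ _ ()
      single (group (suc _)) _               (inj₂ _) _ _ () _
      single (block _ _)     _               (inj₂ _) _ _ () _

    tournament-hole : Tournament (m * D + u) ([ uncurry S , Sᴴ ]′ ∘ decode)
    tournament-hole = tournament σ fit Sₚ S-true S-false single

-- Enlarging a single block by additional points.

module Spikes where

  open import Data.Bool using (Bool; true; false)
  open import Data.Fin using (Fin; zero; suc; splitAt; _↑ˡ_; _↑ʳ_)
  open import Data.Fin.Properties
    using (_≟_; any?; ↑ˡ-injective; ↑ʳ-injective; splitAt-↑ˡ; splitAt-↑ʳ; splitAt⁻¹-↑ˡ; splitAt⁻¹-↑ʳ)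
  open import Data.Nat using (ℕ; suc; _+_; _*_)
  open import Data.Product using (∃; _×_; _,_)
  open import Data.Product.Properties using (,-injectiveˡ; ,-injectiveʳ)
  open import Data.Sum using (inj₁; inj₂; [_,_]′)
  open import Data.Sum.Properties using (inj₁-injective)
  open import Function using (_∘_)
  open import Function.Definitions using (Injective)
  open import Relation.Binary.PropositionalEquality using (_≡_; _≢_; refl; sym; trans; cong; cong₂)
  open import Relation.Nullary using (yes; no; contradiction)
  open Composition
  open Planes

  ↑ˡ≢↑ʳ : ∀ {m n} {i : Fin m} {j : Fin n} → i ↑ˡ n ≢ m ↑ʳ j
  ↑ˡ≢↑ʳ {m} {n} {i} {j} e with trans (sym (splitAt-↑ˡ m i n)) (trans (cong (splitAt m) e) (splitAt-↑ʳ m n j))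
  ... | ()

  -- D full groups and t further points, all on the block (0# , 0#).
  module Spike {D m t : ℕ} (P : Plane (D + t) m)
    (Tᴳ : AllSpouses m) (T₁ : AllSpouses 1) (T : AllSpouses D) (T⁺ : AllSpouses (suc D))
    {Sᶜ : Fin m → Fin D → Bool} (Tᶜ : ∀ q → Tournament D (Sᶜ q))
    {Sᴮ : Fin (D + t) → Bool} (Tᴮ : Tournament (D + t) Sᴮ)
    where

    open Plane P

    private
      dir : Point m D t → Fin (D + t)
      dir (inj₁ (_ , g)) = g ↑ˡ t
      dir (inj₂ e)       = D ↑ʳ e

      pos : Point m D t → Fin m
      pos (inj₁ (x , _)) = x
      pos (inj₂ _)       = 0#

      dir-pos-injective : ∀ {x y} → dir x ≡ dir y → pos x ≡ pos y → x ≡ y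
      dir-pos-injective {inj₁ (_ , g)} {inj₁ (_ , h)} e refl with ↑ˡ-injective t g h e
      ... | refl = refl
      dir-pos-injective {inj₁ _} {inj₂ _} e _ = contradiction e ↑ˡ≢↑ʳ
      dir-pos-injective {inj₂ _} {inj₁ _} e _ = contradiction (sym e) ↑ˡ≢↑ʳ
      dir-pos-injective {inj₂ a} {inj₂ b} e _ = cong inj₂ (↑ʳ-injective D a b e)

      open Truncate P dir pos dir-pos-injective

    spikeStatus : Point m D t → Bool
    spikeStatus (inj₁ (q , g)) with q ≟ 0#
    ... | yes _ = Sᴮ (g ↑ˡ t)
    ... | no  _ = Sᶜ q g
    spikeStatus (inj₂ e) = Sᴮ (D ↑ʳ e)

    private
      σ : Line (D + t) m → Point m D t → Bool
      σ (group _)   _ = true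
      σ (block p q) x with p ≟ 0#
      ... | yes _ = spikeStatus x
      ... | no  _ = true

      blockPoint : ∀ p q → Fin D → Point m D t
      blockPoint p q g = inj₁ (val (g ↑ˡ t) p q , g)

      spikePoint : Fin (D + t) → Point m D t
      spikePoint = [ (λ g → inj₁ (0# , g)) , inj₂ ]′ ∘ splitAt D

      spikePoint-dir : ∀ i → dir (spikePoint i) ≡ i
      spikePoint-dir i with splitAt D i in eq
      ... | inj₁ g = splitAt⁻¹-↑ˡ eq
      ... | inj₂ e = splitAt⁻¹-↑ʳ eq

      spikePoint-pos : ∀ i → pos (spikePoint i) ≡ 0#
      spikePoint-pos i with splitAt D i
      ... | inj₁ _ = refl
      ... | inj₂ _ = refl

      spikePoint-status : ∀ i → Sᴮ i ≡ spikeStatus (spikePoint i)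
      spikePoint-status i with splitAt D i in eq
      ... | inj₂ e = cong Sᴮ (sym (splitAt⁻¹-↑ʳ eq))
      ... | inj₁ g with 0# ≟ 0#
      ...   | yes _ = cong Sᴮ (sym (splitAt⁻¹-↑ˡ eq))
      ...   | no ¬e = contradiction refl ¬e

      class-status : ∀ q → q ≢ 0# → ∀ g → Sᶜ q g ≡ spikeStatus (blockPoint 0# q g)
      class-status q q≢0 g rewrite val-0 (g ↑ˡ t) q with q ≟ 0#
      ... | yes e = contradiction e q≢0
      ... | no  _ = refl

      fit : ∀ c → Fitting (σ c) c
      fit (group i) with splitAt D i in eq
      ... | inj₁ g = record
        { size = m ; point = λ q → inj₁ (q , g) ; injective = ,-injectiveˡ ∘ inj₁-injective
        ; sound = λ _ → splitAt⁻¹-↑ˡ eq ; complete = complete ; tournament = Tᴳ }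
        where
        complete : ∀ x → dir x ≡ i → ∃ λ q → inj₁ (q , g) ≡ x
        complete (inj₁ (q , h)) e with ↑ˡ-injective t g h (trans (splitAt⁻¹-↑ˡ eq) (sym e))
        ... | refl = q , refl
        complete (inj₂ _) e = contradiction (trans (splitAt⁻¹-↑ˡ eq) (sym e)) ↑ˡ≢↑ʳ
      ... | inj₂ e = record
        { size = 1 ; point = λ _ → inj₂ e ; injective = λ { {zero} {zero} _ → refl }
        ; sound = λ _ → splitAt⁻¹-↑ʳ eq ; complete = complete ; tournament = T₁ }
        where
        complete : ∀ x → dir x ≡ i → ∃ λ (_ : Fin 1) → inj₂ e ≡ x
        complete (inj₁ _) e′ = contradiction (trans e′ (sym (splitAt⁻¹-↑ʳ eq))) ↑ˡ≢↑ʳ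
        complete (inj₂ e′) d = zero , cong inj₂ (↑ʳ-injective D e e′ (trans (splitAt⁻¹-↑ʳ eq) (sym d)))
      fit (block p q) with p ≟ 0#
      fit (block p q) | yes refl with q ≟ 0#
      ... | yes refl = record
        { size = D + t ; point = spikePoint
        ; injective = λ {i} {j} e → trans (sym (spikePoint-dir i)) (trans (cong dir e) (spikePoint-dir j))
        ; sound = λ i → trans (val-0 _ _) (sym (spikePoint-pos i))
        ; complete = λ x on → dir x , dir-pos-injective (spikePoint-dir (dir x))
            (trans (spikePoint-pos (dir x)) (trans (sym (val-0 _ _)) on))
        ; tournament = Tournament-resp spikePoint-status Tᴮ }
      ... | no q≢0 = record
        { size = D ; point = blockPoint 0# q ; injective = ,-injectiveʳ ∘ inj₁-injective ; sound = λ _ → refl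
        ; complete = λ { (inj₁ (_ , g)) refl → g , refl
                       ; (inj₂ e) on → contradiction (trans (sym (val-0 _ _)) on) q≢0 }
        ; tournament = Tournament-resp (class-status q q≢0) (Tᶜ q) }
      -- All further points have position `0#`, so the block contains the one in direction `D ↑ʳ e`
      -- exactly when its value there is `0#`.
      fit (block p q) | no p≢0 with any? (λ e → val (D ↑ʳ e) p q ≟ 0#)
      ... | no ¬e = record
        { size = D ; point = blockPoint p q ; injective = ,-injectiveʳ ∘ inj₁-injective ; sound = λ _ → refl
        ; complete = λ { (inj₁ (_ , g)) refl → g , refl ; (inj₂ e) on → contradiction (e , on) ¬e }
        ; tournament = T }
      ... | yes (e , val-e) = record
        { size = suc D ; point = point ; injective = injective ; sound = sound ; complete = complete ; tournament = T⁺ }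
        where
        point : Fin (suc D) → Point m D t
        point zero    = inj₂ e
        point (suc g) = blockPoint p q g

        injective : Injective _≡_ _≡_ point
        injective {zero}  {zero}  _ = refl
        injective {suc _} {suc _} d = cong suc (,-injectiveʳ (inj₁-injective d))

        sound : ∀ i → On (block p q) (point i)
        sound zero    = val-e
        sound (suc _) = refl

        complete : ∀ x → On (block p q) x → ∃ λ i → point i ≡ x
        complete (inj₁ (_ , g)) refl = suc g , refl
        complete (inj₂ e′) on with e ≟ e′
        ... | yes refl = zero , refl
        -- Two further points already determine the block `(0# , 0#)`, so a block through both would
        -- have `p ≡ 0#`.
        ... | no  e≢e′ = contradiction
                (trans (sym (meet-val dirs p q)) (trans (cong₂ (meet _ _) (trans val-e (sym (val-0 _ _))) (trans on (sym (val-0 _ _))))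
                       (meet-val dirs 0# 0#))) p≢0
          where
          dirs : D ↑ʳ e ≢ D ↑ʳ e′
          dirs = e≢e′ ∘ ↑ʳ-injective D e e′

      S-true : ∀ c x → On c x → spikeStatus x ≡ true → σ c x ≡ true
      S-true (group _)   x _ s = refl
      S-true (block p q) x _ s with p ≟ 0#
      ... | yes _ = s
      ... | no  _ = refl

      S-false : ∀ x → spikeStatus x ≡ false → ∃ λ c → On c x × σ c x ≡ false
      S-false x s = block 0# (pos x) , val-0 _ _ , status
        where
        status : σ (block 0# (pos x)) x ≡ false
        status with 0# ≟ 0#
        ... | yes _ = s
        ... | no ¬e = contradiction refl ¬e

      class : ∀ c x → On c x → σ c x ≡ false → c ≡ block 0# (pos x)
      class (block p q) x on s with p ≟ 0#
      ... | yes refl = cong (block 0#) (trans (sym (val-0 _ _)) on)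

    tournament-spike : Tournament (m * D + t) (spikeStatus ∘ decode)
    tournament-spike = tournament σ fit spikeStatus S-true S-false
      (λ c c′ x on on′ s s′ → trans (class c x on s) (sym (class c′ x on′ s′)))

-- Tournaments with all players married, from self-orthogonal Latin squares.

module LatinSquares where

  open import Data.Bool using (true)
  open import Data.Fin using (Fin; _<_)
  open import Data.Fin.Properties using (_<?_; <-cmp; <⇒≢; <-asym)
  open import Data.List using (List; []; _∷_; length; concatMap; cartesianProduct; allFin)
  open import Data.List.Membership.Propositional.Properties using (∈-allFin; ∈-cartesianProduct⁺)
  open import Data.List.Properties using (filter-accept; filter-reject)
  open import Data.List.Relation.Unary.Unique.Propositional.Properties using (allFin⁺; cartesianProduct⁺)
  open import Data.Nat using (ℕ)
  open import Data.Product using (∃₂; _×_; _,_; swap)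
  open import Data.Product.Properties using (,-injectiveˡ; ,-injectiveʳ)
  open import Data.Sum using (_⊎_; inj₁; inj₂; [_,_]′)
  open import Function using (_∘_; const)
  open import Relation.Binary using (tri<; tri≈; tri>)
  open import Relation.Binary.PropositionalEquality using (_≡_; _≢_; refl; sym; trans; cong; cong₂; ≢-sym)
  open import Relation.Nullary using (¬_; yes; no; contradiction)
  open Composition
  open Planes

  -- Orthogonality of the square to its transpose says that `(x , y) ↦ (x ∙ y , y ∙ x)` is a
  -- bijection. Its inverse is `(a , b) ↦ (pair a b , pair b a)`; by symmetry the equations for the
  -- first coordinate suffice.
  record SelfOrthogonal (n : ℕ) : Set where
    infix 7 _∙_
    field
      _∙_ ldiv rdiv pair : Fin n → Fin n → Fin n
      idem     : ∀ x → x ∙ x ≡ x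
      ∙-ldiv   : ∀ x z → x ∙ ldiv x z ≡ z
      ldiv-∙   : ∀ x y → ldiv x (x ∙ y) ≡ y
      ∙-rdiv  : ∀ z y → rdiv z y ∙ y ≡ z
      rdiv-∙  : ∀ x y → rdiv (x ∙ y) y ≡ x
      ∙-pair   : ∀ a b → pair a b ∙ pair b a ≡ a
      pair-∙   : ∀ x y → pair (x ∙ y) (y ∙ x) ≡ x

  module _ {n : ℕ} (L : SelfOrthogonal n) where

    open SelfOrthogonal L

    private
      ∙-distinct : ∀ {i j} → i ≢ j → i ∙ j ≢ j ∙ i
      ∙-distinct {i} {j} i≢j e = i≢j (trans (sym (pair-∙ i j)) (trans (cong₂ pair e (sym e)) (pair-∙ j i)))

      -- The classical spouse-avoiding mixed doubles tournament: when men `i` and `j` meet, the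
      -- entries at `(i , j)` and `(j , i)` name their partners.
      match : ∀ {i j} → i ≢ j → Game n
      match {i} {j} i≢j = game (M i F (i ∙ j)) (M j F (j ∙ i)) i≢j (∙-distinct i≢j)

      -- For each kind of meeting this is a bijection on ordered pairs that fixes the diagonal.
      -- Hence every pair of distinct players comes from one unordered pair of men, and pairs on the
      -- diagonal from none.
      φ : Meeting → Fin n → Fin n → Fin n × Fin n
      φ partnersᴹ  i j = i , i ∙ j
      φ opponentsᴹ i j = i , j ∙ i
      φ menᴹ       i j = i , j
      φ womenᴹ     i j = i ∙ j , j ∙ i

      left-match : ∀ r {i j} (i≢j : i ≢ j) → left r (match i≢j) ≡ φ r i j
      left-match partnersᴹ  _ = refl
      left-match opponentsᴹ _ = refl
      left-match menᴹ       _ = refl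
      left-match womenᴹ     _ = refl

      right-match : ∀ r {i j} (i≢j : i ≢ j) → right r (match i≢j) ≡ φ r j i
      right-match partnersᴹ  _ = refl
      right-match opponentsᴹ _ = refl
      right-match menᴹ       _ = refl
      right-match womenᴹ     _ = refl

      match-Meets : ∀ r {x y i j} (i≢j : i ≢ j) → Meets r x y (match i≢j) → φ r i j ≡ (x , y) ⊎ φ r j i ≡ (x , y)
      match-Meets r i≢j p rewrite left-match r i≢j | right-match r i≢j with p
      ... | inj₁ (a , b) = inj₁ (cong₂ _,_ a b)
      ... | inj₂ (a , b) = inj₂ (cong₂ _,_ a b)

      Meets-match : ∀ r {x y i j} (i≢j : i ≢ j) → φ r i j ≡ (x , y) ⊎ φ r j i ≡ (x , y) → Meets r x y (match i≢j)
      Meets-match r i≢j p rewrite left-match r i≢j | right-match r i≢j with p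
      ... | inj₁ e = inj₁ (,-injectiveˡ e , ,-injectiveʳ e)
      ... | inj₂ e = inj₂ (,-injectiveˡ e , ,-injectiveʳ e)

      φ-diagonal : ∀ r i → φ r i i ≡ (i , i)
      φ-diagonal partnersᴹ  i = cong (i ,_) (idem i)
      φ-diagonal opponentsᴹ i = cong (i ,_) (idem i)
      φ-diagonal menᴹ       i = refl
      φ-diagonal womenᴹ     i = cong₂ _,_ (idem i) (idem i)

      solution : ∀ r x y → ∃₂ λ i j → φ r i j ≡ (x , y)
      solution partnersᴹ  x y = x , ldiv x y , cong (x ,_) (∙-ldiv x y)
      solution opponentsᴹ x y = x , rdiv y x , cong (x ,_) (∙-rdiv y x)
      solution menᴹ       x y = x , y , refl
      solution womenᴹ     x y = pair x y , pair y x , cong₂ _,_ (∙-pair x y) (∙-pair y x)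

      φ-injective : ∀ r {i j i′ j′} → φ r i j ≡ φ r i′ j′ → i ≡ i′ × j ≡ j′
      φ-injective partnersᴹ e with ,-injectiveˡ e
      ... | refl = refl , trans (sym (ldiv-∙ _ _)) (trans (cong (ldiv _) (,-injectiveʳ e)) (ldiv-∙ _ _))
      φ-injective opponentsᴹ e with ,-injectiveˡ e
      ... | refl = refl , trans (sym (rdiv-∙ _ _)) (trans (cong (λ z → rdiv z _) (,-injectiveʳ e)) (rdiv-∙ _ _))
      φ-injective menᴹ refl = refl , refl
      φ-injective womenᴹ {i} {j} {i′} {j′} e =
          trans (sym (pair-∙ i j)) (trans (cong₂ pair a b) (pair-∙ i′ j′))
        , trans (sym (pair-∙ j i)) (trans (cong₂ pair b a) (pair-∙ j′ i′))
        where
        a = ,-injectiveˡ e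
        b = ,-injectiveʳ e

      Pairs : List (Fin n × Fin n)
      Pairs = cartesianProduct (allFin n) (allFin n)

      matches : Fin n × Fin n → List (Game n)
      matches (i , j) with i <? j
      ... | yes i<j = match (<⇒≢ i<j) ∷ []
      ... | no  _   = []

      Solves : Meeting → Fin n → Fin n → Fin n → Fin n → Set
      Solves r x y i j = φ r i j ≡ (x , y) ⊎ φ r j i ≡ (x , y)

      matches-none : ∀ r x y {i j} → (i < j → ¬ Solves r x y i j) → count (meets? r x y) (matches (i , j)) ≡ 0
      matches-none r x y {i} {j} ¬s with i <? j
      ... | no _ = refl
      ... | yes i<j = cong length (filter-reject (meets? r x y) (¬s i<j ∘ match-Meets r (<⇒≢ i<j)))

      matches-one : ∀ r x y {i j} → i < j → Solves r x y i j → count (meets? r x y) (matches (i , j)) ≡ 1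
      matches-one r x y {i} {j} i<j s with i <? j
      ... | no i≮j = contradiction i<j i≮j
      ... | yes i<j′ = cong length (filter-accept (meets? r x y) (Meets-match r (<⇒≢ i<j′) s))

      same-match : ∀ r {x y i j i′ j′} → Solves r x y i j → Solves r x y i′ j′ →
                   (i′ ≡ i × j′ ≡ j) ⊎ (i′ ≡ j × j′ ≡ i)
      same-match r (inj₁ e) (inj₁ e′) = inj₁ (φ-injective r (trans e′ (sym e)))
      same-match r (inj₁ e) (inj₂ e′) = inj₂ (swap (φ-injective r (trans e′ (sym e))))
      same-match r (inj₂ e) (inj₁ e′) = inj₂ (φ-injective r (trans e′ (sym e)))
      same-match r (inj₂ e) (inj₂ e′) = inj₁ (swap (φ-injective r (trans e′ (sym e))))

      gs : List (Game n)
      gs = concatMap matches Pairs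

      diagonal : ∀ r x → meetings r gs x x ≡ 0
      diagonal r x = count-concatMap-zero (meets? r x x) matches Pairs λ {(i , j)} _ → matches-none r x x {i} {j} λ i<j s →
        <⇒≢ i<j ([ (λ (a , b) → trans a (sym b)) , (λ (a , b) → trans a (sym b)) ]′ (same-match r (inj₁ (φ-diagonal r x)) s))

      sorted : ∀ r x y {i j} → i < j → Solves r x y i j → meetings r gs x y ≡ 1
      sorted r x y {i} {j} i<j s =
        count-concatMap (meets? r x y) matches (cartesianProduct⁺ (allFin⁺ n) (allFin⁺ n))
          (∈-cartesianProduct⁺ (∈-allFin i) (∈-allFin j)) (matches-one r x y i<j s)
          (λ (i′ , j′) ≢ij → matches-none r x y (λ i′<j′ s′ → elsewhere ≢ij i′<j′ (same-match r s s′)))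
        where
        elsewhere : ∀ {i′ j′} → (i′ , j′) ≢ (i , j) → i′ < j′ → ¬ ((i′ ≡ i × j′ ≡ j) ⊎ (i′ ≡ j × j′ ≡ i))
        elsewhere ≢ij _     (inj₁ (refl , refl)) = ≢ij refl
        elsewhere _   i′<j′ (inj₂ (refl , refl)) = <-asym i<j i′<j′

      once : ∀ r {x y} → x ≢ y → meetings r gs x y ≡ 1
      once r {x} {y} x≢y with solution r x y
      ... | i , j , e with <-cmp i j
      ...   | tri< i<j _ _  = sorted r x y i<j (inj₁ e)
      ...   | tri> _ _ j<i  = sorted r x y j<i (inj₂ e)
      ...   | tri≈ _ refl _ = contradiction (trans (sym (,-injectiveˡ d)) (,-injectiveʳ d)) x≢y
        where
        d : (i , i) ≡ (x , y)
        d = trans (sym (φ-diagonal r i)) e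

      mixed : ∀ r → MixedMeetings (const true) (meetings r gs)
      mixed r = record { spouses = λ x _ → diagonal r x ; others = λ x y ¬xy → once r (λ e → ¬xy (e , refl)) }

      same : ∀ r → SameSexOpposition (λ _ → true ≡ true) (meetings r gs)
      same r = record { with-spouse = λ p _ q q≢p → once r (≢-sym q≢p) ; without-spouse = λ p ¬p → contradiction refl ¬p }

    selfOrthogonal⇒tournament : AllSpouses n
    selfOrthogonal⇒tournament = record
      { games = gs ; partners = mixed partnersᴹ ; opponents = mixed opponentsᴹ ; men = same menᴹ ; women = same womenᴹ }

-- Designs and squares that are linear over a finite commutative ring.

module LinearConstructions where

  open import Algebra.Bundles using (CommutativeRing)
  open import Algebra.Consequences.Propositional using (comm∧idˡ⇒id; comm∧invˡ⇒inv; comm∧distrˡ⇒distrʳ)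
  import Algebra.Properties.AbelianGroup
  import Algebra.Properties.CommutativeSemigroup
  import Algebra.Properties.Group
  import Algebra.Properties.Ring
  open import Data.Fin using (Fin)
  open import Data.Fin.Properties using (_≟_)
  open import Data.Nat using (ℕ)
  open import Data.Product using (∃; _,_; proj₁; proj₂)
  open import Level using (0ℓ)
  open import Relation.Binary.PropositionalEquality
    using (_≡_; _≢_; sym; trans; cong; cong₂; isEquivalence; module ≡-Reasoning)
  open import Relation.Nullary using (yes; no; contradiction)
  open Planes
  open LatinSquares

  record FinRing (m : ℕ) : Set where
    infixl 6 _+_
    infixl 7 _*_
    field
      _+_ _*_ : Fin m → Fin m → Fin m
      -_      : Fin m → Fin m
      0# 1#   : Fin m
      +-assoc      : ∀ x y z → (x + y) + z ≡ x + (y + z)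
      +-comm       : ∀ x y → x + y ≡ y + x
      +-identityˡ  : ∀ x → 0# + x ≡ x
      -‿inverseˡ   : ∀ x → (- x) + x ≡ 0#
      *-assoc      : ∀ x y z → (x * y) * z ≡ x * (y * z)
      *-comm       : ∀ x y → x * y ≡ y * x
      *-identityˡ  : ∀ x → 1# * x ≡ x
      distribˡ     : ∀ x y z → x * (y + z) ≡ (x * y) + (x * z)

    commutativeRing : CommutativeRing 0ℓ 0ℓ
    commutativeRing = record
      { Carrier = Fin m ; _≈_ = _≡_ ; _+_ = _+_ ; _*_ = _*_ ; -_ = -_ ; 0# = 0# ; 1# = 1#
      ; isCommutativeRing = record
        { isRing = record
          { +-isAbelianGroup = record
            { isGroup = record
              { isMonoid = record
                { isSemigroup = record
                  { isMagma = record { isEquivalence = isEquivalence ; ∙-cong = cong₂ _+_ }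
                  ; assoc = +-assoc }
                ; identity = comm∧idˡ⇒id +-comm +-identityˡ }
              ; inverse = comm∧invˡ⇒inv +-comm -‿inverseˡ
              ; ⁻¹-cong = cong -_ }
            ; comm = +-comm }
          ; *-cong = cong₂ _*_
          ; *-assoc = *-assoc
          ; *-identity = comm∧idˡ⇒id *-comm *-identityˡ
            ; distrib = distribˡ , comm∧distrˡ⇒distrʳ *-comm distribˡ }
        ; *-comm = *-comm } }

  module _ {m : ℕ} (R : FinRing m) where

    open CommutativeRing (FinRing.commutativeRing R)
      using (_+_; _*_; _-_; -_; 0#; 1#; +-assoc; +-comm; +-identityʳ; -‿inverseʳ; *-assoc; *-comm; *-identityˡ;
             zeroʳ; distribʳ; distribˡ; ring; +-group; +-abelianGroup; +-commutativeSemigroup; *-commutativeSemigroup)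
    open Algebra.Properties.Ring ring using (x[y-z]≈xy-xz; [y-z]x≈yx-zx)
    open Algebra.Properties.Group +-group using (//-rightDividesˡ; //-rightDividesʳ)
    open Algebra.Properties.AbelianGroup +-abelianGroup using (xyx⁻¹≈y; ⁻¹-∙-comm)
    open Algebra.Properties.CommutativeSemigroup +-commutativeSemigroup using (interchange)
    open Algebra.Properties.CommutativeSemigroup *-commutativeSemigroup using (x∙yz≈y∙xz)
    open ≡-Reasoning

    private
      +-cancelˡ : ∀ c x y → (c + x) - (c + y) ≡ x - y
      +-cancelˡ c x y = begin
        (c + x) - (c + y)        ≡⟨ cong ((c + x) +_) (⁻¹-∙-comm c y) ⟨
        (c + x) + (- c + - y)    ≡⟨ interchange c x (- c) (- y) ⟩
        (c - c) + (x - y)        ≡⟨ cong (_+ (x - y)) (-‿inverseʳ c) ⟩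
        0# + (x - y)             ≡⟨ +-comm 0# _ ⟩
        (x - y) + 0#             ≡⟨ +-identityʳ _ ⟩
        x - y                    ∎

      +-telescope : ∀ x c y → (x - c) + (c - y) ≡ x - y
      +-telescope x c y = begin
        (x - c) + (c - y)        ≡⟨ +-assoc (x - c) c (- y) ⟨
        (x - c) + c - y          ≡⟨ cong (_- y) (//-rightDividesˡ c x) ⟩
        x - y                    ∎

      unit-cancel : ∀ {u a} → u * a ≡ 1# → ∀ x → u * (a * x) ≡ x
      unit-cancel {u} {a} e x = trans (sym (*-assoc u a x)) (trans (cong (_* x) e) (*-identityˡ x))

      unit-cancel′ : ∀ {u a} → u * a ≡ 1# → ∀ x → a * (u * x) ≡ x
      unit-cancel′ {u} {a} e x = trans (x∙yz≈y∙xz a u x) (unit-cancel e x)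

    module _ {K : ℕ} (slope : Fin K → Fin m)
      (units : ∀ {i j} → i ≢ j → ∃ λ u → u * (slope i - slope j) ≡ 1#) where

      private
        inv : Fin K → Fin K → Fin m
        inv i j with i ≟ j
        -- A placeholder: `meet` is specified for distinct groups only.
        ... | yes _   = 0#
        ... | no  i≢j = proj₁ (units i≢j)

        inverse : ∀ {i j} → i ≢ j → inv i j * (slope i - slope j) ≡ 1#
        inverse {i} {j} i≢j with i ≟ j
        ... | yes e   = contradiction e i≢j
        ... | no  i≢j = proj₂ (units i≢j)

        meet-val : ∀ {i j} → i ≢ j → ∀ p q → inv i j * ((q + slope i * p) - (q + slope j * p)) ≡ p
        meet-val {i} {j} i≢j p q = begin
          inv i j * ((q + slope i * p) - (q + slope j * p)) ≡⟨ cong (inv i j *_) (+-cancelˡ q _ _) ⟩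
          inv i j * (slope i * p - slope j * p)             ≡⟨ cong (inv i j *_) ([y-z]x≈yx-zx p _ _) ⟨
          inv i j * ((slope i - slope j) * p)               ≡⟨ unit-cancel (inverse i≢j) p ⟩
          p                                                 ∎

        lift-meet : ∀ {i j} → i ≢ j → ∀ x y → let p = inv i j * (x - y) in x - slope i * p ≡ y - slope j * p
        lift-meet {i} {j} i≢j x y = begin
          x - slope i * p                            ≡⟨ cong (_- slope i * p) (//-rightDividesˡ y x) ⟨
          (x - y) + y - slope i * p                  ≡⟨ cong (λ z → z + y - slope i * p) difference ⟨
          (slope i * p - slope j * p) + y - slope i * p ≡⟨ cong (_- slope i * p) (+-assoc _ _ y) ⟩
          slope i * p + (- (slope j * p) + y) - slope i * p ≡⟨ xyx⁻¹≈y (slope i * p) _ ⟩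
          - (slope j * p) + y                        ≡⟨ +-comm _ y ⟩
          y - slope j * p                            ∎
          where
          p : Fin m
          p = inv i j * (x - y)

          difference : slope i * p - slope j * p ≡ x - y
          difference = trans (sym ([y-z]x≈yx-zx p _ _)) (unit-cancel′ (inverse i≢j) (x - y))

      -- Subtracting the values in two groups removes `q` and leaves `(slope i - slope j) * p`, so
      -- an inverse of the difference of slopes recovers `p`.
      linearPlane : Plane K m
      linearPlane = record
        { 0#   = 0#
        ; val  = λ i p q → q + slope i * p
        ; lift = λ i p x → x - slope i * p
        ; meet = λ i j x y → inv i j * (x - y)
        ; val-0     = λ i q → trans (cong (q +_) (zeroʳ (slope i))) (+-identityʳ q)
        ; val-lift  = λ i p x → //-rightDividesˡ (slope i * p) x
        ; lift-val  = λ i p q → //-rightDividesʳ (slope i * p) q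
        ; meet-val  = meet-val
        ; lift-meet = lift-meet
        }

    module _ (a b u v w : Fin m) (a+b≡1 : a + b ≡ 1#)
      (u-inverse : u * a ≡ 1#) (v-inverse : v * b ≡ 1#) (w-inverse : w * (a - b) ≡ 1#) where

      private
        -- Adding `b * a` to both squares lets a factor `a + b` come out of each.
        a²-b² : a * a - b * b ≡ a - b
        a²-b² = begin
          a * a - b * b                     ≡⟨ +-cancelˡ (b * a) (a * a) (b * b) ⟨
          (b * a + a * a) - (b * a + b * b) ≡⟨ cong₂ _-_ (distribʳ a b a) (distribˡ b a b) ⟨
          (b + a) * a - b * (a + b)         ≡⟨ cong₂ (λ s t → s * a - b * t) (trans (+-comm b a) a+b≡1) a+b≡1 ⟩
          1# * a - b * 1#                   ≡⟨ cong₂ _-_ (*-identityˡ a) (trans (*-comm b 1#) (*-identityˡ b)) ⟩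
          a - b                             ∎

        idem : ∀ x → a * x + b * x ≡ x
        idem x = trans (sym (distribʳ x a b)) (trans (cong (_* x) a+b≡1) (*-identityˡ x))

        squares : ∀ x → a * (a * x) - b * (b * x) ≡ (a - b) * x
        squares x = begin
          a * (a * x) - b * (b * x) ≡⟨ cong₂ _-_ (*-assoc a a x) (*-assoc b b x) ⟨
          a * a * x - b * b * x     ≡⟨ [y-z]x≈yx-zx x _ _ ⟨
          (a * a - b * b) * x       ≡⟨ cong (_* x) a²-b² ⟩
          (a - b) * x               ∎

        ∙-pair : ∀ s t → a * (w * (a * s - b * t)) + b * (w * (a * t - b * s)) ≡ s
        ∙-pair s t = begin
          a * (w * (a * s - b * t)) + b * (w * (a * t - b * s))         ≡⟨ cong₂ _+_ (x∙yz≈y∙xz a w _) (x∙yz≈y∙xz b w _) ⟩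
          w * (a * (a * s - b * t)) + w * (b * (a * t - b * s))         ≡⟨ distribˡ w _ _ ⟨
          w * (a * (a * s - b * t) + b * (a * t - b * s))               ≡⟨ cong (w *_) (cong₂ _+_ (x[y-z]≈xy-xz a _ _) (x[y-z]≈xy-xz b _ _)) ⟩
          w * ((a * (a * s) - a * (b * t)) + (b * (a * t) - b * (b * s))) ≡⟨ cong (λ z → w * ((a * (a * s) - z) + (b * (a * t) - b * (b * s)))) (x∙yz≈y∙xz a b t) ⟩
          w * ((a * (a * s) - b * (a * t)) + (b * (a * t) - b * (b * s))) ≡⟨ cong (w *_) (+-telescope _ _ _) ⟩
          w * (a * (a * s) - b * (b * s))                               ≡⟨ cong (w *_) (squares s) ⟩
          w * ((a - b) * s)                                             ≡⟨ unit-cancel w-inverse s ⟩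
          s                                                             ∎

        pair-∙ : ∀ x y → w * (a * (a * x + b * y) - b * (a * y + b * x)) ≡ x
        pair-∙ x y = begin
          w * (a * (a * x + b * y) - b * (a * y + b * x))                ≡⟨ cong (w *_) (cong₂ _-_ (distribˡ a _ _) (distribˡ b _ _)) ⟩
          w * ((a * (a * x) + a * (b * y)) - (b * (a * y) + b * (b * x))) ≡⟨ cong (λ z → w * (z - (b * (a * y) + b * (b * x)))) (trans (+-comm _ _) (cong (_+ a * (a * x)) (x∙yz≈y∙xz a b y))) ⟩
          w * ((b * (a * y) + a * (a * x)) - (b * (a * y) + b * (b * x))) ≡⟨ cong (w *_) (+-cancelˡ _ _ _) ⟩
          w * (a * (a * x) - b * (b * x))                                ≡⟨ cong (w *_) (squares x) ⟩
          w * ((a - b) * x)                                              ≡⟨ unit-cancel w-inverse x ⟩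
          x                                                              ∎

      -- The map `(x , y) ↦ (x ∙ y , y ∙ x)` has determinant `a * a - b * b`, which is `a - b`
      -- because `a + b ≡ 1#`. So `w` inverts it and `pair` is Cramer's rule.
      linearSquare : SelfOrthogonal m
      linearSquare = record
        { _∙_  = λ x y → a * x + b * y
        ; ldiv = λ x z → v * (z - a * x)
        ; rdiv = λ z y → u * (z - b * y)
        ; pair = λ s t → w * (a * s - b * t)
        ; idem    = idem
        ; ∙-ldiv  = λ x z → trans (cong (a * x +_) (unit-cancel′ v-inverse _)) (trans (+-comm _ _) (//-rightDividesˡ _ z))
        ; ldiv-∙  = λ x y → trans (cong (v *_) (xyx⁻¹≈y (a * x) (b * y))) (unit-cancel v-inverse y)
        ; ∙-rdiv  = λ z y → trans (cong (_+ b * y) (unit-cancel′ u-inverse _)) (//-rightDividesˡ _ z)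
        ; rdiv-∙  = λ x y → trans (cong (u *_) (//-rightDividesʳ (b * y) (a * x))) (unit-cancel u-inverse x)
        ; ∙-pair  = ∙-pair
        ; pair-∙  = pair-∙
        }

-- The rings ℤ/m.

module ResidueRings where

  open import Algebra.Bundles using (CommutativeRing)
  import Algebra.Properties.AbelianGroup
  import Algebra.Properties.Group
  import Algebra.Properties.Ring
  open import Data.Fin using (Fin; toℕ; fromℕ<)
  open import Data.Fin.Properties using (toℕ<n; toℕ≤n; toℕ-fromℕ<; toℕ-injective)
  open import Data.Nat as ℕ using (ℕ; suc; _∸_; _≤_; _<_; z≤n; s≤s; _%_)
  open import Data.Nat.Coprimality using (Coprime; coprime-Bézout)
  open import Data.Nat.DivMod using (m%n<n; m<n⇒m%n≡m; %-distribˡ-+; %-distribˡ-*; [m+kn]%n≡m%n; n%n≡0)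
  open import Data.Nat.GCD using (module Bézout)
  open import Data.Nat.Properties
    using (+-assoc; +-comm; *-assoc; *-comm; *-identityˡ; *-distribˡ-+; m∸n+n≡m; <⇒≤; <-cmp; m<n⇒0<n∸m;
           m∸n≤m; ≤-<-trans)
  open import Data.Product using (∃; _,_)
  open import Relation.Binary using (tri<; tri≈; tri>)
  open import Relation.Binary.PropositionalEquality
    using (_≡_; _≢_; refl; sym; trans; cong; cong₂; subst; module ≡-Reasoning)
  open import Relation.Nullary using (contradiction)
  open Planes
  open LatinSquares
  open LinearConstructions

  -- With the ring as an abstract record, the arguments about units, slopes and squares use only
  -- these equations and never unfold `_%_`.
  record Residues (m : ℕ) : Set where
    field
      finRing : FinRing m
    open FinRing finRing public
    field
      ⟦_⟧         : ℕ → Fin m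
      ⟦⟧-+        : ∀ a b → ⟦ a ⟧ + ⟦ b ⟧ ≡ ⟦ a ℕ.+ b ⟧
      ⟦⟧-*        : ∀ a b → ⟦ a ⟧ * ⟦ b ⟧ ≡ ⟦ a ℕ.* b ⟧
      ⟦⟧-0        : ⟦ 0 ⟧ ≡ 0#
      ⟦⟧-1        : ⟦ 1 ⟧ ≡ 1#
      ⟦⟧-multiple : ∀ a k → ⟦ a ℕ.+ k ℕ.* m ⟧ ≡ ⟦ a ⟧

  module Mod (r : ℕ) where

    open import Data.Nat using (_+_; _*_)

    private
      m : ℕ
      m = suc r

    ⟦_⟧ : ℕ → Fin m
    ⟦ a ⟧ = fromℕ< (m%n<n a m)

    private
      infixl 6 _⊕_
      infixl 7 _⊗_
      _⊕_ _⊗_ : Fin m → Fin m → Fin m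
      x ⊕ y = ⟦ toℕ x + toℕ y ⟧
      x ⊗ y = ⟦ toℕ x * toℕ y ⟧

      ⊖_ : Fin m → Fin m
      ⊖ x = ⟦ m ∸ toℕ x ⟧

      toℕ-⟦⟧ : ∀ a → toℕ ⟦ a ⟧ ≡ a % m
      toℕ-⟦⟧ a = toℕ-fromℕ< (m%n<n a m)

      ⟦⟧-cong : ∀ a b → a % m ≡ b % m → ⟦ a ⟧ ≡ ⟦ b ⟧
      ⟦⟧-cong a b e = toℕ-injective (trans (toℕ-⟦⟧ a) (trans e (sym (toℕ-⟦⟧ b))))

      ⟦toℕ⟧ : ∀ x → ⟦ toℕ x ⟧ ≡ x
      ⟦toℕ⟧ x = toℕ-injective (trans (toℕ-⟦⟧ (toℕ x)) (m<n⇒m%n≡m (toℕ<n x)))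

    ⟦⟧-+ : ∀ a b → ⟦ a ⟧ ⊕ ⟦ b ⟧ ≡ ⟦ a + b ⟧
    ⟦⟧-+ a b = ⟦⟧-cong (toℕ ⟦ a ⟧ + toℕ ⟦ b ⟧) (a + b) (trans (cong₂ (λ x y → (x + y) % m) (toℕ-⟦⟧ a) (toℕ-⟦⟧ b)) (sym (%-distribˡ-+ a b m)))

    ⟦⟧-* : ∀ a b → ⟦ a ⟧ ⊗ ⟦ b ⟧ ≡ ⟦ a * b ⟧
    ⟦⟧-* a b = ⟦⟧-cong (toℕ ⟦ a ⟧ * toℕ ⟦ b ⟧) (a * b) (trans (cong₂ (λ x y → (x * y) % m) (toℕ-⟦⟧ a) (toℕ-⟦⟧ b)) (sym (%-distribˡ-* a b m)))

    ⟦⟧-multiple : ∀ a k → ⟦ a + k * m ⟧ ≡ ⟦ a ⟧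
    ⟦⟧-multiple a k = ⟦⟧-cong (a + k * m) a ([m+kn]%n≡m%n a k m)

    private
      -- Every residue has the form `⟦ a ⟧`, so the ring laws reduce to those of ℕ.
      elim₁ : (P : Fin m → Set) → (∀ a → P ⟦ a ⟧) → ∀ x → P x
      elim₁ P h x = subst P (⟦toℕ⟧ x) (h (toℕ x))

      elim₃ : (P : Fin m → Fin m → Fin m → Set) → (∀ a b c → P ⟦ a ⟧ ⟦ b ⟧ ⟦ c ⟧) → ∀ x y z → P x y z
      elim₃ P h x y z = elim₁ (λ x → P x y z) (λ a → elim₁ (λ y → P _ y z) (λ b → elim₁ (P _ _) (h a b) z) y) x

      open ≡-Reasoning

      ⊕-assoc : ∀ x y z → (x ⊕ y) ⊕ z ≡ x ⊕ (y ⊕ z)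
      ⊕-assoc = elim₃ _ λ a b c → begin
        (⟦ a ⟧ ⊕ ⟦ b ⟧) ⊕ ⟦ c ⟧ ≡⟨ cong (_⊕ ⟦ c ⟧) (⟦⟧-+ a b) ⟩
        ⟦ a + b ⟧ ⊕ ⟦ c ⟧       ≡⟨ ⟦⟧-+ (a + b) c ⟩
        ⟦ a + b + c ⟧           ≡⟨ cong ⟦_⟧ (+-assoc a b c) ⟩
        ⟦ a + (b + c) ⟧         ≡⟨ ⟦⟧-+ a (b + c) ⟨
        ⟦ a ⟧ ⊕ ⟦ b + c ⟧       ≡⟨ cong (⟦ a ⟧ ⊕_) (⟦⟧-+ b c) ⟨
        ⟦ a ⟧ ⊕ (⟦ b ⟧ ⊕ ⟦ c ⟧) ∎

      ⊗-assoc : ∀ x y z → (x ⊗ y) ⊗ z ≡ x ⊗ (y ⊗ z)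
      ⊗-assoc = elim₃ _ λ a b c → begin
        (⟦ a ⟧ ⊗ ⟦ b ⟧) ⊗ ⟦ c ⟧ ≡⟨ cong (_⊗ ⟦ c ⟧) (⟦⟧-* a b) ⟩
        ⟦ a * b ⟧ ⊗ ⟦ c ⟧       ≡⟨ ⟦⟧-* (a * b) c ⟩
        ⟦ a * b * c ⟧           ≡⟨ cong ⟦_⟧ (*-assoc a b c) ⟩
        ⟦ a * (b * c) ⟧         ≡⟨ ⟦⟧-* a (b * c) ⟨
        ⟦ a ⟧ ⊗ ⟦ b * c ⟧       ≡⟨ cong (⟦ a ⟧ ⊗_) (⟦⟧-* b c) ⟨
        ⟦ a ⟧ ⊗ (⟦ b ⟧ ⊗ ⟦ c ⟧) ∎

      ⊗-distribˡ : ∀ x y z → x ⊗ (y ⊕ z) ≡ (x ⊗ y) ⊕ (x ⊗ z)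
      ⊗-distribˡ = elim₃ _ λ a b c → begin
        ⟦ a ⟧ ⊗ (⟦ b ⟧ ⊕ ⟦ c ⟧)               ≡⟨ cong (⟦ a ⟧ ⊗_) (⟦⟧-+ b c) ⟩
        ⟦ a ⟧ ⊗ ⟦ b + c ⟧                     ≡⟨ ⟦⟧-* a (b + c) ⟩
        ⟦ a * (b + c) ⟧                       ≡⟨ cong ⟦_⟧ (*-distribˡ-+ a b c) ⟩
        ⟦ a * b + a * c ⟧                     ≡⟨ ⟦⟧-+ (a * b) (a * c) ⟨
        ⟦ a * b ⟧ ⊕ ⟦ a * c ⟧                 ≡⟨ cong₂ _⊕_ (⟦⟧-* a b) (⟦⟧-* a c) ⟨
        (⟦ a ⟧ ⊗ ⟦ b ⟧) ⊕ (⟦ a ⟧ ⊗ ⟦ c ⟧)     ∎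

      ⊖-inverseˡ : ∀ x → (⊖ x) ⊕ x ≡ ⟦ 0 ⟧
      ⊖-inverseˡ x = begin
        ⟦ m ∸ toℕ x ⟧ ⊕ x             ≡⟨ cong (⟦ m ∸ toℕ x ⟧ ⊕_) (⟦toℕ⟧ x) ⟨
        ⟦ m ∸ toℕ x ⟧ ⊕ ⟦ toℕ x ⟧     ≡⟨ ⟦⟧-+ (m ∸ toℕ x) (toℕ x) ⟩
        ⟦ m ∸ toℕ x + toℕ x ⟧         ≡⟨ cong ⟦_⟧ (m∸n+n≡m (toℕ≤n x)) ⟩
        ⟦ m ⟧                         ≡⟨ ⟦⟧-cong m 0 (n%n≡0 m) ⟩
        ⟦ 0 ⟧                         ∎

    modRing : FinRing m
    modRing = record
      { _+_ = _⊕_ ; _*_ = _⊗_ ; -_ = ⊖_ ; 0# = ⟦ 0 ⟧ ; 1# = ⟦ 1 ⟧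
      ; +-assoc = ⊕-assoc
      ; +-comm  = λ x y → cong ⟦_⟧ (+-comm (toℕ x) (toℕ y))
      ; +-identityˡ = elim₁ _ (⟦⟧-+ 0)
      ; -‿inverseˡ = ⊖-inverseˡ
      ; *-assoc = ⊗-assoc
      ; *-comm  = λ x y → cong ⟦_⟧ (*-comm (toℕ x) (toℕ y))
      ; *-identityˡ = elim₁ _ (λ a → trans (⟦⟧-* 1 a) (cong ⟦_⟧ (*-identityˡ a)))
      ; distribˡ = ⊗-distribˡ
      }

    residues : Residues m
    residues = record
      { finRing = modRing ; ⟦_⟧ = ⟦_⟧ ; ⟦⟧-+ = ⟦⟧-+ ; ⟦⟧-* = ⟦⟧-* ; ⟦⟧-0 = refl ; ⟦⟧-1 = refl
      ; ⟦⟧-multiple = ⟦⟧-multiple }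

  module _ {m : ℕ} (ℤₘ : Residues m) where

    open Residues ℤₘ
    open ≡-Reasoning

    private
      module R = CommutativeRing commutativeRing
    open Algebra.Properties.Ring R.ring using (-‿distribˡ-*; -‿distribʳ-*)
    open Algebra.Properties.Group R.+-group using (⁻¹-involutive; inverseˡ-unique; //-rightDividesʳ)
    open Algebra.Properties.AbelianGroup R.+-abelianGroup using (⁻¹-anti-homo‿-)

    Unit : Fin m → Set
    Unit x = ∃ λ u → u * x ≡ 1#

    unit-neg : ∀ {x} → Unit x → Unit (- x)
    unit-neg {x} (u , e) = - u , (begin
      (- u) * (- x)   ≡⟨ -‿distribˡ-* u (- x) ⟨
      - (u * (- x))   ≡⟨ cong -_ (-‿distribʳ-* u x) ⟨
      - (- (u * x))   ≡⟨ ⁻¹-involutive (u * x) ⟩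
      u * x           ≡⟨ e ⟩
      1#              ∎)

    coprime⇒unit : ∀ {d} → Coprime d m → Unit ⟦ d ⟧
    coprime⇒unit {d} c with coprime-Bézout c
    ... | Bézout.+- x y e = ⟦ x ⟧ , trans (⟦⟧-* x d) (trans (cong ⟦_⟧ (sym e)) (trans (⟦⟧-multiple 1 y) ⟦⟧-1))
    -- Here `e` reads `1 + x * d ≡ y * m`, so `x * d` is congruent to `-1` and the inverse is the
    -- negative of `x`.
    ... | Bézout.-+ x y e = - ⟦ x ⟧ , (begin
      (- ⟦ x ⟧) * ⟦ d ⟧   ≡⟨ -‿distribˡ-* ⟦ x ⟧ ⟦ d ⟧ ⟨
      - (⟦ x ⟧ * ⟦ d ⟧)   ≡⟨ cong -_ (⟦⟧-* x d) ⟩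
      - ⟦ x ℕ.* d ⟧       ≡⟨ inverseˡ-unique 1# ⟦ x ℕ.* d ⟧ (trans (cong (_+ ⟦ x ℕ.* d ⟧) (sym ⟦⟧-1)) (trans (⟦⟧-+ 1 (x ℕ.* d))
                               (trans (cong ⟦_⟧ e) (trans (⟦⟧-multiple 0 y) ⟦⟧-0)))) ⟨
      1#                  ∎)

    private
      ⟦⟧-∸ : ∀ {a b} → b ≤ a → ⟦ a ⟧ + (- ⟦ b ⟧) ≡ ⟦ a ∸ b ⟧
      ⟦⟧-∸ {a} {b} b≤a = begin
        ⟦ a ⟧ + (- ⟦ b ⟧)                   ≡⟨ cong (λ z → ⟦ z ⟧ + (- ⟦ b ⟧)) (m∸n+n≡m b≤a) ⟨
        ⟦ a ∸ b ℕ.+ b ⟧ + (- ⟦ b ⟧)           ≡⟨ cong (_+ (- ⟦ b ⟧)) (⟦⟧-+ (a ∸ b) b) ⟨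
        ⟦ a ∸ b ⟧ + ⟦ b ⟧ + (- ⟦ b ⟧)       ≡⟨ //-rightDividesʳ ⟦ b ⟧ ⟦ a ∸ b ⟧ ⟩
        ⟦ a ∸ b ⟧                           ∎

    module _ {K : ℕ} (coprime : ∀ d → 0 < d → d < K → Coprime d m) where

      private
        slope : Fin K → Fin m
        slope i = ⟦ toℕ i ⟧

        below : ∀ {i j : Fin K} → toℕ j < toℕ i → Unit (slope i + (- slope j))
        below {i} {j} j<i = subst Unit (sym (⟦⟧-∸ (<⇒≤ j<i)))
          (coprime⇒unit (coprime (toℕ i ∸ toℕ j) (m<n⇒0<n∸m j<i) (≤-<-trans (m∸n≤m (toℕ i) (toℕ j)) (toℕ<n i))))

        units : ∀ {i j} → i ≢ j → Unit (slope i + (- slope j))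
        units {i} {j} i≢j with <-cmp (toℕ i) (toℕ j)
        ... | tri> _ _ j<i = below j<i
        ... | tri≈ _ e _   = contradiction (toℕ-injective e) i≢j
        ... | tri< i<j _ _ = subst Unit (⁻¹-anti-homo‿- (slope j) (slope i)) (unit-neg (below i<j))

      -- The slopes are 0, 1, ... , `K - 1`; their differences are, up to sign, numbers strictly
      -- between 0 and `K`.
      modPlane : Plane K m
      modPlane = linearPlane finRing slope units

    -- The square is `2 x - y`. Its coefficients 2 and -1 add up to 1 and differ by 3, which
    -- explains the two hypotheses.
    modSquare : Coprime 2 m → Coprime 3 m → SelfOrthogonal m
    modSquare c₂ c₃ with coprime⇒unit c₂ | coprime⇒unit c₃ | unit-neg (1# , R.*-identityˡ 1#)
    ... | u , u-inverse | w , w-inverse | v , v-inverse =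
      linearSquare finRing ⟦ 2 ⟧ (- 1#) u v w
        (trans (cong (λ z → ⟦ 2 ⟧ + (- z)) (sym ⟦⟧-1)) (trans (⟦⟧-∸ {2} {1} (s≤s z≤n)) ⟦⟧-1)) u-inverse v-inverse
        (trans (cong (w *_) (trans (cong (⟦ 2 ⟧ +_) (trans (⁻¹-involutive 1#) (sym ⟦⟧-1))) (⟦⟧-+ 2 1))) w-inverse)

-- Fields of order 8, 9 and 16.

module GaloisFields where

  open import Algebra.Bundles using (CommutativeRing)
  import Algebra.Properties.Group
  open import Data.Fin using (Fin; toℕ; inject≤; #_)
  open import Data.Fin.Properties using (_≟_; all?; toℕ-inject≤; toℕ-injective)
  open import Data.List using (List; []; _∷_)
  open import Data.Nat using (ℕ; zero; suc; _∸_; _≤_; _%_; _/_; NonZero)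
  open import Data.Product using (∃; _,_)
  open import Data.Sum using (_⊎_; inj₁; inj₂)
  open import Relation.Binary.PropositionalEquality using (_≡_; _≢_; refl; sym; trans; cong)
  open import Relation.Nullary using (contradiction)
  open import Relation.Nullary.Decidable using (True; toWitness; _×-dec_; _⊎-dec_)
  open Planes
  open LatinSquares
  open LinearConstructions
  open ResidueRings

  record FinField (q : ℕ) : Set where
    field
      finRing  : FinRing q
    open FinRing finRing public
    field
      reciprocal : Fin q → Fin q
      inverse    : ∀ x → x ≡ 0# ⊎ reciprocal x * x ≡ 1#

    unit : ∀ {x} → x ≢ 0# → ∃ λ u → u * x ≡ 1#
    unit {x} x≢0 with inverse x
    ... | inj₁ e = contradiction e x≢0
    ... | inj₂ e = reciprocal x , e

  module _ {q : ℕ} (𝔽 : FinField q) where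

    open FinField 𝔽
    open Algebra.Properties.Group (CommutativeRing.+-group commutativeRing) using (x∙y⁻¹≈ε⇒x≈y)

    fieldPlane : ∀ {K} → K ≤ q → Plane K q
    fieldPlane K≤q = linearPlane finRing (λ i → inject≤ i K≤q) λ i≢j → unit λ e →
      i≢j (toℕ-injective (trans (sym (toℕ-inject≤ _ K≤q)) (trans (cong toℕ (x∙y⁻¹≈ε⇒x≈y _ _ e)) (toℕ-inject≤ _ K≤q))))

    fieldSquare : ∀ a b → a + b ≡ 1# → a ≢ 0# → b ≢ 0# → a + (- b) ≢ 0# → SelfOrthogonal q
    fieldSquare a b a+b≡1 a≢0 b≢0 a≢b with unit a≢0 | unit b≢0 | unit a≢b
    ... | u , eᵤ | v , eᵥ | w , e_w = linearSquare finRing a b u v w a+b≡1 eᵤ eᵥ e_w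

  nth : List ℕ → ℕ → ℕ
  nth []       _       = 0
  nth (x ∷ _)  zero    = x
  nth (_ ∷ xs) (suc i) = nth xs i

  -- Elements are polynomials over ℤ/p of degree below k, encoded by their digits in base p;
  -- powers lists the powers of a primitive element, and logs its discrete logarithms (with a junk value at 0).
  module PrimePower (p k r : ℕ) .{{_ : NonZero p}} .{{_ : NonZero r}} (powers logs : List ℕ) where

    open import Data.Nat using (_+_; _*_)
    open Mod r using (⟦_⟧)

    private
      addDigits : ℕ → ℕ → ℕ → ℕ
      addDigits zero    a b = 0
      addDigits (suc k) a b = (a + b) % p + p * addDigits k (a / p) (b / p)

      negDigits : ℕ → ℕ → ℕ
      negDigits zero    a = 0
      negDigits (suc k) a = (p ∸ a % p) % p + p * negDigits k (a / p)

      mulℕ : ℕ → ℕ → ℕ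
      mulℕ zero    _       = 0
      mulℕ (suc _) zero    = 0
      mulℕ a@(suc _) b@(suc _) = nth powers ((nth logs a + nth logs b) % r)

    infixl 6 _⊕_
    infixl 7 _⊗_
    _⊕_ _⊗_ : Fin (suc r) → Fin (suc r) → Fin (suc r)
    x ⊕ y = ⟦ addDigits k (toℕ x) (toℕ y) ⟧
    x ⊗ y = ⟦ mulℕ (toℕ x) (toℕ y) ⟧

    ⊖_ : Fin (suc r) → Fin (suc r)
    ⊖ x = ⟦ negDigits k (toℕ x) ⟧

    recip : Fin (suc r) → Fin (suc r)
    recip x = ⟦ nth powers ((r ∸ nth logs (toℕ x)) % r) ⟧

    private
      0ᶠ 1ᶠ : Fin (suc r)
      0ᶠ = ⟦ 0 ⟧
      1ᶠ = ⟦ 1 ⟧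

      laws? = all? (λ x → all? λ y → all? λ z → (x ⊕ y) ⊕ z ≟ x ⊕ (y ⊕ z))
        ×-dec all? (λ x → all? λ y → x ⊕ y ≟ y ⊕ x)
        ×-dec all? (λ x → 0ᶠ ⊕ x ≟ x)
        ×-dec all? (λ x → (⊖ x) ⊕ x ≟ 0ᶠ)
        ×-dec all? (λ x → all? λ y → all? λ z → (x ⊗ y) ⊗ z ≟ x ⊗ (y ⊗ z))
        ×-dec all? (λ x → all? λ y → x ⊗ y ≟ y ⊗ x)
        ×-dec all? (λ x → 1ᶠ ⊗ x ≟ x)
        ×-dec all? (λ x → all? λ y → all? λ z → x ⊗ (y ⊕ z) ≟ (x ⊗ y) ⊕ (x ⊗ z))
        ×-dec all? (λ x → (x ≟ 0ᶠ) ⊎-dec (recip x ⊗ x ≟ 1ᶠ))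

    -- The axioms are verified by evaluation on all triples, so no theory of irreducible polynomials
    -- enters.
    finField : {True laws?} → FinField (suc r)
    finField {laws} with toWitness laws
    ... | +-assoc , +-comm , +-identityˡ , -‿inverseˡ , *-assoc , *-comm , *-identityˡ , distribˡ , inverse = record
      { finRing = record
        { _+_ = _⊕_ ; _*_ = _⊗_ ; -_ = ⊖_ ; 0# = 0ᶠ ; 1# = 1ᶠ
        ; +-assoc = +-assoc ; +-comm = +-comm ; +-identityˡ = +-identityˡ ; -‿inverseˡ = -‿inverseˡ
        ; *-assoc = *-assoc ; *-comm = *-comm ; *-identityˡ = *-identityˡ ; distribˡ = distribˡ }
      ; reciprocal = recip
      ; inverse = inverse }

  -- The primitive element 2 encodes a root `x` of `x³ = x + 1` over ℤ/2.
  field₈ : FinField 8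
  field₈ = PrimePower.finField 2 3 7 (1 ∷ 2 ∷ 4 ∷ 3 ∷ 6 ∷ 7 ∷ 5 ∷ []) (0 ∷ 0 ∷ 1 ∷ 3 ∷ 2 ∷ 6 ∷ 4 ∷ 5 ∷ [])

  -- The primitive element 3 encodes a root `x` of `x² = x + 1` over ℤ/3.
  field₉ : FinField 9
  field₉ = PrimePower.finField 3 2 8 (1 ∷ 3 ∷ 4 ∷ 7 ∷ 2 ∷ 6 ∷ 8 ∷ 5 ∷ []) (0 ∷ 0 ∷ 4 ∷ 1 ∷ 2 ∷ 7 ∷ 5 ∷ 3 ∷ 6 ∷ [])

  -- The primitive element 2 encodes a root `x` of `x⁴ = x + 1` over ℤ/2.
  field₁₆ : FinField 16
  field₁₆ = PrimePower.finField 2 4 15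
    (1 ∷ 2 ∷ 4 ∷ 8 ∷ 3 ∷ 6 ∷ 12 ∷ 11 ∷ 5 ∷ 10 ∷ 7 ∷ 14 ∷ 15 ∷ 13 ∷ 9 ∷ [])
    (0 ∷ 0 ∷ 1 ∷ 4 ∷ 2 ∷ 8 ∷ 5 ∷ 10 ∷ 3 ∷ 14 ∷ 9 ∷ 7 ∷ 6 ∷ 13 ∷ 11 ∷ 12 ∷ [])

  -- In characteristic 2 the coefficients `x` and `x + 1` have sum and difference 1.
  square₈ : SelfOrthogonal 8
  square₈ = fieldSquare field₈ (# 2) (# 3) refl (λ ()) (λ ()) (λ ())

  -- The digits of 7 give `2 x + 1`, and `x + (2 x + 1)` is 1 modulo 3.
  square₉ : SelfOrthogonal 9
  square₉ = fieldSquare field₉ (# 3) (# 7) refl (λ ()) (λ ()) (λ ())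

  square₁₆ : SelfOrthogonal 16
  square₁₆ = fieldSquare field₁₆ (# 2) (# 3) refl (λ ()) (λ ()) (λ ())

-- Self-orthogonal squares with a cyclic group of automorphisms.

module Starters where

  open import Data.Bool using (if_then_else_)
  open import Data.Fin using (Fin; toℕ; fromℕ<)
  open import Data.Fin.Properties using (toℕ<n; toℕ-fromℕ<; toℕ-injective)
  open import Data.List using (List; []; _∷_)
  open import Data.Nat using (ℕ; _+_; _*_; _∸_; _<_; _<ᵇ_; _%_; _≟_; _<?_; NonZero)
  open import Data.Nat.Properties using (allUpTo?)
  open import Data.Product using (_×_; _,_)
  open import Relation.Binary.PropositionalEquality using (_≡_; trans; cong; cong₂)
  open import Relation.Nullary using (Dec)
  open import Relation.Nullary.Decidable using (True; toWitness; _×-dec_)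
  open LatinSquares
  open GaloisFields

  -- An operation on ℤ/g ∪ {∞₀ , … , ∞ᵤ₋₁}, with ∞ᵢ encoded as g + i, that is invariant under x ↦ x + 1.
  -- For residues, x ∙ (x + d) is x + steps[d] if steps[d] < g and the infinite point steps[d] otherwise;
  -- x ∙ ∞ᵢ is x + right[i], ∞ᵢ ∙ x is x + left[i], and ∞ᵢ ∙ ∞ⱼ has index αi + βj modulo u.
  record Cyclic : Set where
    constructor cyclic
    field
      steps right left : List ℕ
      α β : ℕ

  module Starter (g u : ℕ) .{{_ : NonZero g}} .{{_ : NonZero u}} where

    apply : Cyclic → ℕ → ℕ → ℕ
    apply (cyclic steps right left α β) x y =
      if x <ᵇ g
      then (if y <ᵇ g then (let v = nth steps ((y + g ∸ x) % g) in if v <ᵇ g then (x + v) % g else v)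
                      else (x + nth right (y ∸ g)) % g)
      else (if y <ᵇ g then (y + nth left (x ∸ g)) % g
                      else g + (α * (x ∸ g) + β * (y ∸ g)) % u)

    module _ (n : ℕ) (op ldiv rdiv pair : Cyclic) where

      private
        _∙_ _╲_ _╱_ _⋄_ : ℕ → ℕ → ℕ
        _∙_ = apply op
        _╲_ = apply ldiv
        _╱_ = apply rdiv
        _⋄_ = apply pair

        For : (ℕ → ℕ → Set) → Set
        For P = ∀ {x} → x < n → ∀ {y} → y < n → P x y

        Closed : Cyclic → Set
        Closed f = For λ x y → apply f x y < n

        closed? : ∀ f → Dec (Closed f)
        closed? f = allUpTo? (λ x → allUpTo? (λ y → apply f x y <? n) n) n

        equal? : ∀ (f h : ℕ → ℕ → ℕ) → Dec (For λ x y → f x y ≡ h x y)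
        equal? f h = allUpTo? (λ x → allUpTo? (λ y → f x y ≟ h x y) n) n

      -- The laws are stated for numbers below `n`, where the operations evaluate by arithmetic on
      -- ℕ; the closure conditions then turn them into operations on `Fin n`.
      Laws : Set
      Laws = (Closed op × Closed ldiv × Closed rdiv × Closed pair)
           × (∀ {x} → x < n → x ∙ x ≡ x)
           × For (λ x z → x ∙ (x ╲ z) ≡ z)
           × For (λ x y → x ╲ (x ∙ y) ≡ y)
           × For (λ z y → (z ╱ y) ∙ y ≡ z)
           × For (λ x y → (x ∙ y) ╱ y ≡ x)
           × For (λ a b → (a ⋄ b) ∙ (b ⋄ a) ≡ a)
           × For (λ x y → (x ∙ y) ⋄ (y ∙ x) ≡ x)

      laws? : Dec Laws
      laws? = (closed? op ×-dec closed? ldiv ×-dec closed? rdiv ×-dec closed? pair)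
        ×-dec allUpTo? (λ x → x ∙ x ≟ x) n
        ×-dec equal? (λ x z → x ∙ (x ╲ z)) (λ x z → z)
        ×-dec equal? (λ x y → x ╲ (x ∙ y)) (λ x y → y)
        ×-dec equal? (λ z y → (z ╱ y) ∙ y) (λ z y → z)
        ×-dec equal? (λ x y → (x ∙ y) ╱ y) (λ x y → x)
        ×-dec equal? (λ a b → (a ⋄ b) ∙ (b ⋄ a)) (λ a b → a)
        ×-dec equal? (λ x y → (x ∙ y) ⋄ (y ∙ x)) (λ x y → x)

      private
        lift : ∀ f → Closed f → Fin n → Fin n → Fin n
        lift f closed x y = fromℕ< (closed (toℕ<n x) (toℕ<n y))

        toℕ-lift : ∀ f (closed : Closed f) x y → toℕ (lift f closed x y) ≡ apply f (toℕ x) (toℕ y)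
        toℕ-lift f closed x y = toℕ-fromℕ< (closed (toℕ<n x) (toℕ<n y))

        equal : ∀ f (closed : Closed f) x y {z} → apply f (toℕ x) (toℕ y) ≡ toℕ z → lift f closed x y ≡ z
        equal f closed x y e = toℕ-injective (trans (toℕ-lift f closed x y) e)

      fromLaws : Laws → SelfOrthogonal n
      fromLaws ((c∙ , c╲ , c╱ , c⋄) , idem , ∙-╲ , ╲-∙ , ╱-∙ , ∙-╱ , ⋄-∙ , ∙-⋄) = record
        { _∙_ = lift op c∙ ; ldiv = lift ldiv c╲ ; rdiv = lift rdiv c╱ ; pair = lift pair c⋄
        ; idem   = λ x → equal op c∙ x x (idem (toℕ<n x))
        ; ∙-ldiv = λ x z → equal op c∙ x _ (trans (cong (toℕ x ∙_) (toℕ-lift ldiv c╲ x z)) (∙-╲ (toℕ<n x) (toℕ<n z)))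
        ; ldiv-∙ = λ x y → equal ldiv c╲ x _ (trans (cong (toℕ x ╲_) (toℕ-lift op c∙ x y)) (╲-∙ (toℕ<n x) (toℕ<n y)))
        ; ∙-rdiv = λ z y → equal op c∙ _ y (trans (cong (_∙ toℕ y) (toℕ-lift rdiv c╱ z y)) (╱-∙ (toℕ<n z) (toℕ<n y)))
        ; rdiv-∙ = λ x y → equal rdiv c╱ _ y (trans (cong (_╱ toℕ y) (toℕ-lift op c∙ x y)) (∙-╱ (toℕ<n x) (toℕ<n y)))
        ; ∙-pair = λ a b → equal op c∙ _ _
            (trans (cong₂ _∙_ (toℕ-lift pair c⋄ a b) (toℕ-lift pair c⋄ b a)) (⋄-∙ (toℕ<n a) (toℕ<n b)))
        ; pair-∙ = λ x y → equal pair c⋄ _ _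
            (trans (cong₂ _⋄_ (toℕ-lift op c∙ x y) (toℕ-lift op c∙ y x)) (∙-⋄ (toℕ<n x) (toℕ<n y)))
        }

      starterSquare : {True laws?} → SelfOrthogonal n
      starterSquare {laws} = fromLaws (toWitness {a? = laws?} laws)

  square4 : SelfOrthogonal 4
  square4 = Starter.starterSquare 3 1 4
    (cyclic (0 ∷ 3 ∷ 1 ∷ []) (2 ∷ []) (1 ∷ []) 0 0)
    (cyclic (0 ∷ 2 ∷ 3 ∷ []) (1 ∷ []) (2 ∷ []) 0 0)
    (cyclic (0 ∷ 2 ∷ 3 ∷ []) (1 ∷ []) (2 ∷ []) 0 0)
    (cyclic (0 ∷ 3 ∷ 1 ∷ []) (2 ∷ []) (1 ∷ []) 0 0)

  square10 : SelfOrthogonal 10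
  square10 = Starter.starterSquare 9 1 10
    (cyclic (0 ∷ 3 ∷ 6 ∷ 1 ∷ 7 ∷ 2 ∷ 9 ∷ 8 ∷ 4 ∷ []) (5 ∷ []) (8 ∷ []) 0 0)
    (cyclic (0 ∷ 3 ∷ 5 ∷ 1 ∷ 8 ∷ 9 ∷ 2 ∷ 4 ∷ 7 ∷ []) (6 ∷ []) (1 ∷ []) 0 0)
    (cyclic (0 ∷ 9 ∷ 8 ∷ 7 ∷ 5 ∷ 3 ∷ 2 ∷ 6 ∷ 1 ∷ []) (4 ∷ []) (3 ∷ []) 0 0)
    (cyclic (0 ∷ 7 ∷ 6 ∷ 4 ∷ 3 ∷ 1 ∷ 9 ∷ 5 ∷ 2 ∷ []) (8 ∷ []) (2 ∷ []) 0 0)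

  square14 : SelfOrthogonal 14
  square14 = Starter.starterSquare 13 1 14
    (cyclic (0 ∷ 13 ∷ 6 ∷ 4 ∷ 2 ∷ 11 ∷ 3 ∷ 12 ∷ 10 ∷ 5 ∷ 9 ∷ 1 ∷ 7 ∷ []) (8 ∷ []) (7 ∷ []) 0 0)
    (cyclic (0 ∷ 11 ∷ 4 ∷ 6 ∷ 3 ∷ 9 ∷ 2 ∷ 12 ∷ 13 ∷ 10 ∷ 8 ∷ 5 ∷ 7 ∷ []) (1 ∷ []) (6 ∷ []) 0 0)
    (cyclic (0 ∷ 4 ∷ 11 ∷ 10 ∷ 8 ∷ 6 ∷ 13 ∷ 2 ∷ 1 ∷ 7 ∷ 12 ∷ 3 ∷ 9 ∷ []) (5 ∷ []) (12 ∷ []) 0 0)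
    (cyclic (0 ∷ 13 ∷ 10 ∷ 12 ∷ 2 ∷ 4 ∷ 8 ∷ 11 ∷ 9 ∷ 3 ∷ 7 ∷ 1 ∷ 5 ∷ []) (6 ∷ []) (5 ∷ []) 0 0)

  square15 : SelfOrthogonal 15
  -- Here `n` equals `g`: the square is purely cyclic, with no infinite point.
  square15 = Starter.starterSquare 15 1 15
    (cyclic (0 ∷ 14 ∷ 12 ∷ 9 ∷ 3 ∷ 8 ∷ 11 ∷ 1 ∷ 5 ∷ 10 ∷ 6 ∷ 13 ∷ 4 ∷ 2 ∷ 7 ∷ []) ([]) ([]) 0 0)
    (cyclic (0 ∷ 7 ∷ 13 ∷ 4 ∷ 12 ∷ 8 ∷ 10 ∷ 14 ∷ 5 ∷ 3 ∷ 9 ∷ 6 ∷ 2 ∷ 11 ∷ 1 ∷ []) ([]) ([]) 0 0)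
    (cyclic (0 ∷ 12 ∷ 1 ∷ 10 ∷ 9 ∷ 3 ∷ 14 ∷ 8 ∷ 11 ∷ 6 ∷ 4 ∷ 13 ∷ 7 ∷ 2 ∷ 5 ∷ []) ([]) ([]) 0 0)
    (cyclic (0 ∷ 2 ∷ 11 ∷ 7 ∷ 10 ∷ 4 ∷ 8 ∷ 3 ∷ 13 ∷ 1 ∷ 5 ∷ 14 ∷ 9 ∷ 6 ∷ 12 ∷ []) ([]) ([]) 0 0)

  square18 : SelfOrthogonal 18
  square18 = Starter.starterSquare 17 1 18
    (cyclic (0 ∷ 15 ∷ 7 ∷ 9 ∷ 14 ∷ 8 ∷ 17 ∷ 16 ∷ 2 ∷ 13 ∷ 6 ∷ 12 ∷ 11 ∷ 3 ∷ 5 ∷ 10 ∷ 1 ∷ []) (4 ∷ [])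
      (15 ∷ []) 0 0)
    (cyclic (0 ∷ 16 ∷ 8 ∷ 13 ∷ 17 ∷ 14 ∷ 10 ∷ 2 ∷ 5 ∷ 3 ∷ 15 ∷ 12 ∷ 11 ∷ 9 ∷ 4 ∷ 1 ∷ 7 ∷ []) (6 ∷ [])
      (2 ∷ []) 0 0)
    (cyclic (0 ∷ 6 ∷ 17 ∷ 2 ∷ 11 ∷ 7 ∷ 15 ∷ 3 ∷ 1 ∷ 12 ∷ 14 ∷ 8 ∷ 10 ∷ 4 ∷ 9 ∷ 16 ∷ 5 ∷ []) (13 ∷ [])
      (11 ∷ []) 0 0)
    (cyclic (0 ∷ 12 ∷ 15 ∷ 11 ∷ 2 ∷ 10 ∷ 17 ∷ 14 ∷ 9 ∷ 6 ∷ 3 ∷ 13 ∷ 7 ∷ 16 ∷ 1 ∷ 4 ∷ 8 ∷ []) (5 ∷ [])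
      (16 ∷ []) 0 0)

  -- For orders 34, 38, 42, 46 and 66 with `D = 4`, each order `m` in `bases₅` leaves `u` equal to 2
  -- or 6, where no square exists, or `u > m`; so these squares are given outright. Here
  -- `x ∙ (x + d)` is `x - d` if `d` is 0 or a square modulo 23 and infinite otherwise, and `right`
  -- lists the powers of 2. On the infinite points the operation is `2 i - j` modulo 11, so `rdiv`
  -- is `(z + y) / 2` and `pair` is `(2 s + t) / 3` there.
  square34 : SelfOrthogonal 34
  square34 = Starter.starterSquare 23 11 34
    (cyclic (0 ∷ 22 ∷ 21 ∷ 20 ∷ 19 ∷ 23 ∷ 17 ∷ 24 ∷ 15 ∷ 14 ∷ 25 ∷ 26 ∷ 11 ∷ 10 ∷ 27 ∷ 28 ∷ 7 ∷ 29 ∷ 5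
      ∷ 30 ∷ 31 ∷ 32 ∷ 33 ∷ []) (1 ∷ 2 ∷ 4 ∷ 8 ∷ 16 ∷ 9 ∷ 18 ∷ 13 ∷ 3 ∷ 6 ∷ 12 ∷ []) (16 ∷ 9 ∷ 18 ∷ 13 ∷
      3 ∷ 6 ∷ 12 ∷ 1 ∷ 2 ∷ 4 ∷ 8 ∷ []) 2 10)
    (cyclic (0 ∷ 23 ∷ 24 ∷ 31 ∷ 25 ∷ 18 ∷ 32 ∷ 16 ∷ 26 ∷ 28 ∷ 13 ∷ 12 ∷ 33 ∷ 30 ∷ 9 ∷ 8 ∷ 27 ∷ 6 ∷ 29 ∷
      4 ∷ 3 ∷ 2 ∷ 1 ∷ []) (5 ∷ 7 ∷ 10 ∷ 11 ∷ 14 ∷ 15 ∷ 17 ∷ 19 ∷ 20 ∷ 21 ∷ 22 ∷ []) (7 ∷ 14 ∷ 5 ∷ 10 ∷ 20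
      ∷ 17 ∷ 11 ∷ 22 ∷ 21 ∷ 19 ∷ 15 ∷ []) 2 10)
    (cyclic (0 ∷ 12 ∷ 1 ∷ 13 ∷ 2 ∷ 25 ∷ 3 ∷ 23 ∷ 4 ∷ 16 ∷ 26 ∷ 29 ∷ 6 ∷ 18 ∷ 24 ∷ 33 ∷ 8 ∷ 28 ∷ 9 ∷ 32
      ∷ 27 ∷ 31 ∷ 30 ∷ []) (22 ∷ 21 ∷ 19 ∷ 15 ∷ 7 ∷ 14 ∷ 5 ∷ 10 ∷ 20 ∷ 17 ∷ 11 ∷ []) (18 ∷ 16 ∷ 13 ∷ 12 ∷
      9 ∷ 8 ∷ 6 ∷ 4 ∷ 3 ∷ 2 ∷ 1 ∷ []) 6 6)
    (cyclic (0 ∷ 31 ∷ 32 ∷ 28 ∷ 33 ∷ 15 ∷ 29 ∷ 21 ∷ 23 ∷ 25 ∷ 7 ∷ 10 ∷ 30 ∷ 27 ∷ 19 ∷ 22 ∷ 24 ∷ 5 ∷ 26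
      ∷ 11 ∷ 14 ∷ 17 ∷ 20 ∷ []) (18 ∷ 16 ∷ 13 ∷ 12 ∷ 9 ∷ 8 ∷ 6 ∷ 4 ∷ 3 ∷ 2 ∷ 1 ∷ []) (13 ∷ 9 ∷ 3 ∷ 1 ∷ 18
      ∷ 16 ∷ 12 ∷ 8 ∷ 6 ∷ 4 ∷ 2 ∷ []) 8 4)

  square38 : SelfOrthogonal 38
  square38 = Starter.starterSquare 31 7 38
    (cyclic (0 ∷ 24 ∷ 22 ∷ 31 ∷ 32 ∷ 13 ∷ 28 ∷ 10 ∷ 33 ∷ 21 ∷ 9 ∷ 17 ∷ 30 ∷ 3 ∷ 34 ∷ 26 ∷ 29 ∷ 15 ∷ 14
      ∷ 12 ∷ 4 ∷ 7 ∷ 35 ∷ 18 ∷ 36 ∷ 37 ∷ 27 ∷ 1 ∷ 11 ∷ 23 ∷ 8 ∷ []) (25 ∷ 20 ∷ 2 ∷ 5 ∷ 16 ∷ 19 ∷ 6 ∷ [])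
      (4 ∷ 19 ∷ 28 ∷ 16 ∷ 7 ∷ 2 ∷ 10 ∷ []) 2 6)
    (cyclic (0 ∷ 27 ∷ 33 ∷ 13 ∷ 20 ∷ 34 ∷ 37 ∷ 21 ∷ 30 ∷ 10 ∷ 7 ∷ 28 ∷ 19 ∷ 5 ∷ 18 ∷ 17 ∷ 35 ∷ 11 ∷ 23
      ∷ 36 ∷ 32 ∷ 9 ∷ 2 ∷ 29 ∷ 1 ∷ 31 ∷ 15 ∷ 26 ∷ 6 ∷ 16 ∷ 12 ∷ []) (3 ∷ 4 ∷ 8 ∷ 14 ∷ 22 ∷ 24 ∷ 25 ∷ [])
      (27 ∷ 12 ∷ 3 ∷ 15 ∷ 24 ∷ 29 ∷ 21 ∷ []) 2 6)
    (cyclic (0 ∷ 22 ∷ 16 ∷ 33 ∷ 17 ∷ 13 ∷ 8 ∷ 19 ∷ 7 ∷ 3 ∷ 28 ∷ 9 ∷ 32 ∷ 1 ∷ 24 ∷ 34 ∷ 27 ∷ 20 ∷ 2 ∷ 10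
      ∷ 5 ∷ 37 ∷ 23 ∷ 18 ∷ 35 ∷ 14 ∷ 30 ∷ 31 ∷ 21 ∷ 36 ∷ 4 ∷ []) (6 ∷ 11 ∷ 29 ∷ 26 ∷ 15 ∷ 12 ∷ 25 ∷ [])
      (28 ∷ 27 ∷ 23 ∷ 17 ∷ 9 ∷ 7 ∷ 6 ∷ []) 4 4)
    (cyclic (0 ∷ 32 ∷ 27 ∷ 9 ∷ 25 ∷ 33 ∷ 19 ∷ 17 ∷ 22 ∷ 35 ∷ 6 ∷ 26 ∷ 4 ∷ 2 ∷ 12 ∷ 23 ∷ 7 ∷ 36 ∷ 5 ∷ 18
      ∷ 34 ∷ 31 ∷ 15 ∷ 24 ∷ 28 ∷ 1 ∷ 29 ∷ 37 ∷ 8 ∷ 14 ∷ 11 ∷ []) (20 ∷ 30 ∷ 13 ∷ 16 ∷ 10 ∷ 21 ∷ 3 ∷ [])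
      (17 ∷ 26 ∷ 5 ∷ 2 ∷ 19 ∷ 28 ∷ 9 ∷ []) 3 5)

  square42 : SelfOrthogonal 42
  square42 = Starter.starterSquare 37 5 42
    (cyclic (0 ∷ 22 ∷ 6 ∷ 30 ∷ 7 ∷ 37 ∷ 18 ∷ 23 ∷ 38 ∷ 15 ∷ 20 ∷ 35 ∷ 39 ∷ 32 ∷ 2 ∷ 40 ∷ 1 ∷ 31 ∷ 25 ∷
      13 ∷ 16 ∷ 29 ∷ 5 ∷ 21 ∷ 33 ∷ 17 ∷ 19 ∷ 26 ∷ 14 ∷ 10 ∷ 27 ∷ 9 ∷ 34 ∷ 28 ∷ 41 ∷ 3 ∷ 12 ∷ []) (11 ∷ 4
      ∷ 8 ∷ 36 ∷ 24 ∷ []) (1 ∷ 26 ∷ 28 ∷ 17 ∷ 11 ∷ []) 2 4)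
    (cyclic (0 ∷ 16 ∷ 14 ∷ 35 ∷ 38 ∷ 22 ∷ 2 ∷ 4 ∷ 39 ∷ 31 ∷ 29 ∷ 37 ∷ 36 ∷ 19 ∷ 28 ∷ 9 ∷ 20 ∷ 25 ∷ 6 ∷
      26 ∷ 10 ∷ 23 ∷ 1 ∷ 7 ∷ 41 ∷ 18 ∷ 27 ∷ 30 ∷ 33 ∷ 21 ∷ 3 ∷ 17 ∷ 13 ∷ 24 ∷ 32 ∷ 11 ∷ 40 ∷ []) (5 ∷ 8 ∷
      12 ∷ 15 ∷ 34 ∷ []) (36 ∷ 11 ∷ 9 ∷ 20 ∷ 26 ∷ []) 2 4)
    (cyclic (0 ∷ 11 ∷ 16 ∷ 10 ∷ 21 ∷ 9 ∷ 24 ∷ 18 ∷ 20 ∷ 39 ∷ 7 ∷ 38 ∷ 35 ∷ 2 ∷ 23 ∷ 36 ∷ 15 ∷ 32 ∷ 5 ∷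
      27 ∷ 40 ∷ 14 ∷ 28 ∷ 6 ∷ 25 ∷ 19 ∷ 41 ∷ 17 ∷ 4 ∷ 8 ∷ 12 ∷ 22 ∷ 34 ∷ 31 ∷ 30 ∷ 3 ∷ 37 ∷ []) (26 ∷ 33
      ∷ 29 ∷ 1 ∷ 13 ∷ []) (32 ∷ 29 ∷ 25 ∷ 22 ∷ 3 ∷ []) 3 3)
    (cyclic (0 ∷ 34 ∷ 6 ∷ 28 ∷ 16 ∷ 18 ∷ 12 ∷ 36 ∷ 22 ∷ 25 ∷ 37 ∷ 14 ∷ 9 ∷ 41 ∷ 5 ∷ 38 ∷ 17 ∷ 39 ∷ 1 ∷
      40 ∷ 29 ∷ 11 ∷ 33 ∷ 4 ∷ 13 ∷ 30 ∷ 10 ∷ 26 ∷ 15 ∷ 23 ∷ 8 ∷ 24 ∷ 2 ∷ 35 ∷ 19 ∷ 21 ∷ 31 ∷ []) (3 ∷ 27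
      ∷ 20 ∷ 32 ∷ 7 ∷ []) (35 ∷ 19 ∷ 8 ∷ 17 ∷ 10 ∷ []) 4 2)

  square46 : SelfOrthogonal 46
  square46 = Starter.starterSquare 41 5 46
    (cyclic (0 ∷ 33 ∷ 31 ∷ 18 ∷ 41 ∷ 9 ∷ 11 ∷ 1 ∷ 39 ∷ 8 ∷ 2 ∷ 30 ∷ 29 ∷ 37 ∷ 12 ∷ 27 ∷ 36 ∷ 38 ∷ 20 ∷
      28 ∷ 23 ∷ 5 ∷ 15 ∷ 42 ∷ 35 ∷ 43 ∷ 34 ∷ 24 ∷ 13 ∷ 10 ∷ 16 ∷ 44 ∷ 4 ∷ 40 ∷ 7 ∷ 22 ∷ 25 ∷ 32 ∷ 3 ∷ 21
      ∷ 45 ∷ []) (6 ∷ 19 ∷ 26 ∷ 14 ∷ 17 ∷ []) (37 ∷ 1 ∷ 10 ∷ 18 ∷ 16 ∷ []) 2 4)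
    (cyclic (0 ∷ 7 ∷ 10 ∷ 38 ∷ 32 ∷ 21 ∷ 41 ∷ 34 ∷ 9 ∷ 5 ∷ 29 ∷ 6 ∷ 14 ∷ 28 ∷ 44 ∷ 22 ∷ 30 ∷ 45 ∷ 3 ∷
      42 ∷ 18 ∷ 39 ∷ 35 ∷ 20 ∷ 27 ∷ 36 ∷ 43 ∷ 15 ∷ 19 ∷ 12 ∷ 11 ∷ 2 ∷ 37 ∷ 1 ∷ 26 ∷ 24 ∷ 16 ∷ 13 ∷ 17 ∷ 8
      ∷ 33 ∷ []) (4 ∷ 23 ∷ 25 ∷ 31 ∷ 40 ∷ []) (4 ∷ 40 ∷ 31 ∷ 23 ∷ 25 ∷ []) 2 4)
    (cyclic (0 ∷ 33 ∷ 29 ∷ 17 ∷ 41 ∷ 9 ∷ 40 ∷ 26 ∷ 39 ∷ 8 ∷ 2 ∷ 16 ∷ 10 ∷ 19 ∷ 25 ∷ 28 ∷ 36 ∷ 4 ∷ 20 ∷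
      31 ∷ 3 ∷ 5 ∷ 11 ∷ 44 ∷ 12 ∷ 45 ∷ 23 ∷ 34 ∷ 37 ∷ 14 ∷ 6 ∷ 43 ∷ 13 ∷ 7 ∷ 1 ∷ 38 ∷ 30 ∷ 32 ∷ 18 ∷ 21 ∷
      42 ∷ []) (35 ∷ 22 ∷ 15 ∷ 27 ∷ 24 ∷ []) (37 ∷ 18 ∷ 16 ∷ 10 ∷ 1 ∷ []) 3 3)
    (cyclic (0 ∷ 45 ∷ 18 ∷ 25 ∷ 27 ∷ 33 ∷ 13 ∷ 31 ∷ 20 ∷ 2 ∷ 41 ∷ 28 ∷ 38 ∷ 40 ∷ 3 ∷ 17 ∷ 43 ∷ 30 ∷ 42
      ∷ 7 ∷ 16 ∷ 32 ∷ 14 ∷ 22 ∷ 19 ∷ 15 ∷ 29 ∷ 6 ∷ 34 ∷ 23 ∷ 4 ∷ 35 ∷ 1 ∷ 10 ∷ 12 ∷ 26 ∷ 37 ∷ 44 ∷ 11 ∷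
      36 ∷ 24 ∷ []) (9 ∷ 21 ∷ 5 ∷ 39 ∷ 8 ∷ []) (5 ∷ 39 ∷ 21 ∷ 8 ∷ 9 ∷ []) 4 2)

  square66 : SelfOrthogonal 66
  square66 = Starter.starterSquare 53 13 66
    (cyclic (0 ∷ 5 ∷ 32 ∷ 48 ∷ 40 ∷ 53 ∷ 7 ∷ 17 ∷ 54 ∷ 37 ∷ 50 ∷ 4 ∷ 55 ∷ 12 ∷ 56 ∷ 22 ∷ 27 ∷ 11 ∷ 57 ∷
      39 ∷ 2 ∷ 58 ∷ 59 ∷ 60 ∷ 14 ∷ 38 ∷ 45 ∷ 61 ∷ 34 ∷ 25 ∷ 3 ∷ 19 ∷ 35 ∷ 62 ∷ 63 ∷ 30 ∷ 21 ∷ 52 ∷ 9 ∷ 41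
      ∷ 29 ∷ 20 ∷ 51 ∷ 6 ∷ 8 ∷ 31 ∷ 18 ∷ 23 ∷ 26 ∷ 33 ∷ 64 ∷ 65 ∷ 43 ∷ []) (1 ∷ 10 ∷ 47 ∷ 46 ∷ 36 ∷ 42 ∷
      49 ∷ 13 ∷ 24 ∷ 28 ∷ 15 ∷ 44 ∷ 16 ∷ []) (8 ∷ 27 ∷ 5 ∷ 50 ∷ 23 ∷ 18 ∷ 21 ∷ 51 ∷ 33 ∷ 12 ∷ 14 ∷ 34 ∷
      22 ∷ []) 2 12)
    (cyclic (0 ∷ 53 ∷ 20 ∷ 30 ∷ 11 ∷ 1 ∷ 43 ∷ 6 ∷ 44 ∷ 38 ∷ 54 ∷ 17 ∷ 13 ∷ 60 ∷ 24 ∷ 63 ∷ 65 ∷ 7 ∷ 46 ∷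
      31 ∷ 41 ∷ 36 ∷ 15 ∷ 47 ∷ 61 ∷ 29 ∷ 48 ∷ 16 ∷ 62 ∷ 40 ∷ 35 ∷ 45 ∷ 2 ∷ 49 ∷ 28 ∷ 32 ∷ 57 ∷ 9 ∷ 25 ∷
      19 ∷ 4 ∷ 39 ∷ 58 ∷ 52 ∷ 64 ∷ 26 ∷ 56 ∷ 55 ∷ 3 ∷ 59 ∷ 10 ∷ 42 ∷ 37 ∷ []) (5 ∷ 8 ∷ 12 ∷ 14 ∷ 18 ∷ 21
      ∷ 22 ∷ 23 ∷ 27 ∷ 33 ∷ 34 ∷ 50 ∷ 51 ∷ []) (45 ∷ 26 ∷ 48 ∷ 3 ∷ 30 ∷ 35 ∷ 32 ∷ 2 ∷ 20 ∷ 41 ∷ 39 ∷ 19 ∷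
      31 ∷ []) 2 12)
    (cyclic (0 ∷ 41 ∷ 60 ∷ 56 ∷ 28 ∷ 23 ∷ 42 ∷ 49 ∷ 5 ∷ 10 ∷ 39 ∷ 24 ∷ 34 ∷ 3 ∷ 22 ∷ 32 ∷ 20 ∷ 13 ∷ 51
      ∷ 64 ∷ 61 ∷ 33 ∷ 27 ∷ 21 ∷ 30 ∷ 16 ∷ 54 ∷ 50 ∷ 35 ∷ 44 ∷ 57 ∷ 65 ∷ 59 ∷ 14 ∷ 8 ∷ 58 ∷ 45 ∷ 47 ∷ 1 ∷
      63 ∷ 15 ∷ 62 ∷ 26 ∷ 36 ∷ 2 ∷ 53 ∷ 31 ∷ 19 ∷ 55 ∷ 48 ∷ 18 ∷ 12 ∷ 46 ∷ []) (52 ∷ 43 ∷ 6 ∷ 7 ∷ 17 ∷ 11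
      ∷ 4 ∷ 40 ∷ 29 ∷ 25 ∷ 38 ∷ 9 ∷ 37 ∷ []) (48 ∷ 45 ∷ 41 ∷ 39 ∷ 35 ∷ 32 ∷ 31 ∷ 30 ∷ 26 ∷ 20 ∷ 19 ∷ 3 ∷
      2 ∷ []) 7 7)
    (cyclic (0 ∷ 63 ∷ 31 ∷ 20 ∷ 7 ∷ 49 ∷ 37 ∷ 52 ∷ 36 ∷ 29 ∷ 64 ∷ 6 ∷ 1 ∷ 57 ∷ 10 ∷ 60 ∷ 62 ∷ 43 ∷ 28 ∷
      3 ∷ 45 ∷ 15 ∷ 46 ∷ 24 ∷ 58 ∷ 4 ∷ 32 ∷ 42 ∷ 59 ∷ 11 ∷ 41 ∷ 30 ∷ 19 ∷ 16 ∷ 47 ∷ 39 ∷ 54 ∷ 25 ∷ 40 ∷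
      48 ∷ 17 ∷ 26 ∷ 55 ∷ 9 ∷ 61 ∷ 35 ∷ 53 ∷ 65 ∷ 2 ∷ 56 ∷ 13 ∷ 44 ∷ 38 ∷ []) (27 ∷ 22 ∷ 33 ∷ 12 ∷ 23 ∷
      18 ∷ 34 ∷ 50 ∷ 8 ∷ 51 ∷ 14 ∷ 5 ∷ 21 ∷ []) (22 ∷ 14 ∷ 21 ∷ 51 ∷ 5 ∷ 50 ∷ 12 ∷ 27 ∷ 34 ∷ 18 ∷ 33 ∷ 8
      ∷ 23 ∷ []) 5 9)

-- Small tournaments listed game by game and checked by evaluation.

module ExplicitTournaments where

  open import Data.Bool using (Bool; true; if_then_else_; _∧_)
  import Data.Bool.Properties as Bool
  open import Data.Fin using (Fin; toℕ)
  open import Data.Fin.Properties using (_≟_; all?; any?)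
  open import Data.List using (List; []; _∷_; _++_; concatMap; map; upTo)
  open import Data.Nat using (ℕ; suc; _+_; _*_; _∸_; _<ᵇ_; _≤ᵇ_; _/_; _%_; NonZero)
  import Data.Nat.Properties as ℕ
  open import Data.Product using (_×_; _,_)
  open import Relation.Binary.PropositionalEquality using (_≡_)
  open import Relation.Nullary using (Dec; no; ¬?)
  open import Relation.Nullary.Decidable using (True; toWitness; _×-dec_; _→-dec_; map′)
  open Composition
  open ResidueRings

  init : ∀ {n} → ℕ → Fin n → Bool
  init k x = toℕ x <ᵇ k

  infix 4 _∣_v_∣_
  -- In `a ∣ b v c ∣ d` man `a` partners woman `b` and man `c` partners woman `d`.
  data Match : Set where
    _∣_v_∣_ : ℕ → ℕ → ℕ → ℕ → Match

  module _ {n : ℕ} (S : Fin n → Bool) (M : Fin n → Fin n → ℕ) where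

    mixed? : Dec (MixedMeetings S M)
    mixed? = map′ (λ (a , b) → record { spouses = a ; others = b }) (λ h → MixedMeetings.spouses h , MixedMeetings.others h)
      (all? (λ x → (S x Bool.≟ true) →-dec (M x x ℕ.≟ 0))
       ×-dec all? (λ x → all? λ y → ¬? ((x ≟ y) ×-dec (S x Bool.≟ true)) →-dec (M x y ℕ.≟ 1)))

    same? : Dec (SameSexOpposition (λ x → S x ≡ true) M)
    same? = map′ (λ (a , b) → record { with-spouse = a ; without-spouse = b })
      (λ h → SameSexOpposition.with-spouse h , SameSexOpposition.without-spouse h)
      (all? (λ p → (S p Bool.≟ true) →-dec all? λ q → ¬? (q ≟ p) →-dec (M p q ℕ.≟ 1))
       ×-dec all? (λ p → ¬? (S p Bool.≟ true) →-dec any? λ r →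
         ¬? (r ≟ p) ×-dec ¬? (S r Bool.≟ true) ×-dec (M p r ℕ.≟ 2) ×-dec
         all? (λ q → ¬? (q ≟ p) →-dec ¬? (q ≟ r) →-dec (M p q ℕ.≟ 1))))

  module Raw (r : ℕ) where

    private
      n : ℕ
      n = suc r
    open Mod r using (⟦_⟧)

    toGames : Match → List (Game n)
    toGames (a ∣ b v c ∣ d) with ⟦ a ⟧ ≟ ⟦ c ⟧ | ⟦ b ⟧ ≟ ⟦ d ⟧
    ... | no a≢c | no b≢d = game (M ⟦ a ⟧ F ⟦ b ⟧) (M ⟦ c ⟧ F ⟦ d ⟧) a≢c b≢d ∷ []
    -- A match repeating a player yields no game; validity is decided for the games that result.
    ... | _      | _      = []

    Valid : ℕ → List (Game n) → Set
    Valid k gs = MixedMeetings (init k) (meetings partnersᴹ gs) × MixedMeetings (init k) (meetings opponentsᴹ gs)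
               × SameSexOpposition (λ x → init k x ≡ true) (meetings menᴹ gs)
               × SameSexOpposition (λ x → init k x ≡ true) (meetings womenᴹ gs)

    valid? : ∀ k gs → Dec (Valid k gs)
    valid? k gs = mixed? _ _ ×-dec mixed? _ _ ×-dec same? _ _ ×-dec same? _ _

    tournament : ∀ k ms → {True (valid? k (concatMap toGames ms))} → Tournament n (init k)
    tournament k ms {ok} = let a , b , c , d = toWitness {a? = valid? k (concatMap toGames ms)} ok in
      record { games = concatMap toGames ms ; partners = a ; opponents = b ; men = c ; women = d }

  -- Rotates each block of t consecutive numbers between lo and hi by s and fixes the other numbers.
  rotate : (lo hi t : ℕ) .{{_ : NonZero t}} → ℕ → ℕ → ℕ
  rotate lo hi t s x = if (lo ≤ᵇ x) ∧ (x <ᵇ hi) then lo + ((x ∸ lo) / t * t + ((x ∸ lo) % t + s) % t) else x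

  -- A tournament with an automorphism of order `t` needs one listed game per full orbit; fixed
  -- games and short orbits are listed separately.
  develop : (lo hi t : ℕ) .{{_ : NonZero t}} → List Match → List Match
  develop lo hi t ms = concatMap (λ s → map (λ { (a ∣ b v c ∣ d) → ρ s a ∣ ρ s b v ρ s c ∣ ρ s d }) ms) (upTo t)
    where ρ = rotate lo hi t

  tournament-2-0 : Tournament 2 (init 0)
  tournament-2-0 = Raw.tournament 1 0 (
      ((0 ∣ 1 v 1 ∣ 0) ∷ (0 ∣ 0 v 1 ∣ 1) ∷ []))

  tournament-4-0 : Tournament 4 (init 0)
  tournament-4-0 = Raw.tournament 3 0 (
      ((2 ∣ 0 v 3 ∣ 3) ∷ (0 ∣ 1 v 3 ∣ 0) ∷ (1 ∣ 0 v 2 ∣ 1) ∷ (0 ∣ 0 v 1 ∣ 2) ∷ (1 ∣ 3 v 3 ∣ 2) ∷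
      (0 ∣ 2 v 2 ∣ 3) ∷ (0 ∣ 3 v 1 ∣ 1) ∷ (2 ∣ 2 v 3 ∣ 1) ∷ []))

  tournament-5-1 : Tournament 5 (init 1)
  tournament-5-1 = Raw.tournament 4 1 (
      ((1 ∣ 0 v 4 ∣ 1) ∷ (1 ∣ 3 v 3 ∣ 0) ∷ (2 ∣ 2 v 4 ∣ 0) ∷ (2 ∣ 0 v 3 ∣ 4) ∷ (0 ∣ 4 v 4 ∣ 3) ∷
      (0 ∣ 1 v 3 ∣ 2) ∷ (1 ∣ 2 v 2 ∣ 3) ∷ (0 ∣ 2 v 1 ∣ 4) ∷ (0 ∣ 3 v 2 ∣ 1) ∷ (3 ∣ 1 v 4 ∣ 2) ∷
      (1 ∣ 1 v 2 ∣ 4) ∷ (3 ∣ 3 v 4 ∣ 4) ∷ []))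

  tournament-6-0 : Tournament 6 (init 0)
  tournament-6-0 = Raw.tournament 5 0 (
      develop 0 6 3
      ((3 ∣ 1 v 5 ∣ 5) ∷ (0 ∣ 5 v 4 ∣ 3) ∷ (0 ∣ 1 v 3 ∣ 4) ∷ (0 ∣ 2 v 5 ∣ 1) ∷ (0 ∣ 0 v 1 ∣ 5) ∷
      (0 ∣ 3 v 3 ∣ 0) ∷ []))

  tournament-6-4 : Tournament 6 (init 4)
  tournament-6-4 = Raw.tournament 5 4 (
      ((0 ∣ 4 v 3 ∣ 5) ∷ (2 ∣ 1 v 3 ∣ 0) ∷ (3 ∣ 1 v 4 ∣ 5) ∷ (3 ∣ 2 v 5 ∣ 0) ∷ (1 ∣ 2 v 3 ∣ 4) ∷
      (0 ∣ 3 v 5 ∣ 1) ∷ (4 ∣ 1 v 5 ∣ 2) ∷ (0 ∣ 5 v 4 ∣ 2) ∷ (0 ∣ 1 v 2 ∣ 4) ∷ (0 ∣ 2 v 1 ∣ 3) ∷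
      (4 ∣ 0 v 5 ∣ 4) ∷ (1 ∣ 0 v 4 ∣ 3) ∷ (2 ∣ 3 v 4 ∣ 4) ∷ (1 ∣ 5 v 2 ∣ 0) ∷ (2 ∣ 5 v 5 ∣ 3) ∷
      (1 ∣ 4 v 5 ∣ 5) ∷ []))

  tournament-7-1 : Tournament 7 (init 1)
  tournament-7-1 = Raw.tournament 6 1 (
      develop 1 7 3
      ((0 ∣ 4 v 5 ∣ 3) ∷ (0 ∣ 1 v 3 ∣ 4) ∷ (1 ∣ 4 v 6 ∣ 6) ∷ (4 ∣ 1 v 5 ∣ 4) ∷ (1 ∣ 0 v 4 ∣ 5) ∷
      (1 ∣ 2 v 2 ∣ 4) ∷ (1 ∣ 3 v 5 ∣ 0) ∷ (1 ∣ 1 v 4 ∣ 3) ∷ []))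

  tournament-7-3 : Tournament 7 (init 3)
  tournament-7-3 = Raw.tournament 6 3 (
      ((0 ∣ 3 v 2 ∣ 1) ∷ (0 ∣ 4 v 1 ∣ 2) ∷ (0 ∣ 5 v 3 ∣ 3) ∷ (0 ∣ 2 v 6 ∣ 6) ∷ (0 ∣ 1 v 5 ∣ 5) ∷
      (0 ∣ 6 v 4 ∣ 4) ∷ (3 ∣ 1 v 4 ∣ 2) ∷ (3 ∣ 6 v 6 ∣ 1) ∷ (4 ∣ 5 v 5 ∣ 2) ∷ (1 ∣ 5 v 6 ∣ 0) ∷
      (2 ∣ 4 v 6 ∣ 5) ∷ (3 ∣ 0 v 5 ∣ 4) ∷ (2 ∣ 0 v 4 ∣ 1) ∷ (5 ∣ 1 v 6 ∣ 4) ∷ (5 ∣ 3 v 6 ∣ 2) ∷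
      (2 ∣ 6 v 5 ∣ 0) ∷ (4 ∣ 0 v 6 ∣ 3) ∷ (1 ∣ 3 v 5 ∣ 6) ∷ (1 ∣ 6 v 2 ∣ 5) ∷ (3 ∣ 5 v 4 ∣ 6) ∷
      (2 ∣ 3 v 3 ∣ 4) ∷ (1 ∣ 4 v 4 ∣ 3) ∷ (1 ∣ 0 v 3 ∣ 2) ∷ []))

  tournament-7-5 : Tournament 7 (init 5)
  tournament-7-5 = Raw.tournament 6 5 (
      ((5 ∣ 6 v 6 ∣ 5) ∷ (5 ∣ 5 v 6 ∣ 6) ∷ []) ++
      develop 0 5 5
      ((0 ∣ 4 v 1 ∣ 6) ∷ (0 ∣ 2 v 3 ∣ 5) ∷ (0 ∣ 3 v 5 ∣ 1) ∷ (0 ∣ 1 v 6 ∣ 2) ∷ []))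

  tournament-8-0 : Tournament 8 (init 0)
  tournament-8-0 = Raw.tournament 7 0 (
      ((6 ∣ 7 v 7 ∣ 6) ∷ (6 ∣ 6 v 7 ∣ 7) ∷ []) ++
      develop 0 6 3
      ((0 ∣ 2 v 3 ∣ 6) ∷ (0 ∣ 6 v 3 ∣ 5) ∷ (3 ∣ 2 v 4 ∣ 7) ∷ (0 ∣ 4 v 1 ∣ 7) ∷ (0 ∣ 3 v 5 ∣ 0) ∷
      (0 ∣ 1 v 4 ∣ 4) ∷ (3 ∣ 4 v 7 ∣ 3) ∷ (3 ∣ 0 v 6 ∣ 5) ∷ (0 ∣ 5 v 6 ∣ 1) ∷ (0 ∣ 0 v 7 ∣ 2) ∷ []))

  tournament-8-2 : Tournament 8 (init 2)
  tournament-8-2 = Raw.tournament 7 2 (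
      ((4 ∣ 1 v 5 ∣ 0) ∷ (2 ∣ 4 v 7 ∣ 0) ∷ (2 ∣ 0 v 3 ∣ 6) ∷ (5 ∣ 3 v 6 ∣ 0) ∷ (1 ∣ 0 v 7 ∣ 7) ∷
      (1 ∣ 5 v 3 ∣ 0) ∷ (4 ∣ 0 v 6 ∣ 2) ∷ (0 ∣ 4 v 1 ∣ 6) ∷ (1 ∣ 2 v 5 ∣ 5) ∷ (1 ∣ 7 v 6 ∣ 6) ∷
      (1 ∣ 3 v 2 ∣ 2) ∷ (1 ∣ 4 v 4 ∣ 3) ∷ (6 ∣ 7 v 7 ∣ 4) ∷ (3 ∣ 4 v 5 ∣ 2) ∷ (2 ∣ 5 v 5 ∣ 4) ∷
      (4 ∣ 7 v 5 ∣ 6) ∷ (0 ∣ 3 v 5 ∣ 7) ∷ (2 ∣ 1 v 3 ∣ 7) ∷ (5 ∣ 1 v 7 ∣ 6) ∷ (2 ∣ 6 v 6 ∣ 5) ∷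
      (6 ∣ 3 v 7 ∣ 5) ∷ (3 ∣ 2 v 7 ∣ 3) ∷ (4 ∣ 5 v 7 ∣ 1) ∷ (0 ∣ 2 v 6 ∣ 1) ∷ (0 ∣ 7 v 3 ∣ 5) ∷
      (2 ∣ 7 v 4 ∣ 2) ∷ (0 ∣ 1 v 2 ∣ 3) ∷ (3 ∣ 1 v 6 ∣ 4) ∷ (3 ∣ 3 v 4 ∣ 6) ∷ (0 ∣ 6 v 7 ∣ 2) ∷
      (0 ∣ 5 v 4 ∣ 4) ∷ []))

  tournament-8-4 : Tournament 8 (init 4)
  tournament-8-4 = Raw.tournament 7 4 (
      ((1 ∣ 4 v 3 ∣ 7) ∷ (0 ∣ 5 v 3 ∣ 2) ∷ (0 ∣ 3 v 1 ∣ 6) ∷ (1 ∣ 3 v 2 ∣ 4) ∷ (1 ∣ 7 v 5 ∣ 2) ∷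
      (1 ∣ 0 v 7 ∣ 5) ∷ (1 ∣ 5 v 4 ∣ 6) ∷ (1 ∣ 2 v 6 ∣ 0) ∷ (3 ∣ 5 v 7 ∣ 7) ∷ (3 ∣ 1 v 6 ∣ 2) ∷
      (5 ∣ 6 v 7 ∣ 2) ∷ (4 ∣ 2 v 7 ∣ 3) ∷ (0 ∣ 2 v 4 ∣ 4) ∷ (0 ∣ 7 v 7 ∣ 1) ∷ (0 ∣ 4 v 6 ∣ 5) ∷
      (2 ∣ 1 v 7 ∣ 4) ∷ (2 ∣ 6 v 3 ∣ 0) ∷ (6 ∣ 4 v 7 ∣ 6) ∷ (6 ∣ 3 v 7 ∣ 0) ∷ (2 ∣ 3 v 5 ∣ 5) ∷
      (4 ∣ 5 v 5 ∣ 4) ∷ (2 ∣ 5 v 6 ∣ 1) ∷ (2 ∣ 0 v 4 ∣ 7) ∷ (0 ∣ 6 v 2 ∣ 7) ∷ (4 ∣ 0 v 5 ∣ 1) ∷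
      (5 ∣ 7 v 6 ∣ 6) ∷ (4 ∣ 3 v 6 ∣ 7) ∷ (3 ∣ 4 v 5 ∣ 0) ∷ (0 ∣ 1 v 5 ∣ 3) ∷ (3 ∣ 6 v 4 ∣ 1) ∷ []))

  tournament-8-6 : Tournament 8 (init 6)
  tournament-8-6 = Raw.tournament 7 6 (
      ((1 ∣ 0 v 7 ∣ 5) ∷ (0 ∣ 5 v 6 ∣ 3) ∷ (3 ∣ 2 v 4 ∣ 5) ∷ (4 ∣ 1 v 6 ∣ 5) ∷ (1 ∣ 5 v 2 ∣ 6) ∷
      (2 ∣ 5 v 7 ∣ 7) ∷ (0 ∣ 4 v 3 ∣ 5) ∷ (0 ∣ 1 v 2 ∣ 4) ∷ (2 ∣ 0 v 4 ∣ 3) ∷ (2 ∣ 3 v 5 ∣ 6) ∷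
      (2 ∣ 1 v 3 ∣ 0) ∷ (2 ∣ 7 v 6 ∣ 4) ∷ (1 ∣ 4 v 5 ∣ 3) ∷ (0 ∣ 3 v 7 ∣ 1) ∷ (1 ∣ 2 v 3 ∣ 4) ∷
      (6 ∣ 6 v 7 ∣ 4) ∷ (5 ∣ 4 v 7 ∣ 0) ∷ (5 ∣ 0 v 6 ∣ 2) ∷ (3 ∣ 1 v 5 ∣ 7) ∷ (3 ∣ 6 v 6 ∣ 0) ∷
      (4 ∣ 6 v 5 ∣ 1) ∷ (6 ∣ 1 v 7 ∣ 2) ∷ (3 ∣ 7 v 7 ∣ 6) ∷ (0 ∣ 7 v 5 ∣ 2) ∷ (0 ∣ 2 v 1 ∣ 6) ∷
      (0 ∣ 6 v 4 ∣ 7) ∷ (1 ∣ 7 v 4 ∣ 0) ∷ (4 ∣ 2 v 7 ∣ 3) ∷ (1 ∣ 3 v 6 ∣ 7) ∷ []))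

  tournament-9-1 : Tournament 9 (init 1)
  tournament-9-1 = Raw.tournament 8 1 (
      ((5 ∣ 6 v 7 ∣ 8) ∷ (6 ∣ 7 v 8 ∣ 5) ∷ (1 ∣ 3 v 3 ∣ 1) ∷ (2 ∣ 4 v 4 ∣ 2) ∷ []) ++
      develop 1 9 4
      ((5 ∣ 4 v 8 ∣ 6) ∷ (0 ∣ 1 v 7 ∣ 4) ∷ (1 ∣ 0 v 8 ∣ 2) ∷ (1 ∣ 7 v 7 ∣ 3) ∷ (1 ∣ 2 v 5 ∣ 5) ∷
      (1 ∣ 1 v 2 ∣ 6) ∷ (1 ∣ 8 v 6 ∣ 0) ∷ (0 ∣ 5 v 3 ∣ 8) ∷ (1 ∣ 4 v 5 ∣ 8) ∷ []))

  tournament-9-3 : Tournament 9 (init 3)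
  tournament-9-3 = Raw.tournament 8 3 (
      develop 0 9 3
      ((0 ∣ 3 v 2 ∣ 7) ∷ (0 ∣ 5 v 4 ∣ 1) ∷ (0 ∣ 1 v 3 ∣ 3) ∷ (0 ∣ 6 v 5 ∣ 8) ∷ (0 ∣ 7 v 6 ∣ 2) ∷
      (0 ∣ 4 v 8 ∣ 6) ∷ (0 ∣ 2 v 7 ∣ 5) ∷ (3 ∣ 2 v 5 ∣ 6) ∷ (3 ∣ 5 v 8 ∣ 8) ∷ (3 ∣ 4 v 6 ∣ 3) ∷
      (3 ∣ 1 v 7 ∣ 2) ∷ (3 ∣ 8 v 6 ∣ 5) ∷ (6 ∣ 0 v 7 ∣ 6) ∷ []))

  tournament-9-5 : Tournament 9 (init 5)
  tournament-9-5 = Raw.tournament 8 5 (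
      ((0 ∣ 5 v 3 ∣ 1) ∷ (2 ∣ 0 v 3 ∣ 8) ∷ (3 ∣ 6 v 4 ∣ 8) ∷ (3 ∣ 2 v 5 ∣ 1) ∷ (3 ∣ 0 v 6 ∣ 4) ∷
      (3 ∣ 5 v 8 ∣ 7) ∷ (3 ∣ 7 v 7 ∣ 6) ∷ (1 ∣ 2 v 3 ∣ 4) ∷ (4 ∣ 1 v 6 ∣ 0) ∷ (1 ∣ 0 v 5 ∣ 2) ∷
      (5 ∣ 0 v 8 ∣ 6) ∷ (1 ∣ 3 v 7 ∣ 0) ∷ (4 ∣ 0 v 7 ∣ 5) ∷ (2 ∣ 7 v 8 ∣ 0) ∷ (1 ∣ 7 v 4 ∣ 3) ∷
      (4 ∣ 5 v 5 ∣ 8) ∷ (0 ∣ 3 v 4 ∣ 2) ∷ (4 ∣ 6 v 8 ∣ 2) ∷ (2 ∣ 1 v 4 ∣ 7) ∷ (1 ∣ 6 v 6 ∣ 5) ∷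
      (0 ∣ 7 v 1 ∣ 8) ∷ (1 ∣ 4 v 8 ∣ 8) ∷ (1 ∣ 5 v 2 ∣ 6) ∷ (7 ∣ 2 v 8 ∣ 5) ∷ (6 ∣ 2 v 7 ∣ 8) ∷
      (2 ∣ 8 v 7 ∣ 1) ∷ (0 ∣ 2 v 6 ∣ 7) ∷ (5 ∣ 7 v 6 ∣ 8) ∷ (0 ∣ 1 v 5 ∣ 6) ∷ (0 ∣ 8 v 8 ∣ 3) ∷
      (2 ∣ 3 v 6 ∣ 6) ∷ (7 ∣ 3 v 8 ∣ 1) ∷ (0 ∣ 4 v 2 ∣ 5) ∷ (5 ∣ 5 v 6 ∣ 3) ∷ (0 ∣ 6 v 7 ∣ 4) ∷
      (2 ∣ 4 v 5 ∣ 3) ∷ (5 ∣ 4 v 7 ∣ 7) ∷ (6 ∣ 1 v 8 ∣ 4) ∷ []))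

  tournament-9-7 : Tournament 9 (init 7)
  tournament-9-7 = Raw.tournament 8 7 (
      ((7 ∣ 8 v 8 ∣ 7) ∷ (7 ∣ 7 v 8 ∣ 8) ∷ []) ++
      develop 0 7 7
      ((0 ∣ 4 v 1 ∣ 8) ∷ (0 ∣ 3 v 5 ∣ 7) ∷ (0 ∣ 1 v 4 ∣ 2) ∷ (0 ∣ 6 v 7 ∣ 1) ∷ (0 ∣ 2 v 8 ∣ 6) ∷ []))

  tournament-10-0 : Tournament 10 (init 0)
  tournament-10-0 = Raw.tournament 9 0 (
      develop 0 10 5
      ((5 ∣ 4 v 9 ∣ 5) ∷ (5 ∣ 0 v 7 ∣ 9) ∷ (0 ∣ 4 v 5 ∣ 2) ∷ (0 ∣ 1 v 5 ∣ 8) ∷ (0 ∣ 8 v 7 ∣ 3) ∷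
      (0 ∣ 2 v 2 ∣ 7) ∷ (0 ∣ 0 v 8 ∣ 1) ∷ (0 ∣ 9 v 6 ∣ 5) ∷ (0 ∣ 3 v 4 ∣ 6) ∷ (0 ∣ 6 v 9 ∣ 9) ∷ []))

  tournament-10-2 : Tournament 10 (init 2)
  tournament-10-2 = Raw.tournament 9 2 (
      ((3 ∣ 0 v 8 ∣ 1) ∷ (5 ∣ 8 v 9 ∣ 1) ∷ (6 ∣ 1 v 8 ∣ 6) ∷ (0 ∣ 1 v 9 ∣ 3) ∷ (0 ∣ 2 v 4 ∣ 1) ∷
      (5 ∣ 1 v 7 ∣ 5) ∷ (2 ∣ 9 v 3 ∣ 1) ∷ (2 ∣ 1 v 4 ∣ 4) ∷ (6 ∣ 7 v 7 ∣ 1) ∷ (0 ∣ 4 v 5 ∣ 6) ∷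
      (0 ∣ 6 v 7 ∣ 8) ∷ (0 ∣ 9 v 2 ∣ 7) ∷ (0 ∣ 7 v 1 ∣ 5) ∷ (0 ∣ 3 v 6 ∣ 2) ∷ (0 ∣ 8 v 8 ∣ 4) ∷
      (0 ∣ 5 v 3 ∣ 9) ∷ (4 ∣ 9 v 5 ∣ 0) ∷ (6 ∣ 9 v 9 ∣ 2) ∷ (1 ∣ 9 v 8 ∣ 8) ∷ (7 ∣ 4 v 9 ∣ 9) ∷
      (4 ∣ 6 v 8 ∣ 9) ∷ (1 ∣ 3 v 5 ∣ 9) ∷ (6 ∣ 8 v 7 ∣ 9) ∷ (5 ∣ 4 v 6 ∣ 0) ∷ (5 ∣ 3 v 8 ∣ 7) ∷
      (8 ∣ 2 v 9 ∣ 7) ∷ (4 ∣ 2 v 5 ∣ 5) ∷ (8 ∣ 5 v 9 ∣ 4) ∷ (7 ∣ 2 v 8 ∣ 3) ∷ (2 ∣ 5 v 8 ∣ 0) ∷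
      (1 ∣ 8 v 6 ∣ 5) ∷ (2 ∣ 0 v 6 ∣ 3) ∷ (4 ∣ 0 v 9 ∣ 8) ∷ (3 ∣ 7 v 4 ∣ 8) ∷ (2 ∣ 8 v 5 ∣ 2) ∷
      (4 ∣ 5 v 7 ∣ 3) ∷ (3 ∣ 6 v 5 ∣ 7) ∷ (3 ∣ 3 v 9 ∣ 6) ∷ (2 ∣ 4 v 7 ∣ 7) ∷ (1 ∣ 6 v 2 ∣ 2) ∷
      (1 ∣ 4 v 4 ∣ 3) ∷ (1 ∣ 0 v 7 ∣ 6) ∷ (2 ∣ 6 v 9 ∣ 5) ∷ (1 ∣ 7 v 9 ∣ 0) ∷ (3 ∣ 5 v 6 ∣ 4) ∷
      (1 ∣ 2 v 3 ∣ 4) ∷ (2 ∣ 3 v 3 ∣ 8) ∷ (4 ∣ 7 v 6 ∣ 6) ∷ (3 ∣ 2 v 7 ∣ 0) ∷ []))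

  tournament-10-8 : Tournament 10 (init 8)
  tournament-10-8 = Raw.tournament 9 8 (
      -- The first two games are a tournament of players 8 and 9. The other four form a short orbit:
      -- rotation by 4 only exchanges the teams of `0 ∣ 7 v 4 ∣ 3`.
      ((8 ∣ 9 v 9 ∣ 8) ∷ (8 ∣ 8 v 9 ∣ 9) ∷ (0 ∣ 7 v 4 ∣ 3) ∷ (1 ∣ 0 v 5 ∣ 4) ∷ (2 ∣ 1 v 6 ∣ 5) ∷
      (3 ∣ 2 v 7 ∣ 6) ∷ []) ++
      develop 0 8 8
      ((0 ∣ 1 v 3 ∣ 8) ∷ (0 ∣ 3 v 6 ∣ 9) ∷ (0 ∣ 2 v 1 ∣ 7) ∷ (0 ∣ 4 v 8 ∣ 2) ∷ (0 ∣ 5 v 9 ∣ 4) ∷ []))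

  tournament-11-1 : Tournament 11 (init 1)
  tournament-11-1 = Raw.tournament 10 1 (
      develop 1 11 5
      ((0 ∣ 6 v 10 ∣ 3) ∷ (0 ∣ 1 v 2 ∣ 8) ∷ (1 ∣ 3 v 2 ∣ 7) ∷ (1 ∣ 9 v 4 ∣ 8) ∷ (6 ∣ 6 v 7 ∣ 9) ∷
      (1 ∣ 8 v 6 ∣ 3) ∷ (6 ∣ 5 v 8 ∣ 6) ∷ (1 ∣ 1 v 7 ∣ 0) ∷ (1 ∣ 5 v 10 ∣ 1) ∷ (1 ∣ 2 v 9 ∣ 4) ∷
      (1 ∣ 4 v 8 ∣ 9) ∷ (1 ∣ 0 v 6 ∣ 10) ∷ []))

  tournament-11-3 : Tournament 11 (init 3)
  tournament-11-3 = Raw.tournament 10 3 (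
      ((9 ∣ 10 v 10 ∣ 9) ∷ (9 ∣ 9 v 10 ∣ 10) ∷ []) ++
      develop 0 9 3
      ((0 ∣ 4 v 9 ∣ 6) ∷ (6 ∣ 8 v 9 ∣ 5) ∷ (3 ∣ 1 v 9 ∣ 0) ∷ (0 ∣ 1 v 2 ∣ 9) ∷ (3 ∣ 9 v 6 ∣ 6) ∷
      (3 ∣ 4 v 6 ∣ 9) ∷ (3 ∣ 2 v 8 ∣ 5) ∷ (0 ∣ 2 v 4 ∣ 4) ∷ (6 ∣ 2 v 7 ∣ 3) ∷ (6 ∣ 7 v 10 ∣ 2) ∷
      (3 ∣ 0 v 10 ∣ 7) ∷ (0 ∣ 8 v 3 ∣ 7) ∷ (0 ∣ 3 v 10 ∣ 5) ∷ (0 ∣ 7 v 8 ∣ 3) ∷ (0 ∣ 10 v 7 ∣ 1) ∷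
      (0 ∣ 6 v 6 ∣ 10) ∷ (3 ∣ 8 v 7 ∣ 2) ∷ (3 ∣ 5 v 4 ∣ 10) ∷ (0 ∣ 5 v 5 ∣ 8) ∷ []))

  tournament-11-9 : Tournament 11 (init 9)
  tournament-11-9 = Raw.tournament 10 9 (
      ((9 ∣ 10 v 10 ∣ 9) ∷ (9 ∣ 9 v 10 ∣ 10) ∷ []) ++
      develop 0 9 9
      ((0 ∣ 4 v 7 ∣ 10) ∷ (0 ∣ 8 v 1 ∣ 9) ∷ (0 ∣ 3 v 4 ∣ 1) ∷ (0 ∣ 1 v 6 ∣ 2) ∷ (0 ∣ 7 v 9 ∣ 3) ∷
      (0 ∣ 2 v 10 ∣ 5) ∷ []))

  tournament-12-0 : Tournament 12 (init 0)
  tournament-12-0 = Raw.tournament 11 0 (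
      ((10 ∣ 10 v 11 ∣ 11) ∷ (10 ∣ 11 v 11 ∣ 10) ∷ []) ++
      develop 0 10 5
      ((5 ∣ 3 v 11 ∣ 2) ∷ (0 ∣ 5 v 11 ∣ 6) ∷ (0 ∣ 3 v 10 ∣ 5) ∷ (5 ∣ 6 v 10 ∣ 3) ∷ (0 ∣ 2 v 1 ∣ 0) ∷
      (0 ∣ 1 v 5 ∣ 7) ∷ (0 ∣ 6 v 3 ∣ 10) ∷ (0 ∣ 0 v 5 ∣ 9) ∷ (5 ∣ 5 v 9 ∣ 7) ∷ (5 ∣ 2 v 8 ∣ 10) ∷
      (0 ∣ 9 v 6 ∣ 11) ∷ (0 ∣ 7 v 7 ∣ 2) ∷ (0 ∣ 8 v 9 ∣ 3) ∷ (0 ∣ 11 v 8 ∣ 4) ∷ []))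

  tournament-13-3 : Tournament 13 (init 3)
  tournament-13-3 = Raw.tournament 12 3 (
      ((11 ∣ 9 v 12 ∣ 12) ∷ (9 ∣ 10 v 12 ∣ 9) ∷ (10 ∣ 9 v 11 ∣ 10) ∷ (9 ∣ 9 v 10 ∣ 11) ∷
      (10 ∣ 12 v 12 ∣ 11) ∷ (9 ∣ 11 v 11 ∣ 12) ∷ (9 ∣ 12 v 10 ∣ 10) ∷ (11 ∣ 11 v 12 ∣ 10) ∷ []) ++
      develop 0 9 3
      ((0 ∣ 11 v 6 ∣ 2) ∷ (3 ∣ 7 v 7 ∣ 11) ∷ (0 ∣ 4 v 3 ∣ 11) ∷ (6 ∣ 0 v 8 ∣ 9) ∷ (0 ∣ 5 v 2 ∣ 9) ∷
      (3 ∣ 6 v 4 ∣ 9) ∷ (3 ∣ 10 v 8 ∣ 0) ∷ (0 ∣ 10 v 5 ∣ 4) ∷ (0 ∣ 6 v 8 ∣ 10) ∷ (0 ∣ 2 v 4 ∣ 12) ∷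
      (3 ∣ 4 v 6 ∣ 12) ∷ (0 ∣ 12 v 7 ∣ 8) ∷ (3 ∣ 0 v 11 ∣ 2) ∷ (0 ∣ 3 v 11 ∣ 6) ∷ (6 ∣ 8 v 11 ∣ 5) ∷
      (0 ∣ 8 v 9 ∣ 7) ∷ (0 ∣ 7 v 10 ∣ 1) ∷ (0 ∣ 1 v 12 ∣ 5) ∷ (3 ∣ 3 v 12 ∣ 7) ∷ (6 ∣ 6 v 12 ∣ 2) ∷
      (3 ∣ 8 v 6 ∣ 3) ∷ (6 ∣ 5 v 9 ∣ 0) ∷ (6 ∣ 4 v 10 ∣ 3) ∷ (3 ∣ 2 v 9 ∣ 5) ∷ (3 ∣ 1 v 10 ∣ 6) ∷ []))

  tournament-14-0 : Tournament 14 (init 0)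
  tournament-14-0 = Raw.tournament 13 0 (
      develop 0 14 7
      ((0 ∣ 5 v 4 ∣ 7) ∷ (0 ∣ 1 v 1 ∣ 4) ∷ (0 ∣ 7 v 2 ∣ 13) ∷ (0 ∣ 6 v 12 ∣ 10) ∷ (0 ∣ 2 v 13 ∣ 8) ∷
      (0 ∣ 13 v 10 ∣ 9) ∷ (0 ∣ 4 v 7 ∣ 11) ∷ (7 ∣ 7 v 8 ∣ 9) ∷ (7 ∣ 6 v 11 ∣ 7) ∷ (0 ∣ 8 v 7 ∣ 3) ∷
      (0 ∣ 9 v 11 ∣ 6) ∷ (0 ∣ 12 v 8 ∣ 5) ∷ (0 ∣ 0 v 9 ∣ 2) ∷ (7 ∣ 1 v 9 ∣ 0) ∷ []))

  tournament-15-1 : Tournament 15 (init 1)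
  tournament-15-1 = Raw.tournament 14 1 (
      develop 1 15 7
      ((0 ∣ 8 v 1 ∣ 2) ∷ (0 ∣ 1 v 8 ∣ 11) ∷ (8 ∣ 10 v 9 ∣ 14) ∷ (1 ∣ 9 v 5 ∣ 11) ∷ (1 ∣ 13 v 10 ∣ 14) ∷
      (1 ∣ 8 v 8 ∣ 3) ∷ (1 ∣ 7 v 6 ∣ 9) ∷ (1 ∣ 3 v 11 ∣ 10) ∷ (1 ∣ 5 v 2 ∣ 13) ∷ (8 ∣ 5 v 11 ∣ 12) ∷
      (1 ∣ 10 v 12 ∣ 0) ∷ (8 ∣ 6 v 10 ∣ 10) ∷ (1 ∣ 1 v 13 ∣ 6) ∷ (1 ∣ 4 v 14 ∣ 1) ∷ (1 ∣ 0 v 9 ∣ 5) ∷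
      (1 ∣ 6 v 8 ∣ 7) ∷ []))

  tournament-15-3 : Tournament 15 (init 3)
  tournament-15-3 = Raw.tournament 14 3 (
      develop 0 15 3
      ((0 ∣ 1 v 4 ∣ 2) ∷ (0 ∣ 6 v 2 ∣ 9) ∷ (0 ∣ 13 v 12 ∣ 8) ∷ (0 ∣ 2 v 14 ∣ 6) ∷ (0 ∣ 8 v 8 ∣ 5) ∷
      (0 ∣ 7 v 5 ∣ 13) ∷ (0 ∣ 9 v 3 ∣ 10) ∷ (0 ∣ 14 v 11 ∣ 1) ∷ (0 ∣ 12 v 7 ∣ 14) ∷ (0 ∣ 5 v 10 ∣ 3) ∷
      (0 ∣ 11 v 6 ∣ 4) ∷ (0 ∣ 4 v 13 ∣ 12) ∷ (0 ∣ 3 v 9 ∣ 11) ∷ (3 ∣ 12 v 12 ∣ 3) ∷ (3 ∣ 5 v 13 ∣ 11) ∷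
      (3 ∣ 8 v 6 ∣ 5) ∷ (3 ∣ 0 v 9 ∣ 4) ∷ (3 ∣ 9 v 5 ∣ 12) ∷ (3 ∣ 6 v 10 ∣ 1) ∷ (3 ∣ 7 v 14 ∣ 14) ∷
      (3 ∣ 2 v 7 ∣ 13) ∷ (3 ∣ 3 v 6 ∣ 7) ∷ (3 ∣ 4 v 8 ∣ 2) ∷ (3 ∣ 11 v 11 ∣ 6) ∷ (12 ∣ 2 v 13 ∣ 5) ∷
      (6 ∣ 6 v 14 ∣ 4) ∷ (9 ∣ 3 v 10 ∣ 13) ∷ (9 ∣ 8 v 14 ∣ 2) ∷ (9 ∣ 14 v 12 ∣ 11) ∷ (6 ∣ 8 v 10 ∣ 7) ∷
      (9 ∣ 10 v 12 ∣ 6) ∷ (6 ∣ 9 v 11 ∣ 0) ∷ (6 ∣ 2 v 12 ∣ 9) ∷ (6 ∣ 11 v 7 ∣ 12) ∷ (9 ∣ 9 v 13 ∣ 14) ∷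
      (6 ∣ 10 v 13 ∣ 2) ∷ (6 ∣ 1 v 9 ∣ 13) ∷ []))

  tournament-15-13 : Tournament 15 (init 13)
  tournament-15-13 = Raw.tournament 14 13 (
      ((13 ∣ 14 v 14 ∣ 13) ∷ (13 ∣ 13 v 14 ∣ 14) ∷ []) ++
      develop 0 13 13
      ((0 ∣ 7 v 8 ∣ 14) ∷ (0 ∣ 6 v 10 ∣ 7) ∷ (0 ∣ 8 v 4 ∣ 2) ∷ (0 ∣ 12 v 11 ∣ 13) ∷ (0 ∣ 4 v 1 ∣ 6) ∷
      (0 ∣ 2 v 7 ∣ 10) ∷ (0 ∣ 9 v 13 ∣ 5) ∷ (0 ∣ 1 v 14 ∣ 11) ∷ []))

  tournament-16-14 : Tournament 16 (init 14)
  tournament-16-14 = Raw.tournament 15 14 (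
      ((14 ∣ 15 v 15 ∣ 14) ∷ (14 ∣ 14 v 15 ∣ 15) ∷ []) ++
      develop 0 14 7
      ((7 ∣ 11 v 9 ∣ 14) ∷ (0 ∣ 5 v 2 ∣ 14) ∷ (0 ∣ 6 v 1 ∣ 9) ∷ (0 ∣ 1 v 4 ∣ 10) ∷ (0 ∣ 11 v 13 ∣ 12) ∷
      (0 ∣ 15 v 11 ∣ 13) ∷ (0 ∣ 12 v 15 ∣ 6) ∷ (0 ∣ 7 v 14 ∣ 11) ∷ (0 ∣ 10 v 7 ∣ 8) ∷ (0 ∣ 2 v 9 ∣ 7) ∷
      (0 ∣ 3 v 12 ∣ 15) ∷ (0 ∣ 9 v 8 ∣ 1) ∷ (0 ∣ 4 v 10 ∣ 2) ∷ (7 ∣ 4 v 8 ∣ 11) ∷ (7 ∣ 2 v 15 ∣ 13) ∷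
      (7 ∣ 3 v 11 ∣ 2) ∷ (7 ∣ 1 v 14 ∣ 4) ∷ []))

-- Counting the spouse pairs of composed tournaments.

module Schedules where

  open import Data.Bool using (Bool; true; false; if_then_else_; _∨_)
  open import Data.Bool.Properties using (∨-zeroʳ; ∨-identityʳ)
  open import Data.Fin using (Fin; zero; suc; toℕ; _↑ˡ_; _↑ʳ_; combine)
  open import Data.Fin.Properties using (_≟_; suc-injective; toℕ<n)
  open import Data.Nat using (ℕ; zero; suc; _+_; _*_; _∸_; _⊓_; _≤_; _<_; z≤n; s≤s; _<ᵇ_)
  open import Data.Nat.Properties hiding (suc-injective; _≟_)
  open import Data.Product using (∃; _×_; _,_; uncurry)
  open import Data.Sum using (_⊎_; inj₁; inj₂; [_,_]′)
  open import Function using (_∘_; const; id)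
  open import Function.Bundles using (mk↣)
  open import Relation.Binary.PropositionalEquality
    using (_≡_; refl; sym; trans; cong; cong₂; module ≡-Reasoning)
  open import Relation.Nullary using (yes; no; contradiction)
  open Composition
  open Planes
  open Spikes
  open ExplicitTournaments

  trues : ∀ {n} → (Fin n → Bool) → ℕ
  trues {zero}  f = 0
  trues {suc n} f = (if f zero then suc else id) (trues (f ∘ suc))

  trues-cong : ∀ {n} {f h : Fin n → Bool} → (∀ i → f i ≡ h i) → trues f ≡ trues h
  trues-cong {zero}  e = refl
  trues-cong {suc n} e = cong₂ (λ b → if b then suc else id) (e zero) (trues-cong (e ∘ suc))

  trues-+ : ∀ a {b} (f : Fin (a + b) → Bool) → trues f ≡ trues (f ∘ (_↑ˡ b)) + trues (f ∘ (a ↑ʳ_))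
  trues-+ zero    f = refl
  trues-+ (suc a) f with f zero
  ... | true  = cong suc (trues-+ a (f ∘ suc))
  ... | false = trues-+ a (f ∘ suc)

  Σ[_] : ∀ {m} → (Fin m → ℕ) → ℕ
  Σ[_] {zero}  f = 0
  Σ[_] {suc m} f = f zero + Σ[ f ∘ suc ]

  Σ-cong : ∀ {m} {f h : Fin m → ℕ} → (∀ i → f i ≡ h i) → Σ[ f ] ≡ Σ[ h ]
  Σ-cong {zero}  e = refl
  Σ-cong {suc m} e = cong₂ _+_ (e zero) (Σ-cong (e ∘ suc))

  trues-* : ∀ m {D} (f : Fin (m * D) → Bool) → trues f ≡ Σ[ (λ q → trues (λ g → f (combine {m} q g))) ]
  trues-* zero        f = refl
  trues-* (suc m) {D} f = trans (trues-+ D f) (cong (trues (f ∘ (_↑ˡ (m * D))) +_) (trues-* m (f ∘ (D ↑ʳ_))))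

  trues-init : ∀ {n k} → k ≤ n → trues {n} (init k) ≡ k
  trues-init {zero}  z≤n       = refl
  trues-init {suc n} {zero} _  = none n
    where
    none : ∀ n → trues {n} (λ _ → false) ≡ 0
    none zero    = refl
    none (suc n) = none n
  trues-init {suc n} {suc k} (s≤s k≤n) = cong suc (trues-init k≤n)

  trues-true : ∀ n → trues {n} (const true) ≡ n
  trues-true zero    = refl
  trues-true (suc n) = cong suc (trues-true n)

  trues-decode : ∀ {m D t} (S : Point m D t → Bool) →
    trues (S ∘ decode) ≡ Σ[ (λ q → trues (λ g → S (inj₁ (q , g)))) ] + trues (S ∘ inj₂)
  trues-decode {m} {D} {t} S = trans (trues-+ (m * D) (S ∘ decode)) (cong₂ _+_
    (trans (trues-* m _) (Σ-cong {m} λ q → trues-cong λ g → cong S (decode-encode (inj₁ (q , g)))))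
    (trues-cong λ e → cong S (decode-encode {m} {D} (inj₂ e))))

  enumerate : ∀ {n} (S : Fin n → Bool) → Fin (trues S) → Fin n
  enumerate {suc n} S i with S zero
  enumerate {suc n} S zero    | true  = zero
  enumerate {suc n} S (suc i) | true  = suc (enumerate (S ∘ suc) i)
  enumerate {suc n} S i       | false = suc (enumerate (S ∘ suc) i)

  enumerate-injective : ∀ {n} (S : Fin n → Bool) {i j} → enumerate S i ≡ enumerate S j → i ≡ j
  enumerate-injective {suc n} S {i} {j} e with S zero
  enumerate-injective {suc n} S {zero}  {zero}  e | true  = refl
  enumerate-injective {suc n} S {suc i} {suc j} e | true  = cong suc (enumerate-injective (S ∘ suc) (suc-injective e))
  enumerate-injective {suc n} S {i}     {j}     e | false = enumerate-injective (S ∘ suc) (suc-injective e)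

  enumerate-true : ∀ {n} (S : Fin n → Bool) i → S (enumerate S i) ≡ true
  enumerate-true {suc n} S i with S zero in eq
  enumerate-true {suc n} S zero    | true  = eq
  enumerate-true {suc n} S (suc i) | true  = enumerate-true (S ∘ suc) i
  enumerate-true {suc n} S i       | false = enumerate-true (S ∘ suc) i

  enumerate-surjective : ∀ {n} (S : Fin n → Bool) x → S x ≡ true → ∃ λ i → enumerate S i ≡ x
  enumerate-surjective {suc n} S x s with S zero in eq
  enumerate-surjective {suc n} S zero    s | true  = zero , refl
  enumerate-surjective {suc n} S (suc x) s | true  = let i , e = enumerate-surjective (S ∘ suc) x s in suc i , cong suc e
  enumerate-surjective {suc n} S zero    s | false = contradiction (trans (sym s) eq) λ ()
  enumerate-surjective {suc n} S (suc x) s | false = let i , e = enumerate-surjective (S ∘ suc) x s in i , cong suc e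

  module _ {n : ℕ} {S : Fin n → Bool} (T : Tournament n S) where

    open Tournament T

    private
      spouses : SpousePairs n (trues S)
      spouses = record
        { husbands = mk↣ {to = enumerate S} (enumerate-injective S)
        ; wives    = mk↣ {to = enumerate S} (enumerate-injective S) }

      spouse : ∀ x → S x ≡ true → ∃ λ i → enumerate S i ≡ x × enumerate S i ≡ x
      spouse x s = let i , e = enumerate-surjective S x s in i , e , e

      same : ∀ {M} → SameSexOpposition (λ x → S x ≡ true) M → SameSexOpposition (λ x → ∃ λ i → enumerate S i ≡ x) M
      same h = record
        { with-spouse    = λ { x (i , refl) → with-spouse x (enumerate-true S i) }
        ; without-spouse = λ x ¬p → let r , r≢x , ¬r , two , one = without-spouse x (¬p ∘ enumerate-surjective S x)
                                    in r , r≢x , (λ (i , e) → ¬r (trans (cong S (sym e)) (enumerate-true S i))) , two , one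
        } where open SameSexOpposition h

      module P = MixedMeetings partners
      module O = MixedMeetings opponents

    tournament⇒CMDRR : CMDRR n (trues S)
    tournament⇒CMDRR = record
      { spousePairs = spouses
      ; games = games
      ; spouses-not-partners  = λ { m f (i , refl , refl) → P.spouses m (enumerate-true S i) }
      ; spouses-not-opponents = λ { m f (i , refl , refl) → O.spouses m (enumerate-true S i) }
      ; partners-once  = λ m f ¬s → P.others m f (λ { (refl , s) → ¬s (spouse m s) })
      ; opponents-once = λ m f ¬s → O.others m f (λ { (refl , s) → ¬s (spouse m s) })
      ; men-oppose   = same men
      ; women-oppose = same women
      }

  -- Composition scatters the players with a spouse over all indices, so the status stays arbitrary
  -- and only its total is recorded.
  record Schedulable (n k : ℕ) : Set where
    field
      status     : Fin n → Bool
      tournament : Tournament n status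
      total      : trues status ≡ k

  schedulable⇒CMDRR : ∀ {n k} → Schedulable n k → CMDRR n k
  schedulable⇒CMDRR record { tournament = T ; total = refl } = tournament⇒CMDRR T

  initial : ∀ {n k} → k ≤ n → Tournament n (init k) → Schedulable n k
  initial k≤n T = record { tournament = T ; total = trues-init k≤n }

  allSpouses : ∀ {n} → AllSpouses n → Schedulable n n
  allSpouses T = record { tournament = T ; total = trues-true _ }

  -- Row q of a rectangle with rows of length d in which a cells are filled row by row.
  fill : ℕ → ℕ → ℕ → ℕ
  fill d a q = (a ∸ q * d) ⊓ d

  fill≤ : ∀ d a q → fill d a q ≤ d
  fill≤ d a q = m⊓n≤n (a ∸ q * d) d

  Σ-last : ∀ m (f : ℕ → ℕ) → Σ[ (λ (q : Fin (suc m)) → f (toℕ q)) ] ≡ Σ[ (λ (q : Fin m) → f (toℕ q)) ] + f m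
  Σ-last zero    f = +-comm (f 0) 0
  Σ-last (suc m) f = trans (cong (f 0 +_) (Σ-last m (f ∘ suc))) (sym (+-assoc (f 0) _ (f (suc m))))

  -- By induction the first `m` rows hold `a ⊓ (m * d)` filled cells, and the bound on `a` removes
  -- the minimum.
  Σ-fill : ∀ m d a → a ≤ m * d → Σ[ (λ (q : Fin m) → fill d a (toℕ q)) ] ≡ a
  Σ-fill m d a a≤ = trans (go m) (m≤n⇒m⊓n≡m a≤)
    where
    go : ∀ m → Σ[ (λ (q : Fin m) → fill d a (toℕ q)) ] ≡ a ⊓ (m * d)
    go zero    = sym (⊓-zeroʳ a)
    go (suc m) = trans (Σ-last m (fill d a)) (trans (cong (_+ fill d a m) (go m)) step)
      where
      step : a ⊓ (m * d) + (a ∸ m * d) ⊓ d ≡ a ⊓ (d + m * d)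
      step with ≤-total a (m * d)
      ... | inj₁ a≤md = trans (cong₂ _+_ (m≤n⇒m⊓n≡m a≤md) (cong (_⊓ d) (m≤n⇒m∸n≡0 a≤md)))
                          (trans (+-identityʳ a) (sym (m≤n⇒m⊓n≡m (≤-trans a≤md (m≤n+m (m * d) d)))))
      ... | inj₂ md≤a = begin
        a ⊓ (m * d) + (a ∸ m * d) ⊓ d       ≡⟨ cong (_+ ((a ∸ m * d) ⊓ d)) (m≥n⇒m⊓n≡n md≤a) ⟩
        m * d + (a ∸ m * d) ⊓ d             ≡⟨ +-distribˡ-⊓ (m * d) (a ∸ m * d) d ⟩
        (m * d + (a ∸ m * d)) ⊓ (m * d + d) ≡⟨ cong₂ _⊓_ (m+[n∸m]≡n md≤a) (+-comm (m * d) d) ⟩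
        a ⊓ (d + m * d)                     ∎
        where open ≡-Reasoning

  Σ-*ʳ : ∀ {m} (f : Fin m → ℕ) s → Σ[ (λ q → f q * s) ] ≡ Σ[ f ] * s
  Σ-*ʳ {zero}  f s = refl
  Σ-*ʳ {suc m} f s = trans (cong (f zero * s +_) (Σ-*ʳ (f ∘ suc) s)) (sym (*-distribʳ-+ s (f zero) Σ[ f ∘ suc ]))

  init-true : ∀ {n} (i : Fin n) → init n i ≡ true
  init-true zero    = refl
  init-true (suc i) = init-true i

  -- Blocks of size D = d s and D + 1 whose spouses number 0 , s , … , d s, besides the
  -- first point of the larger block.
  record Blocks (d s : ℕ) : Set where
    field
      short : ∀ i → i ≤ d → Tournament (d * s) (init (i * s))
      long  : ∀ i → i ≤ d → Tournament (suc (d * s)) (init (suc (i * s)))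

    short-full : AllSpouses (d * s)
    short-full = Tournament-resp init-true (short d ≤-refl)

    long-full : AllSpouses (suc (d * s))
    long-full = Tournament-resp init-true (long d ≤-refl)

  module _ {d s : ℕ} (B : Blocks d s) where

    open Blocks B

    private
      D : ℕ
      D = d * s

      ▹-init : ∀ {n} k (i : Fin (suc n)) → init (suc k) i ≡ (true ▹ init k) i
      ▹-init k zero    = refl
      ▹-init k (suc _) = refl

      row≤ : ∀ a q → fill d a q * s ≤ D
      row≤ a q = *-monoˡ-≤ s (fill≤ d a q)

    -- The `a` steps of `s` pairs are spread over the `m` blocks of the class, each taking at most
    -- `d`; the hole contributes its `k` pairs independently. The full groups give everyone a
    -- spouse.
    hole-schedulable : ∀ {m u k a} → Plane (suc D) m → AllSpouses m → u ≤ m → Schedulable u k → a ≤ m * d →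
                       Schedulable (m * D + u) (a * s + k)
    hole-schedulable {m} {u} {k} {a} P G u≤m H a≤ = record { tournament = Hole.tournament-hole u≤m P
        {λ _ _ → true} (λ _ → G)
        {λ q → init (row q)} (λ q → short _ (fill≤ d a (toℕ q)))
        (λ q → Tournament-resp (▹-init (row q)) (long _ (fill≤ d a (toℕ q))))
        (Schedulable.tournament H) short-full long-full (λ q → init (row q)) (λ _ _ → inj₁ (refl , refl))
      ; total = trans (trues-decode {m} {D} {u} [ uncurry (λ q → init (row q)) , Schedulable.status H ]′) (cong₂ _+_ rows (Schedulable.total H)) }
      where
      row : Fin m → ℕ
      row q = fill d a (toℕ q) * s

      rows : Σ[ (λ q → trues {D} (init (row q))) ] ≡ a * s
      rows = trans (Σ-cong {m} λ q → trues-init (row≤ a (toℕ q)))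
                   (trans (Σ-*ʳ {m} (λ q → fill d a (toℕ q)) s) (cong (_* s) (Σ-fill m d a a≤)))

    -- In the last two rows the points of the groups b , … , D - 1 lack a spouse already in their groups.
    mixed-schedulable : ∀ {r u k a b} → Plane (suc D) (2 + r) → AllSpouses (2 + r) → Tournament (2 + r) (init r) →
                        b ≤ D → u ≤ 2 + r → Schedulable u k → a ≤ r * d →
                        Schedulable ((2 + r) * D + u) (a * s + 2 * b + k)
    mixed-schedulable {r} {u} {k} {a} {b} P G G′ b≤D u≤m H a≤ = record { tournament = Hole.tournament-hole u≤m P
        {λ g q → init b g ∨ init r q} groups
        {λ q g → if init r q then init (row q) g else true} blocks blocks⁺
        (Schedulable.tournament H) short-full long-full
        (λ q → init (if init r q then row q else b)) home
      ; total = trans (trues-decode {m} {D} {u} [ uncurry (λ q → init (if init r q then row q else b)) , Schedulable.status H ]′)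
                      (cong₂ _+_ rows (Schedulable.total H)) }
      where
      m = 2 + r

      row : Fin m → ℕ
      row q = fill d a (toℕ q) * s

      groups : ∀ g → Tournament m (λ q → init {D} b g ∨ init r q)
      groups g with init b g
      ... | true  = G
      ... | false = G′

      blocks : ∀ q → Tournament D (λ g → if init {m} r q then init (row q) g else true)
      blocks q with init r q
      ... | true  = short _ (fill≤ d a (toℕ q))
      ... | false = short-full

      blocks⁺ : ∀ q → Tournament (suc D) (true ▹ λ g → if init {m} r q then init (row q) g else true)
      blocks⁺ q with init r q
      ... | true  = Tournament-resp (▹-init (row q)) (long _ (fill≤ d a (toℕ q)))
      ... | false = Tournament-resp (λ { zero → refl ; (suc _) → refl }) long-full

      home : ∀ q g → ((init b g ∨ init r q) ≡ true ×
                      (if init r q then init (row q) g else true) ≡ init {D} (if init {m} r q then row q else b) g)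
                   ⊎ ((if init r q then init (row q) g else true) ≡ true ×
                      (init b g ∨ init r q) ≡ init {D} (if init {m} r q then row q else b) g)
      home q g with init r q
      ... | true  = inj₁ (∨-zeroʳ (init b g) , refl)
      -- In the last two rows the blocks of the class give everyone a spouse, which leaves the
      -- decision to the groups.
      ... | false = inj₂ (refl , ∨-identityʳ (init b g))

      width : ℕ → ℕ
      width q = if q <ᵇ r then fill d a q * s else b

      width-below : ∀ {q} → q < r → width q ≡ fill d a q * s
      width-below {q} q<r with q <ᵇ r | <⇒<ᵇ q<r
      ... | true | _ = refl

      width-above : ∀ {q} → r ≤ q → width q ≡ b
      width-above {q} r≤q with q <ᵇ r | <ᵇ⇒< q r
      ... | false | _   = refl
      ... | true  | q<r = contradiction (q<r _) (≤⇒≯ r≤q)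

      width≤ : ∀ q → width q ≤ D
      width≤ q with q <ᵇ r
      ... | true  = row≤ a q
      ... | false = b≤D

      rows : Σ[ (λ (q : Fin m) → trues {D} (init (width (toℕ q)))) ] ≡ a * s + 2 * b
      rows = begin
        Σ[ (λ (q : Fin m) → trues {D} (init (width (toℕ q)))) ]          ≡⟨ Σ-cong {m} (λ q → trues-init (width≤ (toℕ q))) ⟩
        Σ[ (λ (q : Fin m) → width (toℕ q)) ]                             ≡⟨ Σ-last (suc r) width ⟩
        Σ[ (λ (q : Fin (suc r)) → width (toℕ q)) ] + width (suc r)       ≡⟨ cong₂ _+_ (Σ-last r width) (width-above (n≤1+n r)) ⟩
        Σ[ (λ (q : Fin r) → width (toℕ q)) ] + width r + b               ≡⟨ cong₂ (λ x y → x + y + b) (Σ-cong {r} λ q → width-below (toℕ<n q)) (width-above {r} ≤-refl) ⟩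
        Σ[ (λ (q : Fin r) → fill d a (toℕ q) * s) ] + b + b              ≡⟨ cong (λ x → x + b + b) (Σ-*ʳ {r} (λ q → fill d a (toℕ q)) s) ⟩
        Σ[ (λ (q : Fin r) → fill d a (toℕ q)) ] * s + b + b              ≡⟨ cong (λ x → x * s + b + b) (Σ-fill r d a a≤) ⟩
        a * s + b + b                                                    ≡⟨ +-assoc (a * s) b b ⟩
        a * s + (b + b)                                                  ≡⟨ cong (λ x → a * s + (b + x)) (+-identityʳ b) ⟨
        a * s + 2 * b                                                    ∎
        where open ≡-Reasoning

    -- The block of `D + t` points takes the place of row 0 of the class and contributes `k`; the
    -- other `r` rows are filled with the `a` steps.
    spike-schedulable : ∀ {r t k a} (P : Plane (D + t) (suc r)) → Plane.0# P ≡ zero → AllSpouses (suc r) → AllSpouses 1 →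
                        Schedulable (D + t) k → a ≤ r * d → Schedulable (suc r * D + t) (a * s + k)
    spike-schedulable {r} {t} {k} {a} P 0≡0 G T₁ B′ a≤ = record
      { tournament = tournament-spike
      ; total = trans (trues-decode {suc r} {D} {t} spikeStatus) total }
      where
      open Schedulable B′ using (status) renaming (tournament to TB; total to total-B)

      row : Fin (suc r) → ℕ
      -- Filling starts at row 1, hence the shift; the status of row 0 comes from `B′` instead.
      row q = fill d a (toℕ q ∸ 1) * s

      open Spike P G T₁ short-full long-full {λ q → init (row q)} (λ q → short _ (fill≤ d a (toℕ q ∸ 1))) TB

      first : ∀ g → spikeStatus (inj₁ (zero , g)) ≡ status (g ↑ˡ t)
      first g with zero ≟ Plane.0# P
      ... | yes _ = refl
      ... | no ¬e = contradiction (sym 0≡0) ¬e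

      others : ∀ q g → spikeStatus (inj₁ (suc q , g)) ≡ init (row (suc q)) g
      others q g with suc q ≟ Plane.0# P
      ... | yes e = contradiction (trans e 0≡0) λ ()
      ... | no  _ = refl

      rows : Σ[ (λ (q : Fin r) → trues (λ g → spikeStatus (inj₁ (suc q , g)))) ] ≡ a * s
      rows = trans (Σ-cong {r} λ q → trans (trues-cong (others q)) (trues-init (row≤ a (toℕ q))))
                   (trans (Σ-*ʳ {r} (λ q → fill d a (toℕ q)) s) (cong (_* s) (Σ-fill r d a a≤)))

      total : Σ[ (λ q → trues (λ g → spikeStatus (inj₁ (q , g)))) ] + trues (spikeStatus ∘ inj₂) ≡ a * s + k
      total = begin
        trues (λ g → spikeStatus (inj₁ (zero , g))) + Σ[ (λ (q : Fin r) → trues (λ g → spikeStatus (inj₁ (suc q , g)))) ] + trues (status ∘ (D ↑ʳ_))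
          ≡⟨ cong₂ (λ x y → x + y + trues (status ∘ (D ↑ʳ_))) (trues-cong first) rows ⟩
        trues (status ∘ (_↑ˡ t)) + a * s + trues (status ∘ (D ↑ʳ_))
          ≡⟨ cong (_+ trues (status ∘ (D ↑ʳ_))) (+-comm _ (a * s)) ⟩
        a * s + trues (status ∘ (_↑ˡ t)) + trues (status ∘ (D ↑ʳ_))
          ≡⟨ +-assoc (a * s) _ _ ⟩
        a * s + (trues (status ∘ (_↑ˡ t)) + trues (status ∘ (D ↑ʳ_)))
          ≡⟨ cong (a * s +_) (trans (sym (trues-+ D status)) total-B) ⟩
        a * s + k ∎
        where open ≡-Reasoning

-- The finite range below 240.

module SmallSizes where

  open import Data.Fin using (zero; suc)
  import Data.Fin.Properties as Fin
  open import Data.List using (List; []; _∷_; _++_; map; concatMap)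
  open import Data.List.Relation.Unary.Any using (Any; any?)
  open import Data.Nat using (ℕ; zero; suc; _+_; _*_; _∸_; _≤_; _<_; z≤n; s≤s; _/_; _≟_; _≤?_; _<?_; NonZero)
  open import Data.Nat.Coprimality using (Coprime; coprime?)
  open import Data.Nat.Properties hiding (_≟_; _≤?_; _<?_; suc-injective)
  open import Data.Nat.Properties using (allUpTo?)
  open import Data.Product using (∃; ∃₂; _×_; _,_; proj₂)
  open import Function using (const)
  open import Relation.Binary.PropositionalEquality using (_≡_; refl; sym; subst; subst₂)
  open import Relation.Nullary using (Dec; yes; no)
  open import Relation.Nullary.Decidable using (True; toWitness; from-yes; _×-dec_; _→-dec_)
  open Composition
  open Planes
  open LatinSquares
  open ResidueRings
  open GaloisFields
  open Starters
  open ExplicitTournaments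
  open Schedules

  modSpouses : ∀ r → {True (coprime? 2 (suc r))} → {True (coprime? 3 (suc r))} → AllSpouses (suc r)
  modSpouses r {c₂} {c₃} = selfOrthogonal⇒tournament (modSquare (Mod.residues r) (toWitness c₂) (toWitness c₃))

  init-full : ∀ {n} → AllSpouses n → Tournament n (init n)
  init-full = Tournament-resp λ i → sym (init-true i)

  spouses4  = selfOrthogonal⇒tournament square4
  spouses5  = modSpouses 4
  spouses8  = selfOrthogonal⇒tournament square₈
  spouses9  = selfOrthogonal⇒tournament square₉
  spouses10 = selfOrthogonal⇒tournament square10
  spouses11 = modSpouses 10

  spouses1 : AllSpouses 1
  spouses1 = Tournament-resp (λ { zero → refl }) (Raw.tournament 0 1 [])

  blocks4 : Blocks 1 4
  blocks4 = record
    { short = λ { 0 _ → tournament-4-0 ; 1 _ → init-full spouses4 ; (suc (suc _)) (s≤s ()) }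
    ; long  = λ { 0 _ → tournament-5-1 ; 1 _ → init-full spouses5 ; (suc (suc _)) (s≤s ()) } }

  blocks8 : Blocks 4 2
  blocks8 = record
    { short = λ { 0 _ → tournament-8-0 ; 1 _ → tournament-8-2 ; 2 _ → tournament-8-4 ; 3 _ → tournament-8-6
                ; 4 _ → init-full spouses8 ; (suc (suc (suc (suc (suc _))))) (s≤s (s≤s (s≤s (s≤s ())))) }
    ; long  = λ { 0 _ → tournament-9-1 ; 1 _ → tournament-9-3 ; 2 _ → tournament-9-5 ; 3 _ → tournament-9-7
                ; 4 _ → init-full spouses9 ; (suc (suc (suc (suc (suc _))))) (s≤s (s≤s (s≤s (s≤s ())))) } }

  blocks10 : Blocks 1 10
  blocks10 = record
    { short = λ { 0 _ → tournament-10-0 ; 1 _ → init-full spouses10 ; (suc (suc _)) (s≤s ()) }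
    ; long  = λ { 0 _ → tournament-11-1 ; 1 _ → init-full spouses11 ; (suc (suc _)) (s≤s ()) } }

  -- Serves as the hole when no point of the truncated group remains.
  empty : Schedulable 0 0
  empty = record
    { status = λ () ; total = refl
    ; tournament = record { games = [] ; partners = mixed ; opponents = mixed ; men = same ; women = same } }
    where
    mixed : ∀ {M} → MixedMeetings (λ ()) M
    mixed = record { spouses = λ () ; others = λ () }

    same : ∀ {H M} → SameSexOpposition {0} H M
    same = record { with-spouse = λ () ; without-spouse = λ () }

  small : List (∃₂ Schedulable)
  small =
    (_ , _ , empty) ∷ (_ , _ , allSpouses spouses1) ∷ entry 0 tournament-2-0 ∷
    entry 0 tournament-4-0 ∷ (_ , _ , allSpouses spouses4) ∷ entry 1 tournament-5-1 ∷ (_ , _ , allSpouses spouses5) ∷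
    entry 0 tournament-6-0 ∷ entry 4 tournament-6-4 ∷
    entry 1 tournament-7-1 ∷ entry 3 tournament-7-3 ∷ entry 5 tournament-7-5 ∷ (_ , _ , allSpouses (modSpouses 6)) ∷
    entry 0 tournament-8-0 ∷ entry 2 tournament-8-2 ∷ entry 4 tournament-8-4 ∷ entry 6 tournament-8-6 ∷ (_ , _ , allSpouses spouses8) ∷
    entry 1 tournament-9-1 ∷ entry 3 tournament-9-3 ∷ entry 5 tournament-9-5 ∷ entry 7 tournament-9-7 ∷ (_ , _ , allSpouses spouses9) ∷
    entry 0 tournament-10-0 ∷ entry 2 tournament-10-2 ∷ entry 8 tournament-10-8 ∷ (_ , _ , allSpouses spouses10) ∷
    entry 1 tournament-11-1 ∷ entry 3 tournament-11-3 ∷ entry 9 tournament-11-9 ∷ (_ , _ , allSpouses spouses11) ∷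
    entry 0 tournament-12-0 ∷
    entry 3 tournament-13-3 ∷ (_ , _ , allSpouses (modSpouses 12)) ∷
    entry 0 tournament-14-0 ∷ square square14 ∷
    entry 1 tournament-15-1 ∷ entry 3 tournament-15-3 ∷ entry 13 tournament-15-13 ∷ square square15 ∷
    entry 14 tournament-16-14 ∷ square square18 ∷
    square square34 ∷ square square38 ∷ square square42 ∷ square square46 ∷ square square66 ∷ []
    where
    entry : ∀ {n} k → Tournament n (init k) → {True (k ≤? n)} → ∃₂ Schedulable
    entry k T {k≤n} = _ , k , initial (toWitness k≤n) T

    square : ∀ {n} → SelfOrthogonal n → ∃₂ Schedulable
    square L = _ , _ , allSpouses (selfOrthogonal⇒tournament L)

  -- The order of the plane is r + 1; in particular modular 6 below lives over ℤ/7.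
  record Base (K r : ℕ) : Set where
    field
      plane   : Plane K (suc r)
      origin  : Plane.0# plane ≡ zero
      spouses : AllSpouses (suc r)

  -- With at least 4 groups, 2 and 3 are among the numbers required to be coprime to the order, so
  -- the condition for the design also yields the square.
  coprimes⇒base : ∀ x r → (∀ d → 0 < d → d < 4 + x → Coprime d (suc r)) → Base (4 + x) r
  coprimes⇒base x r coprime = record
    { plane   = modPlane (Mod.residues r) coprime
    ; origin  = refl
    ; spouses = selfOrthogonal⇒tournament (modSquare (Mod.residues r) (coprime 2 (s≤s z≤n) (s≤s (s≤s (s≤s z≤n))))
                                                                      (coprime 3 (s≤s z≤n) (s≤s (s≤s (s≤s (s≤s z≤n)))))) }

  coprimes? : ∀ K m → Dec (∀ {d} → d < K → 0 < d → Coprime d m)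
  coprimes? K m = allUpTo? (λ d → (0 <? d) →-dec coprime? d m) K

  Bases : ℕ → Set
  Bases K = List (∃ (Base K))

  modular : ∀ {x} r → {True (coprimes? (4 + x) (suc r))} → ∃ (Base (4 + x))
  modular r {c} = r , coprimes⇒base _ r (λ d 0<d d<K → toWitness c d<K 0<d)

  galois₈ : ∀ {K} → {True (K ≤? 8)} → ∃ (Base K)
  galois₈ {_} {K≤8} = 7 , record { plane = fieldPlane field₈ (toWitness K≤8) ; origin = refl ; spouses = spouses8 }

  galois₉ : ∀ {K} → {True (K ≤? 9)} → ∃ (Base K)
  galois₉ {_} {K≤9} = 8 , record { plane = fieldPlane field₉ (toWitness K≤9) ; origin = refl ; spouses = spouses9 }

  galois₁₆ : ∀ {K} → {True (K ≤? 16)} → ∃ (Base K)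
  galois₁₆ {_} {K≤16} = 15 , record
    { plane = fieldPlane field₁₆ (toWitness K≤16) ; origin = refl ; spouses = selfOrthogonal⇒tournament square₁₆ }

  bases₅ : Bases 5
  bases₅ = modular 6 ∷ galois₈ ∷ galois₉ ∷ modular 10 ∷ modular 12 ∷ galois₁₆ ∷ modular 18 ∷ modular 22 ∷ modular 24 ∷
    modular 28 ∷ modular 34 ∷ modular 36 ∷ modular 40 ∷ modular 42 ∷ modular 46 ∷ modular 48 ∷ modular 52 ∷ []

  bases₉ : Bases 9
  bases₉ = galois₉ ∷ modular 10 ∷ modular 12 ∷ galois₁₆ ∷ modular 16 ∷ modular 18 ∷ modular 22 ∷ []

  bases₁₁ : Bases 11
  bases₁₁ = modular 10 ∷ []

  -- n - 2 j runs over the numbers of spouse pairs with the parity of n.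
  Full : ℕ → Set
  Full n = ∀ j → j * 2 ≤ n → Schedulable n (n ∸ j * 2)

  Below : ℕ → Set
  Below n = ∀ {u} → u < n → 32 ≤ u → Full u

  -- `start`, `step` and `bound` evaluate without the induction hypothesis, and only `schedule` asks
  -- for it. So coverage can be decided before any tournament on a large hole is available.
  record Progression (n : ℕ) : Set where
    field
      start step bound : ℕ
      .{{step≢0}}      : NonZero step
      schedule         : Below n → ∀ i → i ≤ bound → Schedulable n (i * step + start)

  smallOf : ∀ n → List (∃ (Schedulable n))
  smallOf n = concatMap select small
    where
    select : ∃₂ Schedulable → List (∃ (Schedulable n))
    select (n′ , k , s) with n′ ≟ n
    ... | yes refl = (k , s) ∷ []
    ... | no  _    = []

  -- For u ≥ 32 the two least and the two greatest numbers of spouse pairs suffice for the progressions below.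
  holes : ∀ {n} u → u < n → List (∃ λ k → Below n → Schedulable u k)
  holes {n} u u<n with 32 ≤? u
  ... | no  _    = map (λ (k , s) → k , const s) (smallOf u)
  ... | yes 32≤u = concatMap large (0 ∷ 1 ∷ u / 2 ∷ u / 2 ∸ 1 ∷ [])
    where
    large : ℕ → List (∃ λ k → Below n → Schedulable u k)
    large j with j * 2 ≤? u
    ... | yes 2j≤u = (u ∸ j * 2 , λ ih → ih u<n 32≤u j 2j≤u) ∷ []
    ... | no  _    = []

  module _ (n : ℕ) where

    private
      hole-smaller : ∀ {r D u} .{{_ : NonZero D}} → suc r * D + u ≡ n → u < n
      hole-smaller {r} {D@(suc _)} {u} refl = m<n+m u (s≤s z≤n)

    withHole : ∀ {d s} .{{_ : NonZero s}} .{{_ : NonZero (d * s)}} → Blocks d s → ∃ (Base (suc (d * s))) → List (Progression n)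
    withHole {d} {s} B (r , base) with suc r * (d * s) ≤? n
    ... | no _ = []
    ... | yes fits with n ∸ suc r * (d * s) ≤? suc r
    ...   | no _     = []
    ...   | yes u≤m = map progression (holes (n ∸ suc r * (d * s)) (hole-smaller {r} {d * s} (m+[n∸m]≡n fits)))
      where
      progression : (∃ λ k → Below n → Schedulable (n ∸ suc r * (d * s)) k) → Progression n
      progression (k , H) = record
        { start = k ; step = s ; bound = suc r * d
        ; schedule = λ ih i i≤ → subst (λ x → Schedulable x (i * s + k)) (m+[n∸m]≡n fits)
            (hole-schedulable B (Base.plane base) (Base.spouses base) u≤m (H ih) i≤) }

    mixed : ∀ {r} → Base 5 (suc r) → Tournament (2 + r) (init r) → List (Progression n)
    mixed {r} base T with (2 + r) * 4 ≤? n
    ... | no _ = []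
    ... | yes fits with n ∸ (2 + r) * 4 ≤? 2 + r
    ...   | no _     = []
    -- For odd `b` the summand `2 * b` is 2 modulo 4, which shifts the progression to a residue
    -- class that blocks of 4 points do not reach with the same hole.
    ...   | yes u≤m = concatMap (λ H → progression H 1 (from-yes (1 ≤? 4)) ∷ progression H 3 (from-yes (3 ≤? 4)) ∷ [])
                                (holes (n ∸ (2 + r) * 4) (hole-smaller {suc r} {4} (m+[n∸m]≡n fits)))
      where
      progression : (∃ λ k → Below n → Schedulable (n ∸ (2 + r) * 4) k) → ∀ b → b ≤ 4 → Progression n
      progression (k , H) b b≤4 = record
        { start = 2 * b + k ; step = 4 ; bound = r * 1
        ; schedule = λ ih i i≤ → subst₂ Schedulable (m+[n∸m]≡n fits) (+-assoc (i * 4) (2 * b) k)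
            (mixed-schedulable blocks4 {a = i} (Base.plane base) (Base.spouses base) T b≤4 u≤m (H ih) i≤) }

    spike : ∀ {t} → ∃ (Base (4 + t)) → List (Progression n)
    spike {t} (r , base) with suc r * 4 + t ≟ n
    ... | no  _ = []
    ... | yes e = map (λ (k , B) → record
        { start = k ; step = 4 ; bound = r * 1
        ; schedule = λ _ i i≤ → subst (λ x → Schedulable x (i * 4 + k)) e
            (spike-schedulable blocks4 (Base.plane base) (Base.origin base) (Base.spouses base) spouses1 B i≤) })
        (smallOf (4 + t))

    direct : List (Progression n)
    direct = map (λ (k , s) → record
      { start = k ; step = 1 ; bound = 0
      ; schedule = λ { _ zero _ → s ; _ (suc _) () } }) (smallOf n)

    progressions : List (Progression n)
    progressions = direct
      ++ concatMap (withHole blocks4) bases₅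
      ++ concatMap (withHole blocks8) bases₉
      ++ concatMap (withHole blocks10) bases₁₁
      ++ mixed (proj₂ galois₈) tournament-8-6
      ++ mixed (proj₂ galois₉) tournament-9-7
      ++ mixed (proj₂ (modular 10)) tournament-11-9
      ++ mixed (proj₂ galois₁₆) tournament-16-14
      ++ concatMap (spike {3}) (modular 10 ∷ galois₁₆ ∷ [])
      ++ concatMap (spike {4}) (modular 12 ∷ modular 28 ∷ modular 40 ∷ modular 42 ∷ modular 52 ∷ [])
      ++ concatMap (spike {5}) (modular 12 ∷ modular 28 ∷ modular 40 ∷ modular 42 ∷ modular 52 ∷ [])
      ++ concatMap (spike {6}) (modular 10 ∷ modular 12 ∷ galois₁₆ ∷ modular 18 ∷ modular 28 ∷ modular 40 ∷ modular 42 ∷ modular 52 ∷ [])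

  module _ {n : ℕ} (k : ℕ) where

    -- The quotient is the only possible index. When `k` is below `start`, truncated subtraction
    -- gives index 0 and the equation fails, as it should.
    Covers : Progression n → Set
    Covers p = let open Progression p ; i = (k ∸ start) / step in i * step + start ≡ k × i ≤ bound

    covers? : ∀ p → Dec (Covers p)
    covers? p = let open Progression p ; i = (k ∸ start) / step in (i * step + start ≟ k) ×-dec (i ≤? bound)

  covered? : ∀ {n} (ps : List (Progression n)) → Dec (∀ {j} → j < suc (n / 2) → Any (Covers (n ∸ j * 2)) ps)
  covered? {n} ps = allUpTo? (λ j → any? (covers? (n ∸ j * 2)) ps) (suc (n / 2))

  abstract
    -- The 208 sizes from 32 to 239 are settled by evaluation; `abstract` keeps the result from
    -- being unfolded again.
    allCovered : ∀ {i} → i < 208 → ∀ {j} → j < suc ((32 + i) / 2) → Any (Covers ((32 + i) ∸ j * 2)) (progressions (32 + i))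
    allCovered = toWitness {a? = allUpTo? (λ i → covered? (progressions (32 + i))) 208} _

-- Sizes from 240 on, and the induction.

open import Data.Bool using (if_then_else_)
open import Data.Fin using (Fin; toℕ)
import Data.Fin.Properties as Fin
open import Data.List.Relation.Unary.Any using (satisfied)
open import Data.Nat
  using (ℕ; suc; _+_; _*_; _∸_; _⊓_; _≤_; _<_; z≤n; s≤s; s≤s⁻¹; _<ᵇ_; _%_; _/_; _≤?_; _<?_)
open import Data.Nat.Coprimality using (Coprime; coprime?)
open import Data.Nat.DivMod using (m≡m%n+[m/n]*n; m%n<n; _divMod_; result; m/n*n≤m; m*n/n≡m; /-monoˡ-≤)
open import Data.Nat.Divisibility using (_∣_; divides; ∣-trans; ∣n⇒∣m*n; ∣m+n∣m⇒∣n; _∣?_)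
open import Data.Nat.Induction using (<-rec)
open import Data.Nat.Properties hiding (_≟_; _≤?_; _<?_; suc-injective)
open import Data.Nat.Tactic.RingSolver using (solve-∀)
open import Data.Product using (∃; _×_; _,_; proj₁; proj₂)
open import Data.Sum using (inj₁; inj₂)
open import Relation.Binary.PropositionalEquality
  using (_≡_; refl; sym; trans; cong; cong₂; subst; module ≡-Reasoning)
open import Relation.Nullary using (yes; no)
open import Relation.Nullary.Decidable using (from-yes; _×-dec_; _→-dec_)
open Planes
open Schedules
open SmallSizes

scheduleOf : ∀ {n k} → Below n → (∃ λ (p : Progression n) → Covers k p) → Schedulable n k
scheduleOf ih (p , e , i≤) = subst (Schedulable _) e (Progression.schedule p ih _ i≤)

full-small : ∀ i → i < 208 → Below (32 + i) → Full (32 + i)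
full-small i i<208 ih j 2j≤n =
  scheduleOf ih (satisfied (allCovered i<208 (s≤s (subst (_≤ (32 + i) / 2) (m*n/n≡m j 2) (/-monoˡ-≤ 2 2j≤n)))))

-- The j-th number of spouse pairs below the maximum, with c blocks of the parallel class free of spouses.
full-hole : ∀ {m u} → u ≤ m → Plane 5 m → AllSpouses m → Full u → 2 ≤ u → Full (m * 4 + u)
full-hole {m} {u} u≤m P G H 2≤u j 2j≤n = subst (Schedulable _) total
  (hole-schedulable blocks4 P G u≤m (H (j ∸ 2 * c) rest≤u) (≤-trans (m∸n≤m m c) (≤-reflexive (sym (*-identityʳ m)))))
  where
  c : ℕ
  -- Removing the spouses of one block lowers the number of pairs by 4 and so accounts for 2 units
  -- of `j`. As many blocks as possible are used; the hole absorbs the rest.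
  c = m ⊓ (j / 2)

  c≤m : c ≤ m
  c≤m = m⊓n≤m m (j / 2)

  2c≤j : 2 * c ≤ j
  2c≤j = ≤-trans (*-monoʳ-≤ 2 (m⊓n≤n m (j / 2))) (≤-trans (≤-reflexive (*-comm 2 (j / 2))) (m/n*n≤m j 2))

  rest≤u : (j ∸ 2 * c) * 2 ≤ u
  rest≤u with ≤-total m (j / 2)
  ... | inj₁ m≤ = begin
    (j ∸ 2 * c) * 2           ≡⟨ cong (λ x → (j ∸ 2 * x) * 2) (m≤n⇒m⊓n≡m m≤) ⟩
    (j ∸ 2 * m) * 2           ≡⟨ *-distribʳ-∸ 2 j (2 * m) ⟩
    j * 2 ∸ 2 * m * 2         ≡⟨ cong (j * 2 ∸_) (four m) ⟩
    j * 2 ∸ m * 4             ≤⟨ ∸-monoˡ-≤ (m * 4) 2j≤n ⟩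
    m * 4 + u ∸ m * 4         ≡⟨ m+n∸m≡n (m * 4) u ⟩
    u                         ∎
    where
    open ≤-Reasoning
    four : ∀ m → 2 * m * 2 ≡ m * 4
    four = solve-∀
  -- The blocks account for all of `j` except its parity, so the hole must lower its number of pairs
  -- by 0 or 2, and `2 ≤ u` is enough.
  ... | inj₂ ≤m = begin
    (j ∸ 2 * c) * 2           ≡⟨ cong (λ x → (j ∸ 2 * x) * 2) (m≥n⇒m⊓n≡n ≤m) ⟩
    (j ∸ 2 * (j / 2)) * 2     ≤⟨ *-monoˡ-≤ 2 odd ⟩
    2                         ≤⟨ 2≤u ⟩
    u                         ∎
    where
    open ≤-Reasoning
    odd : j ∸ 2 * (j / 2) ≤ 1
    odd = begin
      j ∸ 2 * (j / 2)                         ≡⟨ cong₂ _∸_ (m≡m%n+[m/n]*n j 2) (*-comm 2 (j / 2)) ⟩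
      (j % 2 + j / 2 * 2) ∸ j / 2 * 2         ≡⟨ m+n∸n≡m (j % 2) (j / 2 * 2) ⟩
      j % 2                                   ≤⟨ s≤s⁻¹ (m%n<n j 2) ⟩
      1                                       ∎

  total : (m ∸ c) * 4 + (u ∸ (j ∸ 2 * c) * 2) ≡ m * 4 + u ∸ j * 2
  total = sym (begin
    m * 4 + u ∸ j * 2                             ≡⟨ cong₂ (λ x y → x * 4 + u ∸ y * 2) (sym (m∸n+n≡m c≤m)) (sym (m∸n+n≡m 2c≤j)) ⟩
    (a + c) * 4 + u ∸ (b + 2 * c) * 2             ≡⟨ cong₂ _∸_ (regroup₁ a c u) (regroup₂ b c) ⟩
    (c * 4 + (a * 4 + u)) ∸ (c * 4 + b * 2)       ≡⟨ [m+n]∸[m+o]≡n∸o (c * 4) (a * 4 + u) (b * 2) ⟩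
    a * 4 + u ∸ b * 2                             ≡⟨ +-∸-assoc (a * 4) rest≤u ⟩
    a * 4 + (u ∸ b * 2)                           ∎)
    where
    open ≡-Reasoning
    a = m ∸ c
    b = j ∸ 2 * c
    regroup₁ : ∀ a c u → (a + c) * 4 + u ≡ c * 4 + (a * 4 + u)
    regroup₁ = solve-∀
    regroup₂ : ∀ b c → (b + 2 * c) * 2 ≡ c * 4 + b * 2
    regroup₂ = solve-∀

-- 1 + below₁₂ ρ is the largest number coprime to 12 that is at most 1 + ρ.
below₁₂ : Fin 12 → ℕ
below₁₂ ρ = if toℕ ρ <ᵇ 4 then 0 else if toℕ ρ <ᵇ 6 then 4 else if toℕ ρ <ᵇ 10 then 6 else 10

-- The residues 1, 5, 7, 11 and then 13 follow each other at distance at most 4, so at most 3 is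
-- lost.
below₁₂-bounds : ∀ ρ → below₁₂ ρ ≤ toℕ ρ × toℕ ρ ≤ 3 + below₁₂ ρ
below₁₂-bounds = from-yes (Fin.all? λ ρ → (below₁₂ ρ ≤? toℕ ρ) ×-dec (toℕ ρ ≤? 3 + below₁₂ ρ))

-- Since 1, 2, 3 and 4 all divide 12, being coprime to them depends only on the residue modulo 12;
-- the second component carries this to `q * 12 + suc (below₁₂ ρ)`.
below₁₂-coprime : ∀ ρ {d} → d < 5 → 0 < d → Coprime d (suc (below₁₂ ρ)) × d ∣ 12
below₁₂-coprime = from-yes (Fin.all? λ ρ → allUpTo? (λ d → (0 <? d) →-dec (coprime? d (suc (below₁₂ ρ)) ×-dec (d ∣? 12))) 5)

coprime-shift : ∀ {d c r} q → d ∣ c → Coprime d r → Coprime d (q * c + r)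
coprime-shift q d∣c cop (x , y) = cop (x , ∣m+n∣m⇒∣n y (∣n⇒∣m*n q (∣-trans x d∣c)))

base-near : ∀ t → ∃ λ r → Base 5 r × r ≤ t × t ≤ 3 + r
base-near t with t divMod 12
... | result q ρ refl = q * 12 + below₁₂ ρ
    , coprimes⇒base 1 _ (λ d 0<d d<5 → let cop , d∣12 = below₁₂-coprime ρ d<5 0<d in
        subst (Coprime d) (+-suc (q * 12) (below₁₂ ρ)) (coprime-shift q d∣12 cop))
    , ≤-trans (≤-reflexive (+-comm (q * 12) (below₁₂ ρ))) (+-monoˡ-≤ (q * 12) (proj₁ (below₁₂-bounds ρ)))
    , ≤-trans (+-monoˡ-≤ (q * 12) (proj₂ (below₁₂-bounds ρ))) (≤-reflexive (cong (3 +_) (+-comm (below₁₂ ρ) (q * 12))))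

-- The choice of `t` makes `suc t` the largest `m` with `m * 4 + 32 ≤ n`. Descending to a suitable
-- `m` loses at most 3, so `u` grows by at most 12 beyond the remainder and stays within
-- `32 + 3 + 12 = 47`. Since `47 * 4 + 47 = 235` is at most 240, `m` is at least 47, so `u ≤ m`.
full-large : ∀ {n} → 240 ≤ n → Below n → Full n
full-large {n} 240≤n ih with base-near ((n ∸ 36) / 4)
... | r , base , lower , upper = subst Full (m+[n∸m]≡n fits)
        (full-hole u≤m (Base.plane base) (Base.spouses base) (ih u<n 32≤u) (≤-trans (s≤s (s≤s z≤n)) 32≤u))
  where
  open ≤-Reasoning
  t = (n ∸ 36) / 4
  m = suc r
  u = n ∸ m * 4

  t-lower : t * 4 ≤ n ∸ 36
  t-lower = m/n*n≤m (n ∸ 36) 4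

  36≤n : 36 ≤ n
  36≤n = ≤-trans (from-yes (36 ≤? 240)) 240≤n

  t-upper : n ≤ t * 4 + 39
  t-upper = begin
    n                                    ≡⟨ m∸n+n≡m 36≤n ⟨
    n ∸ 36 + 36                          ≡⟨ cong (_+ 36) (m≡m%n+[m/n]*n (n ∸ 36) 4) ⟩
    (n ∸ 36) % 4 + t * 4 + 36            ≤⟨ +-monoˡ-≤ 36 (+-monoˡ-≤ (t * 4) (s≤s⁻¹ (m%n<n (n ∸ 36) 4))) ⟩
    3 + t * 4 + 36                       ≡⟨ cong (_+ 36) (+-comm 3 (t * 4)) ⟩
    t * 4 + 3 + 36                       ≡⟨ +-assoc (t * 4) 3 36 ⟩
    t * 4 + 39                           ∎

  m+32≤n : m * 4 + 32 ≤ n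
  m+32≤n = begin
    m * 4 + 32             ≤⟨ +-monoˡ-≤ 32 (*-monoˡ-≤ 4 (s≤s lower)) ⟩
    suc t * 4 + 32         ≡⟨ +-comm (4 + t * 4) 32 ⟩
    36 + t * 4             ≤⟨ +-monoʳ-≤ 36 t-lower ⟩
    36 + (n ∸ 36)          ≡⟨ m+[n∸m]≡n 36≤n ⟩
    n                      ∎

  fits : m * 4 ≤ n
  fits = ≤-trans (m≤m+n (m * 4) 32) m+32≤n

  32≤u : 32 ≤ u
  32≤u = m+n≤o⇒n≤o∸m (m * 4) m+32≤n
    where
    m+n≤o⇒n≤o∸m : ∀ a {b c} → a + b ≤ c → b ≤ c ∸ a
    m+n≤o⇒n≤o∸m a {b} h = ≤-trans (≤-reflexive (sym (m+n∸m≡n a b))) (∸-monoˡ-≤ a h)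

  u<n : u < n
  u<n = ∸-monoʳ-< {o = 0} (s≤s z≤n) fits

  u≤47 : u ≤ 47
  u≤47 = begin
    n ∸ m * 4                      ≤⟨ ∸-monoˡ-≤ (m * 4) (≤-trans t-upper (+-monoˡ-≤ 39 (*-monoˡ-≤ 4 upper))) ⟩
    (2 + m) * 4 + 39 ∸ m * 4       ≡⟨ cong (_∸ m * 4) (regroup m) ⟩
    m * 4 + 47 ∸ m * 4             ≡⟨ m+n∸m≡n (m * 4) 47 ⟩
    47                             ∎
    where
    regroup : ∀ m → (2 + m) * 4 + 39 ≡ m * 4 + 47
    regroup = solve-∀

  47≤m : 47 ≤ m
  47≤m = *-cancelʳ-≤ 47 m 4 (+-cancelʳ-≤ 47 (47 * 4) (m * 4) (begin
    47 * 4 + 47                    ≤⟨ from-yes (47 * 4 + 47 ≤? 240) ⟩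
    240                            ≤⟨ 240≤n ⟩
    n                              ≡⟨ m+[n∸m]≡n fits ⟨
    m * 4 + u                      ≤⟨ +-monoʳ-≤ (m * 4) u≤47 ⟩
    m * 4 + 47                     ∎))

  u≤m : u ≤ m
  u≤m = ≤-trans u≤47 47≤m

-- The induction hypothesis enters on both sides of 240, because holes of 32 or more points already
-- occur among the progressions for smaller `n`.
full : ∀ n → 32 ≤ n → Full n
full = <-rec (λ n → 32 ≤ n → Full n) step
  where
  step : ∀ n → (∀ {u} → u < n → 32 ≤ u → Full u) → 32 ≤ n → Full n
  step n ih 32≤n with n <? 240
  ... | no  n≮240 = full-large (≮⇒≥ n≮240) ih
  ... | yes n<240 = subst (λ x → Below x → Full x) (m+[n∸m]≡n 32≤n)
                      (full-small (n ∸ 32) (∸-monoˡ-< n<240 32≤n)) ih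

theorem4 : (n k : ℕ) → 32 ≤ n → k ≤ n → 2 ∣ n ∸ k → CMDRR n k
theorem4 n k 32≤n k≤n (divides j e) =
  schedulable⇒CMDRR (subst (Schedulable n) (trans (cong (n ∸_) (sym e)) (m∸[m∸n]≡n k≤n))
    (full n 32≤n j (≤-trans (≤-reflexive (sym e)) (m∸n≤m n k))))
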